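{- There is a polynomial-time algorithm that, given $n$ points in the Euclidean plane and a positive integer $k\le n$, constructs a tree spanning at least $k$ of these points such that the total length of the tree is at most $O(k^{1/4})$ times that of a minimum-length tree spanning any $k$ of the points.
   Context: A tree spanning a subset of the points is a tree whose vertices are the points of the subset, each edge having length equal to the Euclidean distance between its endpoints; the length of the tree is the sum of its edge lengths. The minimum is over all choices of $k$ of the points and all trees spanning them. The constant hidden in $O(\cdot)$ is absolute. -}

module Defs where

open import Algebra.Bundles using (CommutativeRing)
open import Algebra.Structures using (IsCommutativeRing)
import Algebra.Definitions.RawMonoid as RawMonoidOps
open import Data.Bool using (Bool; true; false; if_then_else_; not; _∧_)
open import Data.Fin using (Fin; zero; suc; toℕ)
open import Data.Fin.Subset using (Subset; _∈_; ∣_∣; Nonempty)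
open import Data.List using (List; []; _∷_)
open import Data.List.Relation.Unary.Unique.Propositional using (Unique)
open import Data.Nat as ℕ using (ℕ; zero; suc)
open import Data.Product using (Σ; ∃; ∃-syntax; _×_; _,_; proj₁; proj₂)
open import Data.Sum using (_⊎_)
open import Data.Vec.Functional using (Vector)
open import Function.Bundles using (_⇔_)
open import Relation.Binary.Core using (Rel)
open import Relation.Binary.Structures using (IsDecTotalOrder)
open import Relation.Binary.PropositionalEquality using (_≡_; _≢_)
open import Relation.Nullary using (¬_; ⌊_⌋)
open import Level using (0ℓ)

------------------------------------------------------------------------
-- The real numbers, as a Dedekind-complete ordered field.
--
-- The order is decidable because exact comparison is an elementary step
-- of the machine below.  Division and square root are total; the fields
-- marked (junk) fix their values outside the usual domains, so that the
-- record determines its operations up to isomorphism.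

record RealNumbers : Set₁ where
  infix  4 _≤_
  infixl 6 _+_ _-_
  infixl 7 _*_
  infix  8 -_
  infix  9 _⁻¹
  field
    ℝ     : Set
    _+_   : ℝ → ℝ → ℝ
    _*_   : ℝ → ℝ → ℝ
    -_    : ℝ → ℝ
    0#    : ℝ
    1#    : ℝ
    _⁻¹   : ℝ → ℝ
    √     : ℝ → ℝ
    _≤_   : Rel ℝ 0ℓ

    isCommutativeRing : IsCommutativeRing _≡_ _+_ _*_ -_ 0# 1#
    0≢1               : 0# ≢ 1#
    ⁻¹-inverseʳ       : ∀ x → x ≢ 0# → x * x ⁻¹ ≡ 1#
    0⁻¹≡0             : 0# ⁻¹ ≡ 0#                                 -- (junk)

    isDecTotalOrder   : IsDecTotalOrder _≡_ _≤_
    +-monoʳ-≤         : ∀ x {y z} → y ≤ z → x + y ≤ x + z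
    *-nonNeg          : ∀ {x y} → 0# ≤ x → 0# ≤ y → 0# ≤ x * y

    supremum          : (S : ℝ → Set) → ∃ S →
                        (∃[ b ] ∀ x → S x → x ≤ b) →
                        ∃[ s ] (∀ x → S x → x ≤ s) ×
                               (∀ b → (∀ x → S x → x ≤ b) → s ≤ b)

    √-nonNeg          : ∀ x → 0# ≤ √ x
    √-square          : ∀ {x} → 0# ≤ x → √ x * √ x ≡ x
    √-neg             : ∀ {x} → x ≤ 0# → √ x ≡ 0#                  -- (junk)

  open IsDecTotalOrder isDecTotalOrder public using (_≤?_)

  commutativeRing : CommutativeRing 0ℓ 0ℓ
  commutativeRing = record { isCommutativeRing = isCommutativeRing }

  open RawMonoidOps (CommutativeRing.+-rawMonoid commutativeRing) public
    using (sum)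

  _-_ : ℝ → ℝ → ℝ
  x - y = x + (- y)

  fromℕ : ℕ → ℝ
  fromℕ zero    = 0#
  fromℕ (suc n) = 1# + fromℕ n

------------------------------------------------------------------------
-- Trees on a subset of the index set Fin n.
--
-- Edges are given as an indexed family, so loops and repeated edges are
-- not excluded beforehand; each would be a cycle (of length one or two)
-- and is therefore ruled out by acyclicity.

record Graph (n : ℕ) : Set where
  field
    vertices : Subset n
    edges#   : ℕ
    edge     : Vector (Fin n × Fin n) edges#

module _ {n : ℕ} (G : Graph n) where
  open Graph G

  Joins : Fin edges# → Fin n → Fin n → Set
  Joins j u v = edge j ≡ (u , v) ⊎ edge j ≡ (v , u)

  infixr 5 _∷⟨_⟩_

  data Walk : Fin n → Fin n → Set where
    []      : ∀ {u} → Walk u u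
    _∷⟨_⟩_  : ∀ {u v w} (j : Fin edges#) → Joins j u v → Walk v w → Walk u w

  edgesOf : ∀ {u v} → Walk u v → List (Fin edges#)
  edgesOf []            = []
  edgesOf (j ∷⟨ _ ⟩ w)  = j ∷ edgesOf w

  -- The start vertex of every step; the final vertex is not listed.
  sourcesOf : ∀ {u v} → Walk u v → List (Fin n)
  sourcesOf []                    = []
  sourcesOf (_∷⟨_⟩_ {u = u} _ _ w) = u ∷ sourcesOf w

  IsCycle : ∀ {u} → Walk u u → Set
  IsCycle w = edgesOf w ≢ [] × Unique (edgesOf w) × Unique (sourcesOf w)

  record IsTree : Set where
    field
      nonempty  : Nonempty vertices
      endpoints : ∀ j → proj₁ (edge j) ∈ vertices × proj₂ (edge j) ∈ vertices
      connected : ∀ {u v} → u ∈ vertices → v ∈ vertices → Walk u v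
      acyclic   : ∀ {u} (w : Walk u u) → ¬ IsCycle w

------------------------------------------------------------------------
-- Programs of the real RAM.
--
-- Memory consists of countably many arrays of natural numbers and
-- countably many arrays of reals, each indexed by ℕ.  Index arithmetic
-- has addition and truncated subtraction but no multiplication, so after
-- t unit-cost steps the naturals in memory have O(t) more bits than the
-- input.  There is no conversion (such as a floor) from reals to naturals,
-- and the only real constants are 0 and 1.

infixl 6 _⊕_ _⊖_ _+ᴿ_
infixl 7 _*ᴿ_
infix  4 _≤ᴺ_ _≤ᴿ_

data NatExp : Set where
  lit      : ℕ → NatExp
  _[_]ᴺ    : ℕ → NatExp → NatExp
  _⊕_ _⊖_  : NatExp → NatExp → NatExp

data RealExp : Set where
  0ᴿ 1ᴿ        : RealExp
  _[_]ᴿ        : ℕ → NatExp → RealExp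
  _+ᴿ_ _*ᴿ_    : RealExp → RealExp → RealExp
  -ᴿ_ _⁻¹ᴿ √ᴿ  : RealExp → RealExp

data Test : Set where
  _≤ᴺ_  : NatExp → NatExp → Test
  _≤ᴿ_  : RealExp → RealExp → Test
  notᵀ  : Test → Test
  _∧ᵀ_  : Test → Test → Test

infixr 3 _⨾_
infix  5 _[_]ᴺ≔_ _[_]ᴿ≔_

data Program : Set where
  skip      : Program
  _[_]ᴺ≔_   : ℕ → NatExp → NatExp → Program
  _[_]ᴿ≔_   : ℕ → NatExp → RealExp → Program
  _⨾_       : Program → Program → Program
  ifᴾ       : Test → Program → Program → Program
  while     : Test → Program → Program

write : {A : Set} → (ℕ → ℕ → A) → ℕ → ℕ → A → (ℕ → ℕ → A)
write m a i x b j = if ⌊ a ℕ.≟ b ⌋ ∧ ⌊ i ℕ.≟ j ⌋ then x else m b j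

module Plane (R : RealNumbers) where
  open RealNumbers R

  ----------------------------------------------------------------------
  -- Execution

  record State : Set where
    constructor ⟨_,_⟩
    field
      nat  : ℕ → ℕ → ℕ
      real : ℕ → ℕ → ℝ
  open State public

  ⟦_⟧ᴺ : NatExp → State → ℕ
  ⟦ lit m ⟧ᴺ     s = m
  ⟦ a [ e ]ᴺ ⟧ᴺ  s = nat s a (⟦ e ⟧ᴺ s)
  ⟦ e ⊕ f ⟧ᴺ     s = ⟦ e ⟧ᴺ s ℕ.+ ⟦ f ⟧ᴺ s
  ⟦ e ⊖ f ⟧ᴺ     s = ⟦ e ⟧ᴺ s ℕ.∸ ⟦ f ⟧ᴺ s

  ⟦_⟧ᴿ : RealExp → State → ℝ
  ⟦ 0ᴿ ⟧ᴿ        s = 0#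
  ⟦ 1ᴿ ⟧ᴿ        s = 1#
  ⟦ a [ e ]ᴿ ⟧ᴿ  s = real s a (⟦ e ⟧ᴺ s)
  ⟦ e +ᴿ f ⟧ᴿ    s = ⟦ e ⟧ᴿ s + ⟦ f ⟧ᴿ s
  ⟦ e *ᴿ f ⟧ᴿ    s = ⟦ e ⟧ᴿ s * ⟦ f ⟧ᴿ s
  ⟦ -ᴿ e ⟧ᴿ      s = - ⟦ e ⟧ᴿ s
  ⟦ e ⁻¹ᴿ ⟧ᴿ     s = ⟦ e ⟧ᴿ s ⁻¹
  ⟦ √ᴿ e ⟧ᴿ      s = √ (⟦ e ⟧ᴿ s)

  ⟦_⟧ᵀ : Test → State → Bool
  ⟦ e ≤ᴺ f ⟧ᵀ  s = ⌊ ⟦ e ⟧ᴺ s ℕ.≤? ⟦ f ⟧ᴺ s ⌋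
  ⟦ e ≤ᴿ f ⟧ᵀ  s = ⌊ ⟦ e ⟧ᴿ s ≤? ⟦ f ⟧ᴿ s ⌋
  ⟦ notᵀ b ⟧ᵀ  s = not (⟦ b ⟧ᵀ s)
  ⟦ b ∧ᵀ c ⟧ᵀ  s = ⟦ b ⟧ᵀ s ∧ ⟦ c ⟧ᵀ s

  -- P , s ⇓[ t ] s′ : started in s, P halts in s′ after t steps.  Each
  -- assignment and each evaluation of a test is one step; expressions have
  -- a size fixed by the program, so this counts the elementary operations
  -- up to a constant factor.
  infix 2 _,_⇓[_]_

  data _,_⇓[_]_ : Program → State → ℕ → State → Set where
    skip : ∀ {s} → skip , s ⇓[ 1 ] s

    assignᴺ : ∀ {s a i e} → (a [ i ]ᴺ≔ e) , s ⇓[ 1 ]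
              ⟨ write (nat s) a (⟦ i ⟧ᴺ s) (⟦ e ⟧ᴺ s) , real s ⟩

    assignᴿ : ∀ {s a i e} → (a [ i ]ᴿ≔ e) , s ⇓[ 1 ]
              ⟨ nat s , write (real s) a (⟦ i ⟧ᴺ s) (⟦ e ⟧ᴿ s) ⟩

    seq : ∀ {P Q s s′ s″ t t′} →
          P , s ⇓[ t ] s′ → Q , s′ ⇓[ t′ ] s″ →
          (P ⨾ Q) , s ⇓[ t ℕ.+ t′ ] s″

    if-true  : ∀ {b P Q s s′ t} → ⟦ b ⟧ᵀ s ≡ true →
               P , s ⇓[ t ] s′ → ifᴾ b P Q , s ⇓[ suc t ] s′

    if-false : ∀ {b P Q s s′ t} → ⟦ b ⟧ᵀ s ≡ false →
               Q , s ⇓[ t ] s′ → ifᴾ b P Q , s ⇓[ suc t ] s′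

    while-true  : ∀ {b P s s′ s″ t t′} → ⟦ b ⟧ᵀ s ≡ true →
                  P , s ⇓[ t ] s′ → while b P , s′ ⇓[ t′ ] s″ →
                  while b P , s ⇓[ suc (t ℕ.+ t′) ] s″

    while-false : ∀ {b P s} → ⟦ b ⟧ᵀ s ≡ false →
                  while b P , s ⇓[ 1 ] s

  ----------------------------------------------------------------------
  -- Euclidean length

  Point : Set
  Point = ℝ × ℝ

  dist : Point → Point → ℝ
  dist (x , y) (x′ , y′) = √ ((x - x′) * (x - x′) + (y - y′) * (y - y′))

  totalLength : ∀ {n} → Vector Point n → Graph n → ℝ
  totalLength p G = sum λ j → dist (p (proj₁ (edge j))) (p (proj₂ (edge j)))
    where open Graph G

  record IsTreeSpanning {n} (k : ℕ) (G : Graph n) : Set where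
    field
      isTree : IsTree G
      size   : ∣ Graph.vertices G ∣ ≡ k

  record IsMinimumTreeSpanning {n} (p : Vector Point n) (k : ℕ)
                               (G : Graph n) : Set where
    field
      isTreeSpanning : IsTreeSpanning k G
      minimum        : ∀ H → IsTreeSpanning k H →
                       totalLength p G ≤ totalLength p H

  ----------------------------------------------------------------------
  -- Input and output conventions

  array : {A : Set} → A → ∀ {n} → Vector A n → ℕ → A
  array d {zero}  v i       = d
  array d {suc n} v zero    = v zero
  array d {suc n} v (suc i) = array d (λ j → v (suc j)) i

  -- Natural array 0 holds n and k; real arrays 0 and 1 hold the
  -- coordinates.  All other cells are 0.
  input : ∀ {n} → Vector Point n → ℕ → State
  input {n} p k = ⟨ nats , reals ⟩
    where
    nats : ℕ → ℕ → ℕ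
    nats 0 0 = n
    nats 0 1 = k
    nats _ _ = 0

    reals : ℕ → ℕ → ℝ
    reals 0 = array 0# (λ i → proj₁ (p i))
    reals 1 = array 0# (λ i → proj₂ (p i))
    reals _ = λ _ → 0#

  -- Natural array 1 flags the vertices, cell 0 of natural array 2 holds
  -- the number of edges, and arrays 3 and 4 hold their endpoints.
  record Outputs {n} (s : State) (G : Graph n) : Set where
    open Graph G
    field
      flags      : ∀ i → (i ∈ vertices) ⇔ (nat s 1 (toℕ i) ≡ 1)
      edge-count : nat s 2 0 ≡ edges#
      ends₁      : ∀ j → nat s 3 (toℕ j) ≡ toℕ (proj₁ (edge j))
      ends₂      : ∀ j → nat s 4 (toℕ j) ≡ toℕ (proj₂ (edge j))

{-# OPTIONS --safe #-}

-- For all points i, j and depths m, cut the square of centre pᵢ and half-width D = d(pᵢ, pⱼ) by m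
-- bisections into 2^m × 2^m cells, sort all points by decreasing population of their cells (those
-- outside the square last), and join each of the first k to the nearest point before it; the cheapest
-- of these trees is the output.
--
-- Let L be the length of an optimal tree, i one of its vertices, j its vertex farthest from i, and let
-- q = 2^b with q⁴ ≤ k ≤ 16 q⁴ and m = 2b, so that cells have side s = 2D / q².  Suppose that the k
-- chosen points meet t cells.  A point whose dyadic cell of side 2D / 2^a already contains an earlier
-- point is joined at cost O(D / 2^a), so the tree costs O(D) times the sum over a ≤ 3b of the number
-- of cells met at depth a over 2^a, plus k / 2^3b.  At depth a at most min(4^a, t) cells are met if
-- a ≤ 2b, and at most 4^(a-2b) t otherwise, which adds up to O(D (q + t / q)).  The vertices of the
-- optimal tree meet at least t cells, since the fullest cells were taken.  Its Euler tour has length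
-- 2L and splits into O(1 + L / s) pieces of length at most s, each meeting O(1) cells; hence
-- t s = O(s + L).  With D = O(L) the cost is O(q L) = O(k^(1/4) L).
--
-- The algorithm is written as a term of a language of bounded loops whose compilation to programs has
-- a running time that depends on n only, and polynomially.
module Submission where

open import Defs
open import Algebra.Bundles using (CommutativeRing; RawRing)
open import Algebra.Structures using (IsCommutativeRing)
open import Algebra.Solver.Ring.AlmostCommutativeRing
  using (AlmostCommutativeRing; fromCommutativeRing; _-Raw-AlmostCommutative⟶_)
import Algebra.Solver.Ring as RingSolver
import Algebra.Properties.Ring as RingProperties
open import Data.Bool using (Bool; true; false; if_then_else_; not; _∧_)
open import Data.Empty using (⊥; ⊥-elim)
import Data.Fin.Properties as Fin
open import Data.Fin.Subset using (Subset; ∣_∣) renaming (_∈_ to _∈ₛ_)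
open import Data.Fin.Subset.Properties using () renaming (_∈?_ to _∈ₛ?_)
open import Data.Integer as ℤ using (ℤ; -[1+_]; 0ℤ)
import Data.Integer.Properties as ℤ
open import Data.List
  using (List; []; _∷_; _++_; length; map; concatMap; filter; deduplicate; upTo; downFrom; allFin)
open import Data.List.Membership.Propositional using (_∈_)
open import Data.List.Membership.Propositional.Properties
  using (∈-map⁺; ∈-map⁻; ∈-++⁺ˡ; ∈-++⁺ʳ; ∈-++⁻; ∈-upTo⁺; ∈-downFrom⁺; ∈-downFrom⁻; ∈-allFin;
         ∈-filter⁺; ∈-filter⁻; ∈-deduplicate⁺)
import Data.List.Membership.DecPropositional as DecMembership
open import Data.List.Properties
  using (length-map; length-++; length-downFrom; length-tabulate; length-deduplicate;
         ∷-injectiveˡ; ∷-injectiveʳ)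
open import Data.List.Relation.Unary.All as All using (All; []; _∷_)
open import Data.List.Relation.Unary.AllPairs using ([]; _∷_)
open import Data.List.Relation.Unary.Any using (here; there; _─_)
open import Data.List.Relation.Unary.Unique.DecPropositional.Properties using (deduplicate-!)
open import Data.List.Relation.Unary.Unique.Propositional using (Unique)
import Data.List.Relation.Unary.Unique.Propositional.Properties as Unique
open import Data.Maybe using (Maybe; just; nothing)
open import Data.Nat as ℕ using (ℕ; zero; suc; _∸_; ⌊_/2⌋; s≤s; z≤n)
import Data.Nat.Properties as ℕ
open import Data.Nat.Tactic.RingSolver using (solve-∀)
open import Data.Product using (Σ-syntax; ∃-syntax; _×_; _,_; proj₁; proj₂)
open import Data.Product.Properties using (≡-dec)
open import Data.Sum using (_⊎_; inj₁; inj₂)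
open import Data.Vec using (tabulate)
open import Data.Vec.Functional using (Vector)
open import Data.Vec.Properties using (lookup⇒[]=; []=⇒lookup; lookup∘tabulate)
open import Function using (_∘_)
open import Function.Bundles using (mk⇔)
open import Relation.Binary.Definitions using (DecidableEquality; tri<; tri≈; tri>)
open import Relation.Binary.PropositionalEquality
open import Relation.Binary.Structures using (IsDecTotalOrder)
open import Relation.Nullary using (¬_; Dec; yes; no; ⌊_⌋)
open import Relation.Nullary.Decidable using (dec-true; dec-false; isYes≗does; ¬?)

-- The machine has neither floor nor logarithm, so the program never computes a scale: it tries
-- every `i`, `j` and `m` below `n`, and the triple of the analysis is among them because
-- `2b < 16^b ≤ k ≤ n`. Level `3b` occurs only in the accounting; joining to the nearest earlier
-- point is at least as cheap as joining to any cellmate that the accounting names. The accounting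
-- may stop at level `3b`, since `k / 2^(3b)` is at most `16 q`.
--
-- Inequalities are multiplied out by powers of two and by the side `S = 2D` of the square, so the
-- counting needs no division; `S` must be nonzero only where the cells of nearby points are
-- compared. Closeness is measured coordinate by coordinate, where errors add without the Euclidean
-- triangle inequality. The price is a factor 2 at each return to `dist`.
--
-- The ratio is `(2·18 + 2·3·25)·8 + 2·3·2·25`: `18 = 16 + 2` and `3` come from `k ≤ 16 q⁴` and the
-- three scales, `25 = 5·5` counts the cells around an anchor, and `8` bounds `S` in terms of `L`.

-- Finite sums, counting and searching.

module Combinatorics where
  open import Data.Nat as ℕ
  open import Data.Nat.Properties as ℕ

  -- The denotation of `fold` is an `iter` with bound `n`, so functions written with `iter` meet
  -- their terms by computation or by `iter-cong`.
  iter : {A : Set} → (ℕ → A → A) → A → ℕ → A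
  iter f z zero    = z
  iter f z (suc m) = f m (iter f z m)

  ⌊⌋-true : ∀ {A : Set} (d : Dec A) → A → ⌊ d ⌋ ≡ true
  ⌊⌋-true d a = trans (isYes≗does d) (dec-true d a)

  ⌊⌋-false : ∀ {A : Set} (d : Dec A) → ¬ A → ⌊ d ⌋ ≡ false
  ⌊⌋-false d ¬a = trans (isYes≗does d) (dec-false d ¬a)

  ⌊⌋-witness : ∀ {A : Set} (d : Dec A) → ⌊ d ⌋ ≡ true → A
  ⌊⌋-witness (yes a) _ = a

  -- Opaque, since unfolding the decision procedure makes the conversion checker compare each argument
  -- many times.
  opaque
    leᵇ : ℕ → ℕ → Bool
    leᵇ a b = ⌊ a ≤? b ⌋

    leᵇ-⌊⌋ : ∀ a b → ⌊ a ≤? b ⌋ ≡ leᵇ a b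
    leᵇ-⌊⌋ a b = refl

    leᵇ-true : ∀ {a b} → a ≤ b → leᵇ a b ≡ true
    leᵇ-true {a} {b} = ⌊⌋-true (a ≤? b)

    leᵇ-false : ∀ {a b} → ¬ a ≤ b → leᵇ a b ≡ false
    leᵇ-false {a} {b} = ⌊⌋-false (a ≤? b)

    leᵇ⇒≤ : ∀ {a b} → leᵇ a b ≡ true → a ≤ b
    leᵇ⇒≤ {a} {b} = ⌊⌋-witness (a ≤? b)

  ∧-true : ∀ a b → a ∧ b ≡ true → a ≡ true × b ≡ true
  ∧-true true true _ = refl , refl

  Σℓ : {A : Set} → (A → ℕ) → List A → ℕ
  Σℓ f []       = 0
  Σℓ f (x ∷ xs) = f x + Σℓ f xs

  Σℓ-remove : ∀ {A : Set} (f : A → ℕ) {x ys} (x∈ys : x ∈ ys) → Σℓ f ys ≡ f x + Σℓ f (ys ─ x∈ys)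
  Σℓ-remove f (here refl) = refl
  Σℓ-remove f {x} {y ∷ ys} (there x∈ys) = begin
    f y + Σℓ f ys                    ≡⟨ cong (f y +_) (Σℓ-remove f x∈ys) ⟩
    f y + (f x + Σℓ f (ys ─ x∈ys))   ≡⟨ +-assoc (f y) (f x) _ ⟨
    f y + f x + Σℓ f (ys ─ x∈ys)     ≡⟨ cong (_+ Σℓ f (ys ─ x∈ys)) (+-comm (f y) (f x)) ⟩
    f x + f y + Σℓ f (ys ─ x∈ys)     ≡⟨ +-assoc (f x) (f y) _ ⟩
    f x + (f y + Σℓ f (ys ─ x∈ys))   ∎
    where open ≡-Reasoning

  ∈-remove : ∀ {A : Set} {x z : A} {ys} (x∈ys : x ∈ ys) → z ≢ x → z ∈ ys → z ∈ (ys ─ x∈ys)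
  ∈-remove (here refl)  z≢x (here eq)   = ⊥-elim (z≢x eq)
  ∈-remove (here refl)  z≢x (there z∈)  = z∈
  ∈-remove (there x∈ys) z≢x (here eq)   = here eq
  ∈-remove (there x∈ys) z≢x (there z∈)  = there (∈-remove x∈ys z≢x z∈)

  -- Each `x` of nonzero weight is struck out of `ys`; as `xs` has no repetitions, no later element
  -- relies on the struck occurrence. Weight zero is exempted for the sake of truncated excesses,
  -- which vanish on sparse cells.
  Σℓ-⊆ : ∀ {A : Set} (f : A → ℕ) {xs ys} → Unique xs →
         (∀ {x} → x ∈ xs → f x ≡ 0 ⊎ x ∈ ys) → Σℓ f xs ≤ Σℓ f ys
  Σℓ-⊆ f {[]} _ _ = z≤n
  Σℓ-⊆ f {x ∷ xs} {ys} (x∉xs ∷ uniq) incl with incl (here refl)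
  ... | inj₁ fx≡0 = subst (λ z → z + Σℓ f xs ≤ Σℓ f ys) (sym fx≡0) (Σℓ-⊆ f uniq (incl ∘ there))
  ... | inj₂ x∈ys = subst (f x + Σℓ f xs ≤_) (sym (Σℓ-remove f x∈ys)) (+-monoʳ-≤ (f x) (Σℓ-⊆ f uniq rest))
    where
    rest : ∀ {z} → z ∈ xs → f z ≡ 0 ⊎ z ∈ (ys ─ x∈ys)
    rest z∈xs with incl (there z∈xs)
    ... | inj₁ fz≡0 = inj₁ fz≡0
    ... | inj₂ z∈ys = inj₂ (∈-remove x∈ys (λ z≡x → All.lookup x∉xs z∈xs (sym z≡x)) z∈ys)

  -- Weight 1 in `Σℓ-⊆` gives the pigeonhole principle.
  length-⊆ : ∀ {A : Set} {xs ys : List A} → Unique xs → (∀ {x} → x ∈ xs → x ∈ ys) → length xs ≤ length ys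
  length-⊆ {xs = xs} {ys} uniq incl =
    subst₂ _≤_ (ones xs) (ones ys) (Σℓ-⊆ (λ _ → 1) uniq (inj₂ ∘ incl))
    where
    ones : ∀ zs → Σℓ (λ _ → 1) zs ≡ length zs
    ones []       = refl
    ones (_ ∷ zs) = cong suc (ones zs)

  ∈-concatMap : ∀ {A B : Set} (f : A → List B) {x y xs} → x ∈ xs → y ∈ f x → y ∈ concatMap f xs
  ∈-concatMap f {xs = x ∷ xs} (here refl) y∈ = ∈-++⁺ˡ y∈
  ∈-concatMap f {xs = x ∷ xs} (there x∈)  y∈ = ∈-++⁺ʳ (f x) (∈-concatMap f x∈ y∈)

  ∈-concatMap⁻ : ∀ {A B : Set} (f : A → List B) {y} xs → y ∈ concatMap f xs → ∃[ x ] x ∈ xs × y ∈ f x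
  ∈-concatMap⁻ f (x ∷ xs) y∈ with ∈-++⁻ (f x) y∈
  ... | inj₁ y∈fx = x , here refl , y∈fx
  ... | inj₂ y∈r  with ∈-concatMap⁻ f xs y∈r
  ... | z , z∈ , y∈fz = z , there z∈ , y∈fz

  length-concatMap : ∀ {A B : Set} (f : A → List B) xs → length (concatMap f xs) ≡ Σℓ (length ∘ f) xs
  length-concatMap f []       = refl
  length-concatMap f (x ∷ xs) = trans (length-++ (f x)) (cong (length (f x) +_) (length-concatMap f xs))

  length-concatMap-≤ : ∀ {A B : Set} (f : A → List B) c → (∀ x → length (f x) ≤ c) →
                       ∀ xs → length (concatMap f xs) ≤ c * length xs
  length-concatMap-≤ f c f≤c []       = z≤n
  length-concatMap-≤ f c f≤c (x ∷ xs) =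
    subst₂ _≤_ (sym (length-++ (f x))) (sym (*-suc c (length xs)))
      (+-mono-≤ (f≤c x) (length-concatMap-≤ f c f≤c xs))

  count : (ℕ → Bool) → ℕ → ℕ
  count P = iter (λ i a → if P i then suc a else a) 0

  trues : (ℕ → Bool) → ℕ → List ℕ
  trues P = iter (λ i a → if P i then i ∷ a else a) []

  length-trues : ∀ P n → length (trues P n) ≡ count P n
  length-trues P zero    = refl
  length-trues P (suc n) with P n
  ... | true  = cong suc (length-trues P n)
  ... | false = length-trues P n

  ∈-trues⁺ : ∀ P {n v} → v < n → P v ≡ true → v ∈ trues P n
  ∈-trues⁺ P {suc n} {v} v<1+n Pv with v ≟ n
  ... | yes refl rewrite Pv = here refl
  ... | no v≢n with P n
  ... | true  = there (∈-trues⁺ P (≤∧≢⇒< (≤-pred v<1+n) v≢n) Pv)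
  ... | false = ∈-trues⁺ P (≤∧≢⇒< (≤-pred v<1+n) v≢n) Pv

  ∈-trues⁻ : ∀ P n {v} → v ∈ trues P n → v < n × P v ≡ true
  ∈-trues⁻ P (suc n) v∈ with P n in eq
  ∈-trues⁻ P (suc n) (here refl) | true = ≤-refl , eq
  ∈-trues⁻ P (suc n) (there v∈)  | true with ∈-trues⁻ P n v∈
  ... | v<n , Pv = m<n⇒m<1+n v<n , Pv
  ∈-trues⁻ P (suc n) v∈          | false with ∈-trues⁻ P n v∈
  ... | v<n , Pv = m<n⇒m<1+n v<n , Pv

  trues-unique : ∀ P n → Unique (trues P n)
  trues-unique P zero    = []
  trues-unique P (suc n) with P n
  ... | true  = All.tabulate (λ v∈ n≡v → <⇒≢ (proj₁ (∈-trues⁻ P n v∈)) (sym n≡v)) ∷ trues-unique P n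
  ... | false = trues-unique P n

  length≤count : ∀ P {n xs} → Unique xs → (∀ {x} → x ∈ xs → x < n × P x ≡ true) → length xs ≤ count P n
  length≤count P {n} uniq incl = subst (_ ≤_) (length-trues P n)
    (length-⊆ uniq (λ x∈ → ∈-trues⁺ P (proj₁ (incl x∈)) (proj₂ (incl x∈))))

  count≤length : ∀ P {n xs} → (∀ {x} → x < n → P x ≡ true → x ∈ xs) → count P n ≤ length xs
  count≤length P {n} incl = subst (_≤ _) (length-trues P n)
    (length-⊆ (trues-unique P n) (λ x∈ → incl (proj₁ (∈-trues⁻ P n x∈)) (proj₂ (∈-trues⁻ P n x∈))))

  -- The witness `x` put in front of the list of all hits of `P` is still a list without
  -- repetitions, now of hits of `Q`.
  count-< : ∀ P Q {n x} → (∀ {y} → P y ≡ true → Q y ≡ true) →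
            x < n → P x ≡ false → Q x ≡ true → count P n < count Q n
  count-< P Q {n} {x} P⇒Q x<n ¬Px Qx = subst (_< count Q n) (length-trues P n)
    (length≤count Q (All.tabulate fresh ∷ trues-unique P n)
      λ { (here refl) → x<n , Qx
        ; (there y∈) → proj₁ (∈-trues⁻ P n y∈) , P⇒Q (proj₂ (∈-trues⁻ P n y∈)) })
    where
    fresh : ∀ {y} → y ∈ trues P n → x ≢ y
    fresh y∈ refl with trans (sym ¬Px) (proj₂ (∈-trues⁻ P n y∈))
    ... | ()

  count≤n : ∀ P n → count P n ≤ n
  count≤n P n = subst (count P n ≤_) (length-downFrom n) (count≤length P {n} {downFrom n} (λ x<n _ → ∈-downFrom⁺ x<n))

  -- Later hits overwrite earlier ones; `0` is a placeholder when there is no hit.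
  find : (ℕ → Bool) → ℕ → ℕ
  find P = iter (λ i a → if P i then i else a) 0

  find-sound : ∀ P {n v} → v < n → P v ≡ true → find P n < n × P (find P n) ≡ true
  find-sound P {suc n} {v} v<1+n Pv with P n in eq
  ... | true  = ≤-refl , eq
  ... | false with find-sound P (≤∧≢⇒< (≤-pred v<1+n) λ { refl → false≢true (trans (sym eq) Pv) }) Pv
    where
    false≢true : false ≢ true
    false≢true ()
  ... | f<n , Pf = m<n⇒m<1+n f<n , Pf

  eqᵇ : ℕ → ℕ → Bool
  eqᵇ a b = leᵇ a b ∧ leᵇ b a

  eqᵇ⇒≡ : ∀ a b → eqᵇ a b ≡ true → a ≡ b
  eqᵇ⇒≡ a b eq with ∧-true (leᵇ a b) _ eq
  ... | p , q = ≤-antisym (leᵇ⇒≤ p) (leᵇ⇒≤ q)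

  eqᵇ-refl : ∀ a → eqᵇ a a ≡ true
  eqᵇ-refl a rewrite leᵇ-true (≤-refl {a}) = refl

  -- Only `≤` tests occur, the sole comparison of naturals in the loop language. The order is strict
  -- because exhausted lists yield `false`.
  lexᵇ : List ℕ → List ℕ → Bool
  lexᵇ (x ∷ xs) (y ∷ ys) = if leᵇ y x then leᵇ x y ∧ lexᵇ xs ys else true
  lexᵇ _ _ = false

  infix 4 _≺_

  data _≺_ : List ℕ → List ℕ → Set where
    head≺ : ∀ {x y xs ys} → x < y → x ∷ xs ≺ y ∷ ys
    tail≺ : ∀ {x xs ys} → xs ≺ ys → x ∷ xs ≺ x ∷ ys

  lexᵇ⇒≺ : ∀ xs ys → lexᵇ xs ys ≡ true → xs ≺ ys
  lexᵇ⇒≺ (x ∷ xs) (y ∷ ys) eq with y ≤? x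
  ... | no y≰x  = head≺ (≰⇒> y≰x)
  ... | yes y≤x rewrite leᵇ-true y≤x with ∧-true (leᵇ x y) _ eq
  ... | x≤y , eq′ rewrite ≤-antisym (leᵇ⇒≤ x≤y) y≤x = tail≺ (lexᵇ⇒≺ xs ys eq′)

  ≺⇒lexᵇ : ∀ {xs ys} → xs ≺ ys → lexᵇ xs ys ≡ true
  ≺⇒lexᵇ {x ∷ xs} {y ∷ ys} (head≺ x<y) rewrite leᵇ-false (<⇒≱ x<y) = refl
  ≺⇒lexᵇ {x ∷ xs} (tail≺ xs≺ys) rewrite leᵇ-true (≤-refl {x}) = ≺⇒lexᵇ xs≺ys

  ≺-irrefl : ∀ {xs} → ¬ xs ≺ xs
  ≺-irrefl (head≺ x<x) = <-irrefl refl x<x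
  ≺-irrefl (tail≺ h)   = ≺-irrefl h

  ≺-trans : ∀ {xs ys zs} → xs ≺ ys → ys ≺ zs → xs ≺ zs
  ≺-trans (head≺ p) (head≺ q) = head≺ (<-trans p q)
  ≺-trans (head≺ p) (tail≺ q) = head≺ p
  ≺-trans (tail≺ p) (head≺ q) = head≺ q
  ≺-trans (tail≺ p) (tail≺ q) = tail≺ (≺-trans p q)

  ≺-total : ∀ xs ys → length xs ≡ length ys → xs ≺ ys ⊎ xs ≡ ys ⊎ ys ≺ xs
  ≺-total [] [] _ = inj₂ (inj₁ refl)
  ≺-total (x ∷ xs) (y ∷ ys) eq with <-cmp x y
  ... | tri< x<y _ _ = inj₁ (head≺ x<y)
  ... | tri> _ _ y<x = inj₂ (inj₂ (head≺ y<x))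
  ... | tri≈ _ refl _ with ≺-total xs ys (suc-injective eq)
  ... | inj₁ h        = inj₁ (tail≺ h)
  ... | inj₂ (inj₁ h) = inj₂ (inj₁ (cong (x ∷_) h))
  ... | inj₂ (inj₂ h) = inj₂ (inj₂ (tail≺ h))

  -- Prefixes of equal length that differ already decide the comparison, so the tail may be
  -- exchanged. This moves a comparison from one point of a cell to its cellmates.
  ≺-prefix : ∀ {xs ys : List ℕ} {us vs us′} → length xs ≡ length ys → xs ≢ ys →
             (xs ++ us) ≺ (ys ++ vs) → (xs ++ us′) ≺ (ys ++ vs)
  ≺-prefix {[]} {[]} _ ≢ _ = ⊥-elim (≢ refl)
  ≺-prefix {x ∷ xs} {y ∷ ys} eq ≢ (head≺ x<y) = head≺ x<y
  ≺-prefix {x ∷ xs} {.x ∷ ys} eq ≢ (tail≺ h)  = tail≺ (≺-prefix (suc-injective eq) (≢ ∘ cong (x ∷_)) h)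

  map-unique : ∀ {A B : Set} (f : A → B) {xs} →
               (∀ {x y} → x ∈ xs → y ∈ xs → f x ≡ f y → x ≡ y) → Unique xs → Unique (map f xs)
  map-unique f inj []           = []
  map-unique f inj (x∉xs ∷ uxs) =
    All.tabulate (λ y∈ → fresh (∈-map⁻ f y∈)) ∷ map-unique f (λ p q → inj (there p) (there q)) uxs
    where
    fresh : ∀ {y} → ∃[ z ] z ∈ _ × y ≡ f z → _ ≢ y
    fresh (z , z∈ , refl) fx≡fz = All.lookup x∉xs z∈ (inj (here refl) (there z∈) fx≡fz)

  -- Sorting by counting predecessors.

  module Rank (n : ℕ) (key : ℕ → List ℕ)
              (key-length : ∀ v w → length (key v) ≡ length (key w))
              (key-injective : ∀ v w → key v ≡ key w → v ≡ w) where

    opaque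
      before : ℕ → ℕ → Bool
      before w v = lexᵇ (key w) (key v)

      -- Counting predecessors, and inverting the count by a search in `σ`, sorts without writable
      -- arrays, which terms of the loop language do not have.
      rank : ℕ → ℕ
      rank v = count (λ w → before w v) n

      σ : ℕ → ℕ
      σ r = find (λ v → eqᵇ (rank v) r) n

    opaque
      unfolding before

      before-irrefl : ∀ v → before v v ≡ false
      before-irrefl v with lexᵇ (key v) (key v) in eq
      ... | true  = ⊥-elim (≺-irrefl (lexᵇ⇒≺ (key v) (key v) eq))
      ... | false = refl

      rank-mono : ∀ {v w} → w < n → key w ≺ key v → rank w < rank v
      rank-mono {v} {w} w<n w≺v = count-< (λ u → before u w) (λ u → before u v)
        (λ {u} u≺w → ≺⇒lexᵇ (≺-trans (lexᵇ⇒≺ (key u) (key w) u≺w) w≺v)) w<n (before-irrefl w) (≺⇒lexᵇ w≺v)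

    rank-reflects : ∀ {v w} → v < n → rank w < rank v → key w ≺ key v
    rank-reflects {v} {w} v<n rw<rv with ≺-total (key w) (key v) (key-length w v)
    ... | inj₁ w≺v        = w≺v
    ... | inj₂ (inj₁ eq)  = ⊥-elim (<-irrefl (cong rank (key-injective w v eq)) rw<rv)
    ... | inj₂ (inj₂ v≺w) = ⊥-elim (<-asym rw<rv (rank-mono v<n v≺w))

    rank-injective : ∀ {v w} → v < n → w < n → rank v ≡ rank w → v ≡ w
    rank-injective {v} {w} v<n w<n eq with ≺-total (key v) (key w) (key-length v w)
    ... | inj₁ v≺w        = ⊥-elim (<-irrefl eq (rank-mono v<n v≺w))
    ... | inj₂ (inj₁ e)   = key-injective v w e
    ... | inj₂ (inj₂ w≺v) = ⊥-elim (<-irrefl (sym eq) (rank-mono w<n w≺v))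

    opaque
      unfolding before

      rank<n : ∀ {v} → v < n → rank v < n
      rank<n {v} v<n = <-≤-trans
        (count-< (λ w → before w v) (λ _ → true) (λ _ → refl) v<n (before-irrefl v) refl) (count≤n _ n)

    -- A missed `r` together with the `n` distinct ranks would make `n + 1` distinct numbers below
    -- `n`.
    rank-surjective : ∀ {r} → r < n → ∃[ v ] v < n × rank v ≡ r
    rank-surjective {r} r<n with DecMembership._∈?_ _≟_ r (map rank (downFrom n))
    ... | yes r∈ with ∈-map⁻ rank r∈
    ... | v , v∈ , r≡ = v , ∈-downFrom⁻ v∈ , sym r≡
    rank-surjective {r} r<n | no r∉ = ⊥-elim (<-irrefl refl (subst₂ _<_
        (trans (length-map rank (downFrom n)) (length-downFrom n)) (length-downFrom n)
        (length-⊆ {xs = r ∷ map rank (downFrom n)} {downFrom n}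
          (All.tabulate (λ y∈ r≡y → r∉ (subst (_∈ _) (sym r≡y) y∈)) ∷
           map-unique rank (λ p q → rank-injective (∈-downFrom⁻ p) (∈-downFrom⁻ q)) (Unique.downFrom⁺ n))
          λ { (here refl) → ∈-downFrom⁺ r<n ; (there y∈) → below (∈-map⁻ rank y∈) })))
      where
      below : ∀ {y} → ∃[ v ] v ∈ downFrom n × y ≡ rank v → y ∈ downFrom n
      below (v , v∈ , refl) = ∈-downFrom⁺ (rank<n (∈-downFrom⁻ v∈))

    opaque
      unfolding before

      σ-spec : ∀ {r} → r < n → σ r < n × rank (σ r) ≡ r
      σ-spec {r} r<n with rank-surjective r<n
      ... | v , v<n , refl with find-sound (λ w → eqᵇ (rank w) (rank v)) v<n (eqᵇ-refl (rank v))
      ... | σ<n , eq = σ<n , eqᵇ⇒≡ _ _ eq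

    σ<n : ∀ {r} → r < n → σ r < n
    σ<n = proj₁ ∘ σ-spec

    rank-σ : ∀ {r} → r < n → rank (σ r) ≡ r
    rank-σ = proj₂ ∘ σ-spec

    σ-rank : ∀ {v} → v < n → σ (rank v) ≡ v
    σ-rank v<n = rank-injective (σ<n (rank<n v<n)) v<n (rank-σ (rank<n v<n))

    σ-injective : ∀ {r r′} → r < n → r′ < n → σ r ≡ σ r′ → r ≡ r′
    σ-injective r<n r′<n eq = trans (sym (rank-σ r<n)) (trans (cong rank eq) (rank-σ r′<n))

  not-false : ∀ {b} → (b ≡ false → ⊥) → b ≡ true
  not-false {true}  _ = refl
  not-false {false} h = ⊥-elim (h refl)

  ∈⇒0<length : ∀ {A : Set} {x : A} {xs} → x ∈ xs → 0 < length xs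
  ∈⇒0<length (here _)  = z<s
  ∈⇒0<length (there _) = z<s

  Cell : Set
  Cell = ℕ × ℕ

  _≟ᶜ_ : DecidableEquality Cell
  _≟ᶜ_ = ≡-dec _≟_ _≟_

  -- The fullest cells are the fewest.

  module Density (n : ℕ) (inside : ℕ → Bool) (gx gy : ℕ → ℕ) where

    same : ℕ → ℕ → Bool
    same v w = inside v ∧ (inside w ∧ (eqᵇ (gx v) (gx w) ∧ eqᵇ (gy v) (gy w)))

    opaque
      density : ℕ → ℕ
      density v = count (same v) n

    prefix : ℕ → List ℕ
    prefix v = n ∸ density v ∷ gx v ∷ gy v ∷ []

    -- The points of one cell are consecutive, cells come by decreasing population, and points outside
    -- the square, whose density is 0, come last.
    key : ℕ → List ℕ
    key v = prefix v ++ v ∷ []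

    cell : ℕ → Cell
    cell v = gx v , gy v

    key-injective : ∀ v w → key v ≡ key w → v ≡ w
    key-injective v w eq =
      ∷-injectiveˡ (∷-injectiveʳ (∷-injectiveʳ (∷-injectiveʳ eq)))

    open Rank n key (λ _ _ → refl) key-injective public

    members : Cell → List ℕ
    members (a , b) = trues (λ w → inside w ∧ (eqᵇ a (gx w) ∧ eqᵇ b (gy w))) n

    population : Cell → ℕ
    population c = length (members c)

    opaque
      unfolding density

      density-inside : ∀ {v} → inside v ≡ true → density v ≡ population (cell v)
      density-inside {v} in-v = trans (step (inside v) in-v) (sym (length-trues _ n))
        where
        step : ∀ b → b ≡ true →
               count (λ w → b ∧ (inside w ∧ (eqᵇ (gx v) (gx w) ∧ eqᵇ (gy v) (gy w)))) n ≡
               count (λ w → inside w ∧ (eqᵇ (gx v) (gx w) ∧ eqᵇ (gy v) (gy w))) n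
        step true refl = refl

      density-outside : ∀ {v} → inside v ≡ false → density v ≡ 0
      density-outside {v} out = trans (step (inside v) out) (none n)
        where
        none : ∀ n → count (λ _ → false) n ≡ 0
        none zero    = refl
        none (suc n) = none n
        step : ∀ b → b ≡ false →
               count (λ w → b ∧ (inside w ∧ (eqᵇ (gx v) (gx w) ∧ eqᵇ (gy v) (gy w)))) n ≡ count (λ _ → false) n
        step false refl = refl

    ∈-members⁺ : ∀ {v} → v < n → inside v ≡ true → v ∈ members (cell v)
    ∈-members⁺ {v} v<n in-v = ∈-trues⁺ _ v<n eq
      where
      eq : inside v ∧ (eqᵇ (gx v) (gx v) ∧ eqᵇ (gy v) (gy v)) ≡ true
      eq rewrite in-v | eqᵇ-refl (gx v) | eqᵇ-refl (gy v) = refl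

    ∈-members⁻ : ∀ {c v} → v ∈ members c → v < n × inside v ≡ true × cell v ≡ c
    ∈-members⁻ {a , b} {v} v∈ with ∈-trues⁻ _ n v∈
    ... | v<n , eq with ∧-true (inside v) _ eq
    ... | in-v , eq′ with ∧-true (eqᵇ a (gx v)) _ eq′
    ... | ex , ey = v<n , in-v , cong₂ _,_ (sym (eqᵇ⇒≡ a _ ex)) (sym (eqᵇ⇒≡ b _ ey))

    population-nonempty : ∀ c → population c ≢ 0 → ∃[ v ] v ∈ members c
    population-nonempty c ≢0 with members c
    ... | []    = ⊥-elim (≢0 refl)
    ... | v ∷ _ = v , here refl

    opaque
      unfolding density

      density≤n : ∀ v → density v ≤ n
      density≤n v = count≤n (same v) n

    denser⇒≺ : ∀ {v w} → density w < density v → key v ≺ key w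
    denser⇒≺ {v} w<v = head≺ (∸-monoʳ-< w<v (density≤n v))

    ≺⇒density≥ : ∀ {v w} → key v ≺ key w → density w ≤ density v
    ≺⇒density≥ {v} {w} h = ∸-cancelʳ-≤ (density≤n w) (head≤ h)
      where
      head≤ : ∀ {x y xs ys} → x ∷ xs ≺ y ∷ ys → x ≤ y
      head≤ (head≺ x<y) = <⇒≤ x<y
      head≤ (tail≺ _)   = ≤-refl

    selected : ℕ → List ℕ
    selected k = map σ (downFrom k)

    rank<⇒selected : ∀ {v k} → v < n → rank v < k → v ∈ selected k
    rank<⇒selected v<n r<k = subst (_∈ _) (σ-rank v<n) (∈-map⁺ σ (∈-downFrom⁺ r<k))

    length-selected : ∀ k → length (selected k) ≡ k
    length-selected k = trans (length-map σ (downFrom k)) (length-downFrom k)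

    -- A point outside has density 0, so every point of `O`, having positive density, would precede
    -- `σ r`; but only `r < k` points do.
    σ-inside : ∀ {O k r} → Unique O → (∀ {v} → v ∈ O → v < n × inside v ≡ true) →
               k ≤ length O → k ≤ n → r < k → inside (σ r) ≡ true
    σ-inside {O} {k} {r} uniq O-inside k≤O k≤n r<k =
      not-false (λ out → <-irrefl refl (≤-<-trans (≤-trans k≤O (O≤r out)) r<k))
      where
      r<n = <-≤-trans r<k k≤n
      earlier : inside (σ r) ≡ false → ∀ {v} → v ∈ O → v ∈ selected r
      earlier eq {v} v∈ = rank<⇒selected v<n
        (subst (rank v <_) (rank-σ r<n) (rank-mono v<n (denser⇒≺
          (subst₂ _<_ (sym (density-outside eq)) (sym (density-inside in-v)) (∈⇒0<length (∈-members⁺ v<n in-v))))))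
        where
        v<n = proj₁ (O-inside v∈)
        in-v = proj₂ (O-inside v∈)
      O≤r : inside (σ r) ≡ false → length O ≤ r
      O≤r eq = subst (length O ≤_) (length-selected r) (length-⊆ uniq (earlier eq))

    -- Truncation can only raise the right side. `Σℓ-∸-exact` is the equality when nothing is
    -- truncated; the two are played against each other in `densest-cells-≤`.
    Σℓ-∸ : ∀ {A : Set} (f : A → ℕ) θ xs → Σℓ f xs ≤ length xs * θ + Σℓ (λ x → f x ∸ θ) xs
    Σℓ-∸ f θ []       = z≤n
    Σℓ-∸ f θ (x ∷ xs) = begin
      f x + Σℓ f xs                                 ≤⟨ +-mono-≤ (m≤n+m∸n (f x) θ) (Σℓ-∸ f θ xs) ⟩
      θ + (f x ∸ θ) + (length xs * θ + rest)        ≡⟨ shuffle θ (f x ∸ θ) (length xs * θ) rest ⟩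
      θ + length xs * θ + (f x ∸ θ + rest)          ∎
      where
      open ≤-Reasoning
      rest = Σℓ (λ x → f x ∸ θ) xs
      shuffle : ∀ a b c d → a + b + (c + d) ≡ a + c + (b + d)
      shuffle = solve-∀

    Σℓ-∸-exact : ∀ {A : Set} (f : A → ℕ) θ xs → (∀ {x} → x ∈ xs → θ ≤ f x) →
                 Σℓ (λ x → f x ∸ θ) xs + length xs * θ ≡ Σℓ f xs
    Σℓ-∸-exact f θ []       _  = refl
    Σℓ-∸-exact f θ (x ∷ xs) θ≤ = begin
      (f x ∸ θ) + rest + (θ + length xs * θ)   ≡⟨ shuffle (f x ∸ θ) rest θ (length xs * θ) ⟩
      (f x ∸ θ) + θ + (rest + length xs * θ)   ≡⟨ cong₂ _+_ (m∸n+n≡m (θ≤ (here refl))) (Σℓ-∸-exact f θ xs (θ≤ ∘ there)) ⟩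
      f x + Σℓ f xs                            ∎
      where
      open ≡-Reasoning
      rest = Σℓ (λ x → f x ∸ θ) xs
      shuffle : ∀ a b c d → a + b + (c + d) ≡ a + c + (b + d)
      shuffle = solve-∀

    concat-members-unique : ∀ {F} → Unique F → Unique (concatMap members F)
    concat-members-unique {[]}    _            = []
    concat-members-unique {c ∷ F} (c∉F ∷ uniq) =
      Unique.++⁺ (trues-unique _ n) (concat-members-unique uniq) disjoint
      where
      disjoint : ∀ {v} → ¬ (v ∈ members c × v ∈ concatMap members F)
      disjoint (v∈c , v∈F) with ∈-concatMap⁻ members F v∈F
      ... | d , d∈F , v∈d = All.lookup c∉F d∈F
        (trans (sym (proj₂ (proj₂ (∈-members⁻ v∈c)))) (proj₂ (proj₂ (∈-members⁻ v∈d))))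

    -- The k densest points meet the fewest cells: with θ the density of the last one, every cell F
    -- filled before its cell has at least θ members, so that no list of cells can have a larger total
    -- excess over θ than F; as F misses the last point, k points need more than |F| cells.
    densest-cells-≤ : ∀ {k′ O} {CO CA : List Cell} → suc k′ ≤ n →
      Unique O → (∀ {v} → v ∈ O → v < n × inside v ≡ true) → suc k′ ≤ length O →
      Unique CO → (∀ {v} → v ∈ O → cell v ∈ CO) →
      Unique CA → (∀ {c} → c ∈ CA → ∃[ r ] r ≤ k′ × c ≡ cell (σ r)) →
      (∀ {r} → r ≤ k′ → cell (σ r) ∈ CA) →
      length CA ≤ length CO
    densest-cells-≤ {k′} {O} {CO} {CA} k≤n O-uniq O-inside k≤O CO-uniq O⊆CO CA-uniq CA⇒ ⇒CA =
      ≤-trans CA≤1+F F<CO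
      where
      last  = σ k′
      θ     = density last

      σ-in : ∀ {r} → r ≤ k′ → inside (σ r) ≡ true
      σ-in r≤k′ = σ-inside O-uniq O-inside k≤O k≤n (s≤s r≤k′)

      r<n : ∀ {r} → r ≤ k′ → r < n
      r<n r≤k′ = <-≤-trans (s≤s r≤k′) k≤n

      ¬last? = λ c → ¬? (c ≟ᶜ cell last)

      F = filter ¬last? CA

      CA≤1+F : length CA ≤ suc (length F)
      CA≤1+F = length-⊆ {ys = cell last ∷ F} CA-uniq (λ c∈ → split c∈ (_ ≟ᶜ cell last))
        where
        split : ∀ {c} → c ∈ CA → Dec (c ≡ cell last) → c ∈ cell last ∷ F
        split c∈ (yes eq)     = here eq
        split c∈ (no c≢last) = there (∈-filter⁺ ¬last? c∈ c≢last)

      F-earlier : ∀ {c} → c ∈ F → ∃[ r ] r < k′ × c ≡ cell (σ r) × c ≢ cell last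
      F-earlier {c} c∈F = from-CA (∈-filter⁻ ¬last? {xs = CA} c∈F)
        where
        earlier : c ≢ cell last → ∃[ r ] r ≤ k′ × c ≡ cell (σ r) →
                  ∃[ r ] r < k′ × c ≡ cell (σ r) × c ≢ cell last
        earlier c≢last (r , r≤k′ , eq) =
          r , ≤∧≢⇒< r≤k′ (λ { refl → c≢last eq }) , eq , c≢last
        from-CA : c ∈ CA × c ≢ cell last → ∃[ r ] r < k′ × c ≡ cell (σ r) × c ≢ cell last
        from-CA (c∈CA , c≢last) = earlier c≢last (CA⇒ c∈CA)

      before-last : ∀ {r} → r < k′ → key (σ r) ≺ key last
      before-last r<k′ = rank-reflects (σ<n (r<n ≤-refl))
        (subst₂ _<_ (sym (rank-σ (r<n (<⇒≤ r<k′)))) (sym (rank-σ (r<n ≤-refl))) r<k′)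

      F-dense : ∀ {c} → c ∈ F → θ ≤ population c
      F-dense {c} c∈F = dense (F-earlier c∈F)
        where
        dense : ∃[ r ] r < k′ × c ≡ cell (σ r) × c ≢ cell last → θ ≤ population c
        dense (r , r<k′ , refl , _) =
          subst (θ ≤_) (density-inside (σ-in (<⇒≤ r<k′))) (≺⇒density≥ (before-last r<k′))

      -- Cells other than that of `last` are taken whole: a cellmate of `σ r` shares the key prefix
      -- of `σ r`, and that prefix differs from the prefix of `last`, so it alone puts the cellmate
      -- before `last`.
      cellmate-earlier : ∀ {v r} → r < k′ → cell (σ r) ≢ cell last → v < n → inside v ≡ true →
                         cell v ≡ cell (σ r) → v ∈ selected k′
      cellmate-earlier {v} {r} r<k′ c≢last v<n in-v eq =
        rank<⇒selected v<n (subst (rank v <_) (rank-σ (r<n ≤-refl)) (rank-mono v<n v≺last))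
        where
        density-eq : density (σ r) ≡ density v
        density-eq = trans (density-inside (σ-in (<⇒≤ r<k′)))
                           (trans (cong population (sym eq)) (sym (density-inside in-v)))
        prefix-eq : prefix (σ r) ≡ prefix v
        prefix-eq = cong₂ _∷_ (cong (n ∸_) density-eq)
          (cong₂ (λ a b → a ∷ b ∷ []) (sym (cong proj₁ eq)) (sym (cong proj₂ eq)))
        prefix-≢ : prefix (σ r) ≢ prefix last
        prefix-≢ e = c≢last (cong₂ _,_ (∷-injectiveˡ (∷-injectiveʳ e)) (∷-injectiveˡ (∷-injectiveʳ (∷-injectiveʳ e))))
        v≺last : key v ≺ key last
        v≺last = subst (λ p → (p ++ v ∷ []) ≺ key last) prefix-eq
          (≺-prefix {us = σ r ∷ []} {last ∷ []} {v ∷ []} refl prefix-≢ (before-last r<k′))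

      F-members : ∀ {v} → v ∈ concatMap members F → v ∈ selected k′
      F-members {v} v∈ = from-cell (∈-concatMap⁻ members F v∈)
        where
        from-index : ∀ {c} → v < n × inside v ≡ true × cell v ≡ c →
                     ∃[ r ] r < k′ × c ≡ cell (σ r) × c ≢ cell last → v ∈ selected k′
        from-index (v<n , in-v , eq) (r , r<k′ , refl , c≢last) =
          cellmate-earlier r<k′ c≢last v<n in-v eq
        from-cell : ∃[ c ] c ∈ F × v ∈ members c → v ∈ selected k′
        from-cell (c , c∈F , v∈c) = from-index (∈-members⁻ v∈c) (F-earlier c∈F)

      F-total : Σℓ population F ≤ k′
      F-total = subst₂ _≤_ (length-concatMap members F) (length-selected k′)
        (length-⊆ (concat-members-unique (Unique.filter⁺ ¬last? CA-uniq)) F-members)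

      k≤CO : suc k′ ≤ Σℓ population CO
      k≤CO = ≤-trans k≤O (subst (length O ≤_) (length-concatMap members CO) (length-⊆ O-uniq
        (λ v∈ → ∈-concatMap members (O⊆CO v∈) (∈-members⁺ (proj₁ (O-inside v∈)) (proj₂ (O-inside v∈))))))

      excess : (c : Cell) → ℕ
      excess c = population c ∸ θ

      -- A point denser than `last` precedes it, so its cell is met; that cell is not the cell of
      -- `last`, whose population is `θ`.
      populous⇒F : ∀ {c} → θ < population c → c ∈ F
      populous⇒F {c} θ<p = from-member (population-nonempty c (λ p≡0 → n≮0 (subst (θ <_) p≡0 θ<p)))
        where
        from-point : ∀ v → v < n × inside v ≡ true × cell v ≡ c → c ∈ F
        from-point v (v<n , in-v , refl) =
          ∈-filter⁺ ¬last? (subst (λ w → cell w ∈ CA) (σ-rank v<n) (⇒CA (<⇒≤ rv<k′)))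
            (λ eq → <-irrefl (trans (density-inside (σ-in ≤-refl)) (cong population (sym eq))) θ<p)
          where
          rv<k′ : rank v < k′
          rv<k′ = subst (rank v <_) (rank-σ (r<n ≤-refl))
            (rank-mono v<n (denser⇒≺ (subst (θ <_) (sym (density-inside in-v)) θ<p)))
        from-member : ∃[ v ] v ∈ members c → c ∈ F
        from-member (v , v∈c) = from-point v (∈-members⁻ v∈c)

      excess-⊆ : ∀ {c} → c ∈ CO → excess c ≡ 0 ⊎ c ∈ F
      excess-⊆ {c} _ = split (population c ≤? θ)
        where
        split : Dec (population c ≤ θ) → excess c ≡ 0 ⊎ c ∈ F
        split (yes p≤θ) = inj₁ (m≤n⇒m∸n≡0 p≤θ)
        split (no p≰θ)  = inj₂ (populous⇒F (≰⇒> p≰θ))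

      F<CO : length F < length CO
      -- Both totals are taken relative to the base `θ`: nothing is truncated on `F`, and on `CO`
      -- truncation goes in the favourable direction. The excess of `F` then cancels.
      F<CO = *-cancelʳ-< θ (length F) (length CO) (+-cancelˡ-< (Σℓ excess F) _ _ (begin-strict
        Σℓ excess F + length F * θ       ≡⟨ Σℓ-∸-exact population θ F F-dense ⟩
        Σℓ population F                  ≤⟨ F-total ⟩
        k′                               <⟨ k≤CO ⟩
        Σℓ population CO                 ≤⟨ Σℓ-∸ population θ CO ⟩
        length CO * θ + Σℓ excess CO     ≤⟨ +-monoʳ-≤ (length CO * θ) (Σℓ-⊆ excess CO-uniq excess-⊆) ⟩
        length CO * θ + Σℓ excess F      ≡⟨ +-comm (length CO * θ) _ ⟩
        Σℓ excess F + length CO * θ      ∎))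
        where open ≤-Reasoning

  -- The decision is an argument, so that `occupied` and `new` branch on the same test and `N-suc`
  -- follows from one case distinction.
  insert : ∀ {A : Set} {x : A} {xs} → Dec (x ∈ xs) → List A
  insert {xs = xs} (yes _)        = xs
  insert {x = x} {xs} (no _)      = x ∷ xs

  indicator : ∀ {A : Set} → Dec A → ℕ
  indicator (yes _) = 0
  indicator (no _)  = 1

  -- Cells met by the first points at every level of subdivision.

  module Levels {C : Set} (_≟ᶜ_ : DecidableEquality C) (code : ℕ → ℕ → C) where
    open DecMembership _≟ᶜ_ using (_∈?_)

    occupied : ℕ → ℕ → List C
    occupied a zero    = []
    occupied a (suc r) = insert (code a r ∈? occupied a r)

    N : ℕ → ℕ → ℕ
    N a r = length (occupied a r)

    new : ℕ → ℕ → ℕ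
    new a r = indicator (code a r ∈? occupied a r)

    N-suc : ∀ a r → N a (suc r) ≡ N a r + new a r
    N-suc a r with code a r ∈? occupied a r
    ... | yes _ = sym (+-identityʳ _)
    ... | no _  = +-comm 1 _

    ∈-occupied⁺ : ∀ a {r r′} → r′ < r → code a r′ ∈ occupied a r
    ∈-occupied⁺ a {suc r} {r′} r′<1+r with r′ ℕ.≟ r | code a r ∈? occupied a r
    ... | yes refl | yes c∈ = c∈
    ... | yes refl | no _   = here refl
    ... | no r′≢r  | yes _  = ∈-occupied⁺ a (≤∧≢⇒< (≤-pred r′<1+r) r′≢r)
    ... | no r′≢r  | no _   = there (∈-occupied⁺ a (≤∧≢⇒< (≤-pred r′<1+r) r′≢r))

    ∈-occupied⁻ : ∀ a r {c} → c ∈ occupied a r → ∃[ r′ ] r′ < r × c ≡ code a r′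
    ∈-occupied⁻ a (suc r) c∈ with code a r ∈? occupied a r
    ∈-occupied⁻ a (suc r) c∈ | yes _ with ∈-occupied⁻ a r c∈
    ... | r′ , r′<r , eq = r′ , m<n⇒m<1+n r′<r , eq
    ∈-occupied⁻ a (suc r) (here refl) | no _ = r , ≤-refl , refl
    ∈-occupied⁻ a (suc r) (there c∈)  | no _ with ∈-occupied⁻ a r c∈
    ... | r′ , r′<r , eq = r′ , m<n⇒m<1+n r′<r , eq

    occupied-unique : ∀ a r → Unique (occupied a r)
    occupied-unique a zero    = []
    occupied-unique a (suc r) with code a r ∈? occupied a r
    ... | yes _  = occupied-unique a r
    ... | no c∉  = All.tabulate (λ x∈ c≡x → c∉ (subst (_∈ occupied a r) (sym c≡x) x∈)) ∷ occupied-unique a r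

    -- In units of the diameter of a cell of level B, the r-th point is within 1 + E B r of an earlier
    -- one: halving the cells doubles this bound if the new cell is fresh; otherwise 1 would do, but with
    -- 1 + 2 E B r the total over r depends only on the numbers of cells met.
    E : ℕ → ℕ → ℕ
    E zero    r = 0
    E (suc B) r = 2 * E B r + new (suc B) r

    Tot : ℕ → ℕ → ℕ
    Tot B zero    = 0
    Tot B (suc r) = Tot B r + E B r

    Tot-zero : ∀ r → Tot 0 r ≡ 0
    Tot-zero zero    = refl
    Tot-zero (suc r) = trans (+-identityʳ _) (Tot-zero r)

    -- Summed over the points, the freshness indicators of a level count the cells met at that
    -- level.
    Tot-suc : ∀ B r → Tot (suc B) r ≡ 2 * Tot B r + N (suc B) r
    Tot-suc B zero    = refl
    Tot-suc B (suc r) rewrite Tot-suc B r | N-suc (suc B) r =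
      shuffle (Tot B r) (N (suc B) r) (E B r) (new (suc B) r)
      where
      shuffle : ∀ t m e x → 2 * t + m + (2 * e + x) ≡ 2 * (t + e) + (m + x)
      shuffle = solve-∀

    module Refining (parent : C → C) (children : C → List C) (root : C)
                    (code-root : ∀ r → code 0 r ≡ root)
                    (code-parent : ∀ a r → code a r ≡ parent (code (suc a) r))
                    (code-children : ∀ a r → code (suc a) r ∈ children (code a r))
                    (four-children : ∀ c → length (children c) ≡ 4) where

      N-root : ∀ r → N 0 r ≤ 1
      N-root r = length-⊆ {ys = root ∷ []} (occupied-unique 0 r) (λ c∈ → only (∈-occupied⁻ 0 r c∈))
        where
        only : ∀ {c} → ∃[ r′ ] r′ < r × c ≡ code 0 r′ → c ∈ root ∷ []
        only (r′ , _ , refl) = here (code-root r′)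

      -- Every occupied cell is the parent of an occupied cell one level finer.
      N-coarser : ∀ a r → N a r ≤ N (suc a) r
      N-coarser a r = subst (N a r ≤_) (length-map parent (occupied (suc a) r))
        (length-⊆ (occupied-unique a r) (λ c∈ → up (∈-occupied⁻ a r c∈)))
        where
        up : ∀ {c} → ∃[ r′ ] r′ < r × c ≡ code a r′ → c ∈ map parent (occupied (suc a) r)
        up (r′ , r′<r , refl) = subst (_∈ map parent (occupied (suc a) r)) (sym (code-parent a r′))
          (∈-map⁺ parent (∈-occupied⁺ (suc a) r′<r))

      N-finer : ∀ a r → N (suc a) r ≤ 4 * N a r
      N-finer a r = ≤-trans (length-⊆ (occupied-unique (suc a) r) (λ c∈ → down (∈-occupied⁻ (suc a) r c∈)))
        (length-concatMap-≤ children 4 (λ c → ≤-reflexive (four-children c)) (occupied a r))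
        where
        down : ∀ {c} → ∃[ r′ ] r′ < r × c ≡ code (suc a) r′ → c ∈ concatMap children (occupied a r)
        down (r′ , r′<r , refl) = ∈-concatMap children (∈-occupied⁺ a r′<r) (code-children a r′)

      N-coarser* : ∀ j a r → N a r ≤ N (j + a) r
      N-coarser* zero    a r = ≤-refl
      N-coarser* (suc j) a r = ≤-trans (N-coarser* j a r) (N-coarser (j + a) r)

      N-finer* : ∀ j a r → N (j + a) r ≤ 4 ^ j * N a r
      N-finer* zero    a r = ≤-reflexive (sym (+-identityʳ _))
      N-finer* (suc j) a r = begin
        N (suc (j + a)) r       ≤⟨ N-finer (j + a) r ⟩
        4 * N (j + a) r         ≤⟨ *-monoʳ-≤ 4 (N-finer* j a r) ⟩
        4 * (4 ^ j * N a r)     ≡⟨ *-assoc 4 (4 ^ j) _ ⟨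
        4 * 4 ^ j * N a r       ∎
        where open ≤-Reasoning

      N≤4^ : ∀ a r → N a r ≤ 4 ^ a
      N≤4^ a r = begin
        N a r           ≡⟨ cong (λ z → N z r) (+-identityʳ a) ⟨
        N (a + 0) r     ≤⟨ N-finer* a 0 r ⟩
        4 ^ a * N 0 r   ≤⟨ *-monoʳ-≤ (4 ^ a) (N-root r) ⟩
        4 ^ a * 1       ≡⟨ *-identityʳ _ ⟩
        4 ^ a           ∎
        where open ≤-Reasoning

      -- A bound `c 4^B` survives the recursion `T ↦ 2 T + 4^(B+1)` when `2 c + 4 ≤ 4 c`, whence
      -- `c = 2`.
      Tot≤ : ∀ B r → Tot B r ≤ 2 * 4 ^ B
      Tot≤ zero    r = subst (_≤ 2) (sym (Tot-zero r)) z≤n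
      Tot≤ (suc B) r = begin
        Tot (suc B) r                     ≡⟨ Tot-suc B r ⟩
        2 * Tot B r + N (suc B) r         ≤⟨ +-mono-≤ (*-monoʳ-≤ 2 (Tot≤ B r)) (N≤4^ (suc B) r) ⟩
        2 * (2 * 4 ^ B) + 4 * 4 ^ B       ≡⟨ shuffle (4 ^ B) ⟩
        2 * (4 * 4 ^ B)                   ∎
        where
        open ≤-Reasoning
        shuffle : ∀ x → 2 * (2 * x) + 4 * x ≡ 2 * (4 * x)
        shuffle = solve-∀

      -- Adding `t` on both sides turns the recursion `T ↦ 2 T + t` into plain doubling.
      Tot-above : ∀ j a r t → (∀ i → i ≤ j → N (i + a) r ≤ t) → Tot (j + a) r + t ≤ 2 ^ j * (Tot a r + t)
      Tot-above zero    a r t _   = ≤-reflexive (sym (+-identityʳ _))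
      Tot-above (suc j) a r t N≤t = begin
        Tot (suc (j + a)) r + t                 ≡⟨ cong (_+ t) (Tot-suc (j + a) r) ⟩
        2 * Tot (j + a) r + N (suc j + a) r + t ≤⟨ +-monoˡ-≤ t (+-monoʳ-≤ (2 * Tot (j + a) r) (N≤t (suc j) ≤-refl)) ⟩
        2 * Tot (j + a) r + t + t               ≡⟨ shuffle (Tot (j + a) r) t ⟩
        2 * (Tot (j + a) r + t)                 ≤⟨ *-monoʳ-≤ 2 (Tot-above j a r t (λ i i≤j → N≤t i (m≤n⇒m≤1+n i≤j))) ⟩
        2 * (2 ^ j * (Tot a r + t))             ≡⟨ *-assoc 2 (2 ^ j) _ ⟨
        2 * 2 ^ j * (Tot a r + t)               ∎
        where
        open ≤-Reasoning
        shuffle : ∀ x t → 2 * x + t + t ≡ 2 * (x + t)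
        shuffle = solve-∀

      -- Cell numbers may quadruple while the total doubles, so the inhomogeneous part dominates;
      -- its factor 2 is again the solution of `2 c + 4 = 4 c`.
      Tot-below : ∀ j a r → Tot (j + a) r ≤ 2 ^ j * Tot a r + 2 * (4 ^ j * N a r)
      Tot-below zero    a r = ≤-trans (≤-reflexive (sym (+-identityʳ _))) (m≤m+n _ _)
      Tot-below (suc j) a r = begin
        Tot (suc (j + a)) r
          ≡⟨ Tot-suc (j + a) r ⟩
        2 * Tot (j + a) r + N (suc j + a) r
          ≤⟨ +-mono-≤ (*-monoʳ-≤ 2 (Tot-below j a r)) (N-finer* (suc j) a r) ⟩
        2 * (2 ^ j * Tot a r + 2 * (4 ^ j * N a r)) + 4 * 4 ^ j * N a r
          ≡⟨ shuffle (2 ^ j) (Tot a r) (4 ^ j) (N a r) ⟩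
        2 * 2 ^ j * Tot a r + 2 * (4 * 4 ^ j * N a r) ∎
        where
        open ≤-Reasoning
        shuffle : ∀ p t f n → 2 * (p * t + 2 * (f * n)) + 4 * f * n ≡ 2 * p * t + 2 * (4 * f * n)
        shuffle = solve-∀

      4^≡2^*2^ : ∀ b → 4 ^ b ≡ 2 ^ b * 2 ^ b
      4^≡2^*2^ zero    = refl
      4^≡2^*2^ (suc b) = trans (cong (4 *_) (4^≡2^*2^ b)) (shuffle (2 ^ b))
        where
        shuffle : ∀ x → 4 * (x * x) ≡ 2 * x * (2 * x)
        shuffle = solve-∀

      -- The three scales: up to level b a level has at most 4^b cells, up to level 2b at most as many
      -- cells as level 2b, and below that each cell of level 2b splits into quarters.
      Tot-three-scales : ∀ b r → Tot (b + (b + b)) r ≤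
        2 * (2 ^ b * 2 ^ b * (2 ^ b * 2 ^ b)) + 3 * (2 ^ b * 2 ^ b * N (b + b) r)
      Tot-three-scales b r = begin
        Tot (b + (b + b)) r
          ≤⟨ Tot-below b (b + b) r ⟩
        q * Tot (b + b) r + 2 * (4 ^ b * t)
          ≤⟨ +-monoˡ-≤ _ (*-monoʳ-≤ q (≤-trans (m≤m+n _ t) (Tot-above b b r t middle))) ⟩
        q * (q * (Tot b r + t)) + 2 * (4 ^ b * t)
          ≤⟨ +-monoˡ-≤ _ (*-monoʳ-≤ q (*-monoʳ-≤ q (+-monoˡ-≤ t (Tot≤ b r)))) ⟩
        q * (q * (2 * 4 ^ b + t)) + 2 * (4 ^ b * t)
          ≡⟨ cong (λ z → q * (q * (2 * z + t)) + 2 * (z * t)) (4^≡2^*2^ b) ⟩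
        q * (q * (2 * (q * q) + t)) + 2 * (q * q * t)
          ≡⟨ shuffle q t ⟩
        2 * (q * q * (q * q)) + 3 * (q * q * t) ∎
        where
        open ≤-Reasoning
        q = 2 ^ b
        t = N (b + b) r
        middle : ∀ i → i ≤ b → N (i + b) r ≤ t
        middle i i≤b = subst (λ z → N (i + b) r ≤ N z r)
          (trans (sym (+-assoc (b ∸ i) i b)) (cong (_+ b) (m∸n+n≡m i≤b))) (N-coarser* (b ∸ i) (i + b) r)
        shuffle : ∀ q t → q * (q * (2 * (q * q) + t)) + 2 * (q * q * t) ≡
                          2 * (q * q * (q * q)) + 3 * (q * q * t)
        shuffle = solve-∀

-- Parent functions define trees.

module RootedTrees where
  open Combinatorics
  open import Data.Fin using (Fin; zero; suc; toℕ)
  open import Data.Fin.Subset using (inside; outside)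
  open import Data.Vec using ([]; _∷_; here; there)

  elements : ∀ {n} → Subset n → List (Fin n)
  elements []            = []
  elements (inside ∷ p)  = zero ∷ map suc (elements p)
  elements (outside ∷ p) = map suc (elements p)

  length-elements : ∀ {n} (p : Subset n) → length (elements p) ≡ ∣ p ∣
  length-elements []            = refl
  length-elements (inside ∷ p)  = cong suc (trans (length-map suc (elements p)) (length-elements p))
  length-elements (outside ∷ p) = trans (length-map suc (elements p)) (length-elements p)

  ∈-elements⁺ : ∀ {n} {p : Subset n} {i} → i ∈ₛ p → i ∈ elements p
  ∈-elements⁺ {p = inside ∷ p}  here       = here refl
  ∈-elements⁺ {p = inside ∷ p}  (there i∈) = there (∈-map⁺ suc (∈-elements⁺ i∈))
  ∈-elements⁺ {p = outside ∷ p} (there i∈) = ∈-map⁺ suc (∈-elements⁺ i∈)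

  ∈-elements⁻ : ∀ {n} (p : Subset n) {i} → i ∈ elements p → i ∈ₛ p
  ∈-elements⁻ (inside ∷ p)  (here refl) = here
  ∈-elements⁻ (inside ∷ p)  (there i∈) with ∈-map⁻ suc i∈
  ... | j , j∈ , refl = there (∈-elements⁻ p j∈)
  ∈-elements⁻ (outside ∷ p) i∈ with ∈-map⁻ suc i∈
  ... | j , j∈ , refl = there (∈-elements⁻ p j∈)

  elements-unique : ∀ {n} (p : Subset n) → Unique (elements p)
  elements-unique []            = []
  elements-unique (inside ∷ p)  =
    All.tabulate (λ i∈ → fresh (∈-map⁻ suc i∈)) ∷ Unique.map⁺ Fin.suc-injective (elements-unique p)
    where
    fresh : ∀ {i} → ∃[ j ] j ∈ elements p × i ≡ suc j → zero ≢ i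
    fresh (_ , _ , refl) ()
  elements-unique (outside ∷ p) = Unique.map⁺ Fin.suc-injective (elements-unique p)

  module Rooted {n m : ℕ} (node : Fin (suc m) → Fin n) (node-injective : ∀ {r s} → node r ≡ node s → r ≡ s)
                (parent : Fin m → Fin (suc m)) (parent≤ : ∀ j → toℕ (parent j) ℕ.≤ toℕ j)
                (vertices : Subset n) (node∈ : ∀ r → node r ∈ₛ vertices)
                (∈⇒node : ∀ {v} → v ∈ₛ vertices → ∃[ r ] v ≡ node r) where

    graph : Graph n
    graph = record { vertices = vertices ; edges# = m ; edge = λ j → node (suc j) , node (parent j) }

    _++ʷ_ : ∀ {u v w} → Walk graph u v → Walk graph v w → Walk graph u w
    []              ++ʷ w′ = w′
    (j ∷⟨ h ⟩ w)    ++ʷ w′ = j ∷⟨ h ⟩ (w ++ʷ w′)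

    -- The bound `b` is the recursion measure: `parent` decreases the index but not structurally.
    to-root : ∀ b r → toℕ r ℕ.≤ b → Walk graph (node r) (node zero)
    to-root b       zero    _         = []
    to-root (suc b) (suc j) (s≤s j≤b) = j ∷⟨ inj₁ refl ⟩ to-root b (parent j) (ℕ.≤-trans (parent≤ j) j≤b)

    from-root : ∀ b r → toℕ r ℕ.≤ b → Walk graph (node zero) (node r)
    from-root b       zero    _         = []
    from-root (suc b) (suc j) (s≤s j≤b) =
      from-root b (parent j) (ℕ.≤-trans (parent≤ j) j≤b) ++ʷ (j ∷⟨ inj₂ refl ⟩ [])

    connected : ∀ {u v} → u ∈ₛ vertices → v ∈ₛ vertices → Walk graph u v
    connected u∈ v∈ with ∈⇒node u∈ | ∈⇒node v∈
    ... | r , refl | s , refl = to-root _ r ℕ.≤-refl ++ʷ from-root _ s ℕ.≤-refl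

    parent-distinct : ∀ J → node (parent J) ≢ node (suc J)
    parent-distinct J eq = ℕ.<-irrefl (cong toℕ (node-injective eq)) (s≤s (parent≤ J))

    -- Among the edges numbered at most J, node J + 1 is a leaf.
    leaf-source : ∀ {j J v} → toℕ j ℕ.< toℕ J → ¬ Joins graph j (node (suc J)) v
    leaf-source j<J (inj₁ eq) =
      ℕ.<-irrefl (cong toℕ (Fin.suc-injective (node-injective (cong proj₁ eq)))) j<J
    leaf-source {j} {J} j<J (inj₂ eq) = ℕ.<-irrefl refl (ℕ.<-trans j<J (ℕ.≤-trans
      (ℕ.≤-reflexive (sym (cong toℕ (node-injective (cong proj₂ eq))))) (parent≤ j)))

    joins-sym : ∀ {j u v} → Joins graph j u v → Joins graph j v u
    joins-sym (inj₁ eq) = inj₂ eq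
    joins-sym (inj₂ eq) = inj₁ eq

    -- No edge below `J` touches `node (suc J)`, so such a walk has no first step.
    walk-from-leaf : ∀ {J u v} (w : Walk graph u v) → u ≡ node (suc J) →
                     (∀ {j} → j ∈ edgesOf graph w → toℕ j ℕ.< toℕ J) → v ≡ node (suc J)
    walk-from-leaf []           u≡leaf _     = u≡leaf
    walk-from-leaf (j ∷⟨ h ⟩ w) refl   below = ⊥-elim (leaf-source (below (here refl)) h)

    walk-to-leaf : ∀ {J u v} (w : Walk graph u v) → v ≡ node (suc J) →
                   (∀ {j} → j ∈ edgesOf graph w → toℕ j ℕ.< toℕ J) → u ≡ node (suc J)
    walk-to-leaf []           v≡leaf _     = v≡leaf
    walk-to-leaf (j ∷⟨ h ⟩ w) v≡leaf below with walk-to-leaf w v≡leaf (below ∘ there)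
    ... | refl = ⊥-elim (leaf-source (below (here refl)) (joins-sym h))

    -- The two parts of a walk cut at an occurrence of `J`. Both avoid `J` because the walk repeats
    -- no edge.
    record Split (J : Fin m) {u v} (w : Walk graph u v) : Set where
      field
        {a b}   : Fin n
        before  : Walk graph u a
        joins   : Joins graph J a b
        after   : Walk graph b v
        before⊆ : ∀ {j} → j ∈ edgesOf graph before → j ∈ edgesOf graph w × j ≢ J
        after⊆  : ∀ {j} → j ∈ edgesOf graph after → j ∈ edgesOf graph w × j ≢ J

    split : ∀ {J u v} (w : Walk graph u v) → Unique (edgesOf graph w) → J ∈ edgesOf graph w → Split J w
    split (j ∷⟨ h ⟩ w) (j∉ ∷ uniq) (here refl) = record
      { before = [] ; joins = h ; after = w ; before⊆ = λ ()
      ; after⊆ = λ i∈ → there i∈ , λ { refl → All.lookup j∉ i∈ refl } }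
    split {J} (j ∷⟨ h ⟩ w) (j∉ ∷ uniq) (there J∈) = record
      { before = j ∷⟨ h ⟩ before ; joins = joins ; after = after
      ; before⊆ = λ { (here refl) → here refl , λ { refl → All.lookup j∉ J∈ refl }
                    ; (there i∈) → there (proj₁ (before⊆ i∈)) , proj₂ (before⊆ i∈) }
      ; after⊆ = λ i∈ → there (proj₁ (after⊆ i∈)) , proj₂ (after⊆ i∈) }
      where open Split (split w uniq J∈)

    -- Removing the highest edge `J` of a closed walk leaves two parts with lower edges only. One
    -- end of `J` is a leaf for these edges, and the two parts, glued at `u`, would connect it to
    -- the other end, which is its distinct parent.
    top-edge-free : ∀ {J u} (w : Walk graph u u) → Unique (edgesOf graph w) →
                    (∀ {j} → j ∈ edgesOf graph w → toℕ j ℕ.≤ toℕ J) → ¬ J ∈ edgesOf graph w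
    top-edge-free {J} w uniq below J∈ = impossible joins
      where
      open Split (split w uniq J∈)
      lower : ∀ {j} → j ∈ edgesOf graph w × j ≢ J → toℕ j ℕ.< toℕ J
      lower (j∈ , j≢J) = ℕ.≤∧≢⇒< (below j∈) (j≢J ∘ Fin.toℕ-injective)
      impossible : Joins graph J a b → ⊥
      impossible (inj₁ eq) = parent-distinct J (trans (cong proj₂ eq) (walk-to-leaf after
        (walk-to-leaf before (sym (cong proj₁ eq)) (lower ∘ before⊆)) (lower ∘ after⊆)))
      impossible (inj₂ eq) = parent-distinct J (trans (cong proj₂ eq) (walk-from-leaf before
        (walk-from-leaf after (sym (cong proj₁ eq)) (lower ∘ after⊆)) (lower ∘ before⊆)))

    -- Descent on the edge numbers: the highest number allowed cannot occur by `top-edge-free`, so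
    -- the bound drops to zero.
    closed-walk-empty : ∀ b {u} (w : Walk graph u u) → Unique (edgesOf graph w) →
                        (∀ {j} → j ∈ edgesOf graph w → toℕ j ℕ.< b) → edgesOf graph w ≡ []
    closed-walk-empty zero w uniq below with edgesOf graph w
    ... | []    = refl
    ... | j ∷ _ with below (here refl)
    ... | ()
    closed-walk-empty (suc b) w uniq below = closed-walk-empty b w uniq lower
      where
      lower : ∀ {j} → j ∈ edgesOf graph w → toℕ j ℕ.< b
      lower {j} j∈ = ℕ.≤∧≢⇒< (ℕ.≤-pred (below j∈)) (λ j≡b → top-edge-free {j} w uniq
        (λ i∈ → ℕ.≤-trans (ℕ.≤-pred (below i∈)) (ℕ.≤-reflexive (sym j≡b))) j∈)

    isTree : IsTree graph
    isTree = record
      { nonempty  = node zero , node∈ zero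
      ; endpoints = λ j → node∈ (suc j) , node∈ (parent j)
      ; connected = connected
      ; acyclic   = λ w → λ { (nonempty , uniq , _) →
          nonempty (closed-walk-empty m w uniq (λ {j} _ → Fin.toℕ<n j)) } }

    size : suc m ℕ.≤ ∣ vertices ∣
    size = subst₂ ℕ._≤_ (trans (length-map node (allFin (suc m))) (length-tabulate (λ i → i))) (length-elements vertices)
      (length-⊆ (Unique.map⁺ node-injective (Unique.allFin⁺ (suc m))) (λ v∈ → ∈-elements⁺ (is-node (∈-map⁻ node v∈))))
      where
      is-node : ∀ {v} → ∃[ r ] r ∈ allFin (suc m) × v ≡ node r → v ∈ₛ vertices
      is-node (r , _ , refl) = node∈ r

-- Ordered-field arithmetic and distances in the plane.

module RealArithmetic (R : RealNumbers) where
  open RealNumbers R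
  open Plane R using (Point; dist)

  open IsCommutativeRing isCommutativeRing public
    using (+-assoc; +-comm; +-identityˡ; +-identityʳ; -‿inverseʳ; -‿inverseˡ;
           *-assoc; *-comm; *-identityˡ; *-identityʳ; distribˡ; distribʳ; zeroˡ; zeroʳ)
  open IsDecTotalOrder isDecTotalOrder public
    using () renaming (refl to ≤-refl; trans to ≤-trans; antisym to ≤-antisym;
                       total to ≤-total; reflexive to ≤-reflexive)

  private
    ring = CommutativeRing.ring commutativeRing
  open RingProperties ring using (-0#≈0#; -‿distribˡ-*; -‿involutive)

  fromℕ-+ : ∀ m n → fromℕ (m ℕ.+ n) ≡ fromℕ m + fromℕ n
  fromℕ-+ zero    n = sym (+-identityˡ _)
  fromℕ-+ (suc m) n = trans (cong (1# +_) (fromℕ-+ m n)) (sym (+-assoc _ _ _))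

  fromℕ-* : ∀ m n → fromℕ (m ℕ.* n) ≡ fromℕ m * fromℕ n
  fromℕ-* zero    n = sym (zeroˡ _)
  fromℕ-* (suc m) n = begin
    fromℕ (n ℕ.+ m ℕ.* n)           ≡⟨ fromℕ-+ n (m ℕ.* n) ⟩
    fromℕ n + fromℕ (m ℕ.* n)       ≡⟨ cong₂ _+_ (sym (*-identityˡ _)) (fromℕ-* m n) ⟩
    1# * fromℕ n + fromℕ m * fromℕ n ≡⟨ distribʳ _ _ _ ⟨
    (1# + fromℕ m) * fromℕ n        ∎
    where open ≡-Reasoning

  fromℕ-suc-* : ∀ m x → fromℕ (suc m) * x ≡ x + fromℕ m * x
  fromℕ-suc-* m x = trans (distribʳ x 1# (fromℕ m)) (cong (_+ fromℕ m * x) (*-identityˡ x))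

  -- The ring solver needs coefficients whose equality computes; the integers serve, through this
  -- homomorphism.
  fromℤ : ℤ → ℝ
  fromℤ (ℤ.+ n)     = fromℕ n
  fromℤ (-[1+ n ]) = - fromℕ (suc n)

  private
    cancel-suc : ∀ a b → a - b ≡ (1# + a) - (1# + b)
    cancel-suc a b = begin
      a - b                          ≡⟨ cong (_- b) (+-identityˡ a) ⟨
      0# + a - b                     ≡⟨ cong (λ z → z + a - b) (-‿inverseʳ 1#) ⟨
      1# - 1# + a - b                ≡⟨ cong (_- b) (+-assoc _ _ _) ⟩
      1# + (- 1# + a) - b            ≡⟨ cong (λ z → 1# + z - b) (+-comm _ _) ⟩
      1# + (a + - 1#) - b            ≡⟨ cong (_- b) (+-assoc _ _ _) ⟨
      1# + a + - 1# - b              ≡⟨ +-assoc _ _ _ ⟩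
      1# + a + (- 1# - b)            ≡⟨ cong (1# + a +_) (RingProperties.-‿+-comm ring 1# b) ⟩
      (1# + a) - (1# + b)            ∎
      where open ≡-Reasoning

    fromℤ-⊖ : ∀ m n → fromℤ (m ℤ.⊖ n) ≡ fromℕ m - fromℕ n
    fromℤ-⊖ zero zero = sym (-‿inverseʳ 0#)
    fromℤ-⊖ zero (suc n) = sym (+-identityˡ _)
    fromℤ-⊖ (suc m) zero = sym (trans (cong (fromℕ (suc m) +_) -0#≈0#) (+-identityʳ _))
    fromℤ-⊖ (suc m) (suc n) = begin
      fromℤ (suc m ℤ.⊖ suc n)        ≡⟨ cong fromℤ (ℤ.[1+m]⊖[1+n]≡m⊖n m n) ⟩
      fromℤ (m ℤ.⊖ n)                ≡⟨ fromℤ-⊖ m n ⟩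
      fromℕ m - fromℕ n            ≡⟨ cancel-suc (fromℕ m) (fromℕ n) ⟩
      fromℕ (suc m) - fromℕ (suc n) ∎
      where open ≡-Reasoning

    fromℤ-neg : ∀ i → fromℤ (ℤ.- i) ≡ - fromℤ i
    fromℤ-neg (ℤ.+ zero)   = sym -0#≈0#
    fromℤ-neg (ℤ.+ suc n)  = refl
    fromℤ-neg (-[1+ n ]) = sym (-‿involutive _)

    fromℤ-+ : ∀ i j → fromℤ (i ℤ.+ j) ≡ fromℤ i + fromℤ j
    fromℤ-+ (ℤ.+ m)    (ℤ.+ n)    = fromℕ-+ m n
    fromℤ-+ (ℤ.+ m)    -[1+ n ] = fromℤ-⊖ m (suc n)
    fromℤ-+ -[1+ m ] (ℤ.+ n)    = trans (fromℤ-⊖ n (suc m)) (+-comm _ _)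
    fromℤ-+ -[1+ m ] -[1+ n ] = begin
      - fromℕ (suc (suc (m ℕ.+ n)))       ≡⟨ cong (λ z → - fromℕ (suc z)) (ℕ.+-suc m n) ⟨
      - fromℕ (suc m ℕ.+ suc n)           ≡⟨ cong -_ (fromℕ-+ (suc m) (suc n)) ⟩
      - (fromℕ (suc m) + fromℕ (suc n))   ≡⟨ RingProperties.-‿+-comm ring _ _ ⟨
      - fromℕ (suc m) - fromℕ (suc n)     ∎
      where open ≡-Reasoning

    fromℤ-* : ∀ i j → fromℤ (i ℤ.* j) ≡ fromℤ i * fromℤ j
    fromℤ-* (ℤ.+ m) j = go m j
      where
      open ≡-Reasoning
      go : ∀ m j → fromℤ (ℤ.+ m ℤ.* j) ≡ fromℕ m * fromℤ j
      go zero j = trans (cong fromℤ (ℤ.*-zeroˡ j)) (sym (zeroˡ _))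
      go (suc m) j = begin
        fromℤ (ℤ.+ suc m ℤ.* j)              ≡⟨ cong fromℤ (ℤ.suc-* (ℤ.+ m) j) ⟩
        fromℤ (j ℤ.+ ℤ.+ m ℤ.* j)            ≡⟨ fromℤ-+ j (ℤ.+ m ℤ.* j) ⟩
        fromℤ j + fromℤ (ℤ.+ m ℤ.* j)        ≡⟨ cong₂ _+_ (sym (*-identityˡ _)) (go m j) ⟩
        1# * fromℤ j + fromℕ m * fromℤ j   ≡⟨ distribʳ _ _ _ ⟨
        (1# + fromℕ m) * fromℤ j           ∎
    fromℤ-* -[1+ m ] j = begin
      fromℤ (-[1+ m ] ℤ.* j)        ≡⟨ cong fromℤ (ℤ.neg-distribˡ-* (ℤ.+ suc m) j) ⟨
      fromℤ (ℤ.- (ℤ.+ suc m ℤ.* j))   ≡⟨ fromℤ-neg (ℤ.+ suc m ℤ.* j) ⟩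
      - fromℤ (ℤ.+ suc m ℤ.* j)       ≡⟨ cong -_ (fromℤ-* (ℤ.+ suc m) j) ⟩
      - (fromℕ (suc m) * fromℤ j)   ≡⟨ -‿distribˡ-* _ _ ⟩
      - fromℕ (suc m) * fromℤ j     ∎
      where open ≡-Reasoning

    ℤ-raw : RawRing _ _
    ℤ-raw = record { Carrier = ℤ; _≈_ = _≡_; _+_ = ℤ._+_; _*_ = ℤ._*_; -_ = ℤ.-_
                   ; 0# = ℤ.+ 0; 1# = ℤ.+ 1 }

    almost : AlmostCommutativeRing _ _
    almost = fromCommutativeRing commutativeRing

    morphism : ℤ-raw -Raw-AlmostCommutative⟶ almost
    morphism = record
      { ⟦_⟧ = fromℤ ; +-homo = fromℤ-+ ; *-homo = fromℤ-* ; -‿homo = fromℤ-neg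
      ; 0-homo = refl ; 1-homo = +-identityʳ 1# }

    coeff≟ : ∀ i j → Maybe (fromℤ i ≡ fromℤ j)
    coeff≟ i j with i ℤ.≟ j
    ... | yes eq = just (cong fromℤ eq)
    ... | no _   = nothing

  open RingSolver ℤ-raw almost morphism coeff≟ public
    using (solve; _:+_; _:*_; _:-_; :-_; con; _:=_)

  -- An explicit nonnegative slack reduces an inequality to a ring identity, which the solver
  -- proves. Most inequalities below take this form.
  ≤-by : ∀ {x y e} → 0# ≤ e → y ≡ x + e → x ≤ y
  ≤-by {x} 0≤e refl = ≤-trans (≤-reflexive (sym (+-identityʳ x))) (+-monoʳ-≤ x 0≤e)

  0≤-diff : ∀ {x y} → x ≤ y → 0# ≤ y - x
  0≤-diff {x} {y} x≤y =
    ≤-trans (≤-reflexive (sym (-‿inverseˡ x)))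
            (≤-trans (+-monoʳ-≤ (- x) x≤y) (≤-reflexive (+-comm (- x) y)))

  +-mono-≤ : ∀ {a b c d} → a ≤ b → c ≤ d → a + c ≤ b + d
  +-mono-≤ {a} {b} {c} {d} a≤b c≤d =
    ≤-trans (+-monoʳ-≤ a c≤d)
            (≤-trans (≤-reflexive (+-comm a d)) (≤-trans (+-monoʳ-≤ d a≤b) (≤-reflexive (+-comm d b))))

  +-nonNeg : ∀ {a b} → 0# ≤ a → 0# ≤ b → 0# ≤ a + b
  +-nonNeg 0≤a 0≤b = ≤-trans 0≤a (≤-by 0≤b refl)

  *-monoˡ-≤ : ∀ {c a b} → 0# ≤ c → a ≤ b → c * a ≤ c * b
  *-monoˡ-≤ {c} {a} {b} 0≤c a≤b = ≤-by (*-nonNeg 0≤c (0≤-diff a≤b))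
    (solve 3 (λ c a b → c :* b := c :* a :+ c :* (b :- a)) refl c a b)

  *-monoʳ-≤ : ∀ {c a b} → 0# ≤ c → a ≤ b → a * c ≤ b * c
  *-monoʳ-≤ {c} {a} {b} 0≤c a≤b =
    subst₂ _≤_ (*-comm c a) (*-comm c b) (*-monoˡ-≤ 0≤c a≤b)

  0≤x² : ∀ x → 0# ≤ x * x
  0≤x² x with ≤-total 0# x
  ... | inj₁ 0≤x = *-nonNeg 0≤x 0≤x
  ... | inj₂ x≤0 = subst (0# ≤_) (solve 1 (λ x → (con (ℤ.+ 0) :- x) :* (con (ℤ.+ 0) :- x) := x :* x) refl x)
                         (*-nonNeg (0≤-diff x≤0) (0≤-diff x≤0))

  0≤1 : 0# ≤ 1#
  0≤1 = subst (0# ≤_) (*-identityˡ 1#) (0≤x² 1#)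

  0≤fromℕ : ∀ n → 0# ≤ fromℕ n
  0≤fromℕ zero    = ≤-refl
  0≤fromℕ (suc n) = +-nonNeg 0≤1 (0≤fromℕ n)

  fromℕ-mono : ∀ {m n} → m ℕ.≤ n → fromℕ m ≤ fromℕ n
  fromℕ-mono {m} {n} m≤n = ≤-by (0≤fromℕ (n ℕ.∸ m))
    (trans (cong fromℕ (sym (ℕ.m+[n∸m]≡n m≤n))) (fromℕ-+ m _))

  1≤⇒≢0 : ∀ {x} → 1# ≤ x → x ≢ 0#
  1≤⇒≢0 1≤x refl = 0≢1 (≤-antisym 0≤1 1≤x)

  1≤fromℕ : ∀ {n} → 1 ℕ.≤ n → 1# ≤ fromℕ n
  1≤fromℕ {suc n} _ = ≤-by (0≤fromℕ n) refl

  -- If the order were reversed, antisymmetry would make the products equal, and the inverse of `c`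
  -- cancels.
  *-cancelˡ-≤ : ∀ {c a b} → 0# ≤ c → c ≢ 0# → c * a ≤ c * b → a ≤ b
  *-cancelˡ-≤ {c} {a} {b} 0≤c c≢0 ca≤cb with ≤-total a b
  ... | inj₁ a≤b = a≤b
  ... | inj₂ b≤a = ≤-reflexive (begin
    a               ≡⟨ expand a ⟩
    c ⁻¹ * (c * a)  ≡⟨ cong (c ⁻¹ *_) (≤-antisym ca≤cb (*-monoˡ-≤ 0≤c b≤a)) ⟩
    c ⁻¹ * (c * b)  ≡⟨ expand b ⟨
    b               ∎)
    where
    open ≡-Reasoning
    expand : ∀ x → x ≡ c ⁻¹ * (c * x)
    expand x = sym (trans (solve 3 (λ i c x → i :* (c :* x) := c :* i :* x) refl (c ⁻¹) c x)
                          (trans (cong (_* x) (⁻¹-inverseʳ c c≢0)) (*-identityˡ x)))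

  -- In the case `b ≤ a` with `a` nonzero, `a * a ≤ b * b ≤ a * b`, and `a` cancels.
  sq-cancel-≤ : ∀ {a b} → 0# ≤ b → a * a ≤ b * b → a ≤ b
  sq-cancel-≤ {a} {b} 0≤b a²≤b² with ≤-total a b | IsDecTotalOrder._≟_ isDecTotalOrder a 0#
  ... | inj₁ a≤b | _        = a≤b
  ... | inj₂ b≤a | yes refl = 0≤b
  ... | inj₂ b≤a | no a≢0   =
    *-cancelˡ-≤ (≤-trans 0≤b b≤a) a≢0 (≤-trans a²≤b² (*-monoʳ-≤ 0≤b b≤a))

  Near : ℝ → ℝ → ℝ → Set
  Near e x y = x ≤ y + e × y ≤ x + e

  near-sym : ∀ {e x y} → Near e x y → Near e y x
  near-sym (p , q) = q , p

  near-refl : ∀ {e x} → 0# ≤ e → Near e x x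
  near-refl 0≤e = ≤-by 0≤e refl , ≤-by 0≤e refl

  near-trans : ∀ {e f x y z} → Near e x y → Near f y z → Near (e + f) x z
  near-trans {e} {f} {x} {y} {z} (p , q) (p′ , q′) =
    ≤-by (+-nonNeg (0≤-diff p) (0≤-diff p′))
      (solve 5 (λ e f x y z → z :+ (e :+ f) := x :+ ((y :+ e :- x) :+ (z :+ f :- y))) refl e f x y z) ,
    ≤-by (+-nonNeg (0≤-diff q) (0≤-diff q′))
      (solve 5 (λ e f x y z → x :+ (e :+ f) := z :+ ((x :+ e :- y) :+ (y :+ f :- z))) refl e f x y z)

  -- The maximum norm. Its errors add up by linear arithmetic, whereas chaining `dist` would require
  -- the triangle inequality under a square root.
  Near₂ : ℝ → Point → Point → Set
  Near₂ e (x , y) (x′ , y′) = Near e x x′ × Near e y y′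

  0≤dist : ∀ p q → 0# ≤ dist p q
  0≤dist p q = √-nonNeg _

  dist-sq : ∀ x y x′ y′ → dist (x , y) (x′ , y′) * dist (x , y) (x′ , y′) ≡
            (x - x′) * (x - x′) + (y - y′) * (y - y′)
  dist-sq x y x′ y′ = √-square (+-nonNeg (0≤x² _) (0≤x² _))

  private
    near-of-sq : ∀ {e x y} → 0# ≤ e → (x - y) * (x - y) ≤ e * e → Near e x y
    near-of-sq {e} {x} {y} 0≤e h =
      ≤-by (0≤-diff (sq-cancel-≤ 0≤e h))
        (solve 3 (λ e x y → y :+ e := x :+ (e :- (x :- y))) refl e x y) ,
      ≤-by (0≤-diff (sq-cancel-≤ 0≤e (≤-trans (≤-reflexive
               (solve 2 (λ x y → (y :- x) :* (y :- x) := (x :- y) :* (x :- y)) refl x y)) h)))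
        (solve 3 (λ e x y → x :+ e := y :+ (e :- (y :- x))) refl e x y)

    -- The difference `e² - (x - y)²` factors into the two slacks.
    sq-of-near : ∀ {e x y} → Near e x y → (x - y) * (x - y) ≤ e * e
    sq-of-near {e} {x} {y} (p , q) = ≤-by (*-nonNeg (0≤-diff p) (0≤-diff q))
      (solve 3 (λ e x y → e :* e := (x :- y) :* (x :- y) :+ (y :+ e :- x) :* (x :+ e :- y)) refl e x y)

  near-dist : ∀ p q → Near₂ (dist p q) p q
  near-dist (x , y) (x′ , y′) =
    near-of-sq 0≤d (≤-by (0≤x² (y - y′)) (dist-sq x y x′ y′)) ,
    near-of-sq 0≤d (≤-by (0≤x² (x - x′)) (trans (dist-sq x y x′ y′) (+-comm _ _)))
    where 0≤d = 0≤dist (x , y) (x′ , y′)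

  -- The sum of squares is at most `2 e²`; bounding it by `(e + e)²` avoids the root of 2.
  dist≤ : ∀ {e} p q → 0# ≤ e → Near₂ e p q → dist p q ≤ e + e
  dist≤ {e} (x , y) (x′ , y′) 0≤e (h , h′) = sq-cancel-≤ (+-nonNeg 0≤e 0≤e)
    (≤-trans (≤-reflexive (dist-sq x y x′ y′))
    (≤-trans (+-mono-≤ (sq-of-near h) (sq-of-near h′))
    (≤-by (+-nonNeg (0≤x² e) (0≤x² e))
      (solve 1 (λ e → (e :+ e) :* (e :+ e) := e :* e :+ e :* e :+ (e :* e :+ e :* e)) refl e))))

  ≤-√ : ∀ {x y} → 0# ≤ y → x * x ≤ y → x ≤ √ y
  ≤-√ {x} {y} 0≤y h = sq-cancel-≤ (√-nonNeg y) (≤-trans h (≤-reflexive (sym (√-square 0≤y))))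

  dist-sym : ∀ p q → dist p q ≡ dist q p
  dist-sym (x , y) (x′ , y′) = cong √
    (solve 4 (λ x y x′ y′ → (x :- x′) :* (x :- x′) :+ (y :- y′) :* (y :- y′) :=
                            (x′ :- x) :* (x′ :- x) :+ (y′ :- y) :* (y′ :- y)) refl x y x′ y′)

-- Tours of a tree and their division into short pieces.

module TreeTours (R : RealNumbers) where
  open RealNumbers R
  open Plane R
  open RealArithmetic R
  open import Data.Fin using (Fin; zero; suc)

  sum-cong : ∀ {m} {f g : Vector ℝ m} → (∀ i → f i ≡ g i) → sum f ≡ sum g
  sum-cong {zero}  _  = refl
  sum-cong {suc m} eq = cong₂ _+_ (eq zero) (sum-cong (eq ∘ suc))

  sum-mono : ∀ {m} {f g : Vector ℝ m} → (∀ i → f i ≤ g i) → sum f ≤ sum g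
  sum-mono {zero}  _ = ≤-refl
  sum-mono {suc m} h = +-mono-≤ (h zero) (sum-mono (h ∘ suc))

  0≤sum : ∀ {m} {f : Vector ℝ m} → (∀ i → 0# ≤ f i) → 0# ≤ sum f
  0≤sum {zero}  _ = ≤-refl
  0≤sum {suc m} h = +-nonNeg (h zero) (0≤sum (h ∘ suc))

  sum-update : ∀ {m} {f g : Vector ℝ m} {x} j → g j ≡ x + f j → (∀ i → i ≢ j → g i ≡ f i) →
               sum g ≡ x + sum f
  sum-update {f = f} {g} {x} zero gj g≡f = begin
    g zero + sum (g ∘ suc)       ≡⟨ cong₂ _+_ gj (sum-cong (λ i → g≡f (suc i) λ ())) ⟩
    x + f zero + sum (f ∘ suc)   ≡⟨ +-assoc _ _ _ ⟩
    x + (f zero + sum (f ∘ suc)) ∎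
    where open ≡-Reasoning
  sum-update {f = f} {g} {x} (suc j) gj g≡f = begin
    g zero + sum (g ∘ suc)       ≡⟨ cong₂ _+_ (g≡f zero λ ()) (sum-update {f = f ∘ suc} j gj λ i i≢j → g≡f (suc i) (i≢j ∘ Fin.suc-injective)) ⟩
    f zero + (x + sum (f ∘ suc)) ≡⟨ solve 3 (λ a x s → a :+ (x :+ s) := x :+ (a :+ s)) refl _ _ _ ⟩
    x + (f zero + sum (f ∘ suc)) ∎
    where open ≡-Reasoning

  module Tours {n} (p : Vector Point n) where

    d : Fin n → Fin n → ℝ
    d u v = dist (p u) (p v)

    len : List (Fin n) → ℝ
    len []           = 0#
    len (_ ∷ [])     = 0#
    len (u ∷ v ∷ xs) = d u v + len (v ∷ xs)

    0≤len : ∀ xs → 0# ≤ len xs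
    0≤len []           = ≤-refl
    0≤len (_ ∷ [])     = ≤-refl
    0≤len (u ∷ v ∷ xs) = +-nonNeg (0≤dist (p u) (p v)) (0≤len (v ∷ xs))

    detour : ∀ {u xs} → u ∈ xs → Fin n → List (Fin n)
    detour {u} {_ ∷ xs} (here _)   v = u ∷ v ∷ u ∷ xs
    detour {xs = x ∷ _} (there u∈) v = x ∷ detour u∈ v

    -- One occurrence of `u` becomes `u v u`: out and back along the same segment, with the rest of
    -- the tour unchanged.
    len-detour : ∀ {u xs} (u∈ : u ∈ xs) v → len (detour u∈ v) ≡ len xs + (d u v + d u v)
    len-detour {u} {_ ∷ []} (here refl) v = begin
      d u v + (d v u + 0#) ≡⟨ cong (λ z → d u v + (z + 0#)) (dist-sym (p v) (p u)) ⟩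
      d u v + (d u v + 0#) ≡⟨ solve 1 (λ a → a :+ (a :+ con 0ℤ) := con 0ℤ :+ (a :+ a)) refl (d u v) ⟩
      0# + (d u v + d u v) ∎
      where open ≡-Reasoning
    len-detour {u} {_ ∷ y ∷ xs} (here refl) v = begin
      d u v + (d v u + (d u y + len (y ∷ xs))) ≡⟨ cong (λ z → d u v + (z + (d u y + len (y ∷ xs)))) (dist-sym (p v) (p u)) ⟩
      d u v + (d u v + (d u y + len (y ∷ xs))) ≡⟨ solve 2 (λ a l → a :+ (a :+ l) := l :+ (a :+ a)) refl (d u v) _ ⟩
      d u y + len (y ∷ xs) + (d u v + d u v)   ∎
      where open ≡-Reasoning
    len-detour {u} {x ∷ y ∷ xs} (there u∈@(here refl)) v =
      trans (cong (d x y +_) (len-detour u∈ v)) (sym (+-assoc _ _ _))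
    len-detour {u} {x ∷ y ∷ xs} (there u∈@(there _)) v =
      trans (cong (d x y +_) (len-detour u∈ v)) (sym (+-assoc _ _ _))

    ∈-detour : ∀ {u xs} (u∈ : u ∈ xs) v {z} → z ∈ xs → z ∈ detour u∈ v
    ∈-detour (here refl) v (here refl) = here refl
    ∈-detour (here refl) v (there z∈)  = there (there (there z∈))
    ∈-detour (there u∈)  v (here refl) = here refl
    ∈-detour (there u∈)  v (there z∈)  = there (∈-detour u∈ v z∈)

    target∈detour : ∀ {u xs} (u∈ : u ∈ xs) v → v ∈ detour u∈ v
    target∈detour (here refl) v = there (here refl)
    target∈detour (there u∈)  v = there (target∈detour u∈ v)

    ∈-detour⁻ : ∀ {u xs} (u∈ : u ∈ xs) v {z} → z ∈ detour u∈ v → z ∈ xs ⊎ z ≡ v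
    ∈-detour⁻ (here refl) v (here eq)                 = inj₁ (here eq)
    ∈-detour⁻ (here refl) v (there (here eq))         = inj₂ eq
    ∈-detour⁻ (here refl) v (there (there (here eq))) = inj₁ (here eq)
    ∈-detour⁻ (here refl) v (there (there (there z∈))) = inj₁ (there z∈)
    ∈-detour⁻ (there u∈)  v (here eq)                 = inj₁ (here eq)
    ∈-detour⁻ (there u∈)  v (there z∈) with ∈-detour⁻ u∈ v z∈
    ... | inj₁ z∈xs = inj₁ (there z∈xs)
    ... | inj₂ eq   = inj₂ eq

    near-len : ∀ h xs {x} → x ∈ h ∷ xs → Near₂ (len (h ∷ xs)) (p h) (p x)
    near-len h xs (here refl) = near-refl (0≤len (h ∷ xs)) , near-refl (0≤len (h ∷ xs))
    near-len h (y ∷ xs) (there x∈) =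
      near-trans (proj₁ (near-dist (p h) (p y))) (proj₁ (near-len y xs x∈)) ,
      near-trans (proj₂ (near-dist (p h) (p y))) (proj₂ (near-len y xs x∈))

    farthest : ∀ i x xs → ∃[ j ] j ∈ x ∷ xs × (∀ {v} → v ∈ x ∷ xs → d i v ≤ d i j)
    farthest i x [] = x , here refl , λ { (here refl) → ≤-refl }
    farthest i x (y ∷ xs) with farthest i y xs
    ... | j , j∈ , max with ≤-total (d i x) (d i j)
    ... | inj₁ x≤j = j , there j∈ , λ { (here refl) → x≤j ; (there v∈) → max v∈ }
    ... | inj₂ j≤x = x , here refl , λ { (here refl) → ≤-refl ; (there v∈) → ≤-trans (max v∈) j≤x }

    -- Q is the number of cells per side, so that Q e ≤ S says that e is at most the side of a cell.
    Close : (Q S : ℝ) → Fin n → Fin n → Set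
    Close Q S a v = ∃[ e ] Q * e ≤ S × Near₂ e (p a) (p v)

    -- A sweep along the tour: `a` is the current anchor and `e` the length travelled since it. A
    -- new anchor is set when the next step would make `Q` times this length exceed `S`, so the
    -- stretch just finished pays `S` for it.
    anchors : ∀ {Q S} → 0# ≤ Q → 0# ≤ S → ∀ a x xs e → 0# ≤ e → Q * e ≤ S → Near₂ e (p a) (p x) →
      ∃[ as ] (∀ {v} → v ∈ x ∷ xs → ∃[ b ] b ∈ a ∷ as × Close Q S b v) ×
              (∀ {b} → b ∈ as → b ∈ x ∷ xs) ×
              fromℕ (length as) * S ≤ Q * (e + len (x ∷ xs))
    anchors {Q} {S} 0≤Q 0≤S a x [] e 0≤e Qe≤S near =
      [] , (λ { (here refl) → a , here refl , e , Qe≤S , near }) , (λ ()) ,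
      ≤-trans (≤-reflexive (zeroˡ S)) (*-nonNeg 0≤Q (+-nonNeg 0≤e ≤-refl))
    anchors {Q} {S} 0≤Q 0≤S a x (y ∷ xs) e 0≤e Qe≤S near@(nx , ny) with ≤-total (Q * (e + d x y)) S
    ... | inj₁ within
      with anchors 0≤Q 0≤S a y xs (e + d x y) (+-nonNeg 0≤e (0≤dist (p x) (p y))) within
             (near-trans nx (proj₁ (near-dist (p x) (p y))) , near-trans ny (proj₂ (near-dist (p x) (p y))))
    ... | as , cover , as⊆ , short =
      as , (λ { (here refl) → a , here refl , e , Qe≤S , near ; (there v∈) → cover v∈ }) ,
      there ∘ as⊆ , subst (λ z → fromℕ (length as) * S ≤ Q * z) (+-assoc e (d x y) _) short
    -- The next stop `y` becomes the anchor and the travelled length restarts at 0; `beyond` is the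
    -- payment of `S` by the stretch up to and including this step.
    anchors {Q} {S} 0≤Q 0≤S a x (y ∷ xs) e 0≤e Qe≤S near | inj₂ beyond
      with anchors 0≤Q 0≤S y y xs 0# ≤-refl (≤-trans (≤-reflexive (zeroʳ Q)) 0≤S)
             (near-refl ≤-refl , near-refl ≤-refl)
    ... | as , cover , as⊆ , short =
      y ∷ as , (λ { (here refl) → a , here refl , e , Qe≤S , near
                  ; (there v∈) → proj₁ (cover v∈) , there (proj₁ (proj₂ (cover v∈))) , proj₂ (proj₂ (cover v∈)) }) ,
      (λ { (here refl) → there (here refl) ; (there b∈) → there (as⊆ b∈) }) ,
      ≤-trans (≤-reflexive (fromℕ-suc-* (length as) S))
        (≤-trans (+-mono-≤ beyond short) (≤-reflexive
          (solve 4 (λ Q e l r → Q :* (e :+ l) :+ Q :* (con 0ℤ :+ r) := Q :* (e :+ (l :+ r))) refl Q e (d x y) _)))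

    module _ (G : Graph n) (tree : IsTree G) where
      open Graph G
      open IsTree tree
      open DecMembership (Fin._≟_ {n}) using (_∈?_)

      ℓ : Fin edges# → ℝ
      ℓ j = d (proj₁ (edge j)) (proj₂ (edge j))

      lengthOf : (Fin edges# → Bool) → ℝ
      lengthOf used = sum (λ j → if used j then ℓ j else 0#)

      record Tour : Set where
        field
          stops  : List (Fin n)
          used   : Fin edges# → Bool
          short  : len stops ≤ lengthOf used + lengthOf used
          within : ∀ {v} → v ∈ stops → v ∈ₛ vertices
          ends   : ∀ j → used j ≡ true → proj₁ (edge j) ∈ stops × proj₂ (edge j) ∈ stops
      open Tour

      ℓ-joins : ∀ {j u v} → Joins G j u v → ℓ j ≡ d u v
      ℓ-joins {j} (inj₁ eq) = cong₂ d (cong proj₁ eq) (cong proj₂ eq)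
      ℓ-joins {j} {u} {v} (inj₂ eq) = trans (cong₂ d (cong proj₁ eq) (cong proj₂ eq)) (dist-sym (p v) (p u))

      joined∈ : ∀ {j u v} {xs : List (Fin n)} → Joins G j u v → proj₁ (edge j) ∈ xs × proj₂ (edge j) ∈ xs → v ∈ xs
      joined∈ (inj₁ eq) (_ , e₂) = subst (_∈ _) (cong proj₂ eq) e₂
      joined∈ (inj₂ eq) (e₁ , _) = subst (_∈ _) (cong proj₁ eq) e₁

      ends-joined : ∀ {j u v} {P : Fin n → Set} → Joins G j u v → P u → P v → P (proj₁ (edge j)) × P (proj₂ (edge j))
      ends-joined {P = P} (inj₁ eq) Pu Pv = subst P (sym (cong proj₁ eq)) Pu , subst P (sym (cong proj₂ eq)) Pv
      ends-joined {P = P} (inj₂ eq) Pu Pv = subst P (sym (cong proj₁ eq)) Pv , subst P (sym (cong proj₂ eq)) Pu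

      joined∈vertices : ∀ {j u v} → Joins G j u v → v ∈ₛ vertices
      joined∈vertices {j} (inj₁ eq) = subst (_∈ₛ vertices) (cong proj₂ eq) (proj₂ (endpoints j))
      joined∈vertices {j} (inj₂ eq) = subst (_∈ₛ vertices) (cong proj₁ eq) (proj₁ (endpoints j))

      unused : ∀ (t : Tour) {j u v} → Joins G j u v → ¬ v ∈ stops t → used t j ≡ false
      unused t {j} joins v∉ with used t j in eq
      ... | true  = ⊥-elim (v∉ (joined∈ joins (ends t j eq)))
      ... | false = refl

      visit : (t : Tour) → ∀ {j u v} → Joins G j u v → u ∈ stops t → ¬ v ∈ stops t →
              Σ[ t′ ∈ Tour ] v ∈ stops t′ × (∀ {z} → z ∈ stops t → z ∈ stops t′)
      visit t {j} {u} {v} joins u∈ v∉ = record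
        { stops  = detour u∈ v
        ; used   = used′
        ; short  = ≤-trans (≤-reflexive (trans (len-detour u∈ v) (cong (λ z → len (stops t) + (z + z)) (sym (ℓ-joins joins)))))
                   (≤-trans (+-mono-≤ (short t) ≤-refl) (≤-reflexive (trans
                     (solve 2 (λ s l → s :+ s :+ (l :+ l) := l :+ s :+ (l :+ s)) refl (lengthOf (used t)) (ℓ j))
                     (cong₂ _+_ (sym longer) (sym longer)))))
        ; within = λ z∈ → within′ (∈-detour⁻ u∈ v z∈)
        ; ends   = λ i → ends′ i (i Fin.≟ j)
        } , target∈detour u∈ v , ∈-detour u∈ v
        where
        mark : ∀ {i} → Dec (i ≡ j) → Bool → Bool
        mark (yes _) _ = true
        mark (no _)  b = b

        used′ : Fin edges# → Bool
        used′ i = mark (i Fin.≟ j) (used t i)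

        longer : lengthOf used′ ≡ ℓ j + lengthOf (used t)
        longer = sum-update j at-j elsewhere
          where
          at-j : (if used′ j then ℓ j else 0#) ≡ ℓ j + (if used t j then ℓ j else 0#)
          at-j with j Fin.≟ j
          ... | yes _  = sym (trans (cong (λ b → ℓ j + (if b then ℓ j else 0#)) (unused t joins v∉)) (+-identityʳ _))
          ... | no j≢j = ⊥-elim (j≢j refl)
          elsewhere : ∀ i → i ≢ j → (if used′ i then ℓ i else 0#) ≡ (if used t i then ℓ i else 0#)
          elsewhere i i≢j with i Fin.≟ j
          ... | yes i≡j = ⊥-elim (i≢j i≡j)
          ... | no _    = refl

        within′ : ∀ {z} → z ∈ stops t ⊎ z ≡ v → z ∈ₛ vertices
        within′ (inj₁ z∈)   = within t z∈
        within′ (inj₂ refl) = joined∈vertices joins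

        ends′ : ∀ i (i≟j : Dec (i ≡ j)) → mark i≟j (used t i) ≡ true →
                proj₁ (edge i) ∈ detour u∈ v × proj₂ (edge i) ∈ detour u∈ v
        ends′ i (yes refl) _  = ends-joined {P = _∈ detour u∈ v} joins (∈-detour u∈ v u∈) (target∈detour u∈ v)
        ends′ i (no _)     eq with ends t i eq
        ... | e₁ , e₂ = ∈-detour u∈ v e₁ , ∈-detour u∈ v e₂

      -- Steps of the walk to visited vertices leave the tour as it is; the others insert a detour
      -- at the present vertex.
      follow : (t : Tour) → ∀ {u w} → Walk G u w → u ∈ stops t →
               Σ[ t′ ∈ Tour ] w ∈ stops t′ × (∀ {z} → z ∈ stops t → z ∈ stops t′)
      follow t []                 u∈ = t , u∈ , λ z∈ → z∈
      follow t (_∷⟨_⟩_ {v = v} j joins w) u∈ with v ∈? stops t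
      ... | yes v∈ = follow t w v∈
      ... | no v∉ with visit t joins u∈ v∉
      ... | t₁ , v∈ , grow with follow t₁ w v∈
      ... | t₂ , w∈ , grow′ = t₂ , w∈ , grow′ ∘ grow

      visit-all : ∀ r → r ∈ₛ vertices → (vs : List (Fin n)) →
        Σ[ t ∈ Tour ] r ∈ stops t × (∀ {v} → v ∈ vs → v ∈ₛ vertices → v ∈ stops t)
      visit-all r r∈ [] = record
        { stops = r ∷ [] ; used = λ _ → false
        ; short = +-nonNeg (0≤sum {edges#} (λ _ → ≤-refl)) (0≤sum {edges#} (λ _ → ≤-refl))
        ; within = λ { (here refl) → r∈ } ; ends = λ _ () } , here refl , λ ()
      visit-all r r∈ (v ∷ vs) with visit-all r r∈ vs | v ∈ₛ? vertices
      ... | t , r∈t , seen | no v∉ = t , r∈t , λ { (here refl) v∈ → ⊥-elim (v∉ v∈) ; (there z∈) → seen z∈ }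
      ... | t , r∈t , seen | yes v∈ with follow t (connected r∈ v∈) r∈t
      ... | t′ , v∈t′ , grow = t′ , grow r∈t ,
        λ { (here refl) _ → v∈t′ ; (there z∈) z∈V → grow (seen z∈ z∈V) }

      L = totalLength p G

      0≤L : 0# ≤ L
      0≤L = 0≤sum (λ j → 0≤dist (p (proj₁ (edge j))) (p (proj₂ (edge j))))

      lengthOf≤L : ∀ used → lengthOf used ≤ L
      lengthOf≤L used = sum-mono bound
        where
        bound : ∀ j → (if used j then ℓ j else 0#) ≤ ℓ j
        bound j with used j
        ... | true  = ≤-refl
        ... | false = 0≤dist (p (proj₁ (edge j))) (p (proj₂ (edge j)))

      closed-tour : ∃[ h ] ∃[ xs ] (∀ {v} → v ∈ₛ vertices → v ∈ h ∷ xs) ×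
                    (∀ {v} → v ∈ h ∷ xs → v ∈ₛ vertices) × len (h ∷ xs) ≤ L + L
      closed-tour with visit-all (proj₁ nonempty) (proj₂ nonempty) (allFin n)
      ... | t , r∈ , seen with stops t | short t | within t
      closed-tour | t , () , seen | [] | _ | _
      ... | h ∷ xs | short′ | within′ = h , xs , (λ {v} → seen (∈-allFin v)) , within′ ,
        ≤-trans short′ (+-mono-≤ (lengthOf≤L (used t)) (lengthOf≤L (used t)))

      -- What the analysis takes from the optimal tree. A tour of length at most `2L` bounds
      -- coordinate differences by `2L` and distances by `4L`, and `S` doubles this to `8L`. The
      -- lone `S` in `covering` pays for the initial anchor.
      record Skeleton : Set where
        field
          centre rim : Fin n
        D = d centre rim
        S = D + D
        field
          radius   : ∀ {v} → v ∈ₛ vertices → d centre v ≤ D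
          S≤8L     : S ≤ fromℕ 8 * L
          covering : ∀ Q → 0# ≤ Q → ∃[ as ]
            (∀ {v} → v ∈ₛ vertices → ∃[ b ] b ∈ as × Close Q S b v) ×
            (∀ {b} → b ∈ as → b ∈ₛ vertices) ×
            fromℕ (length as) * S ≤ S + Q * (L + L)

      skeleton : Skeleton
      skeleton with closed-tour
      ... | h , xs , seen , within , short with farthest h h xs
      ... | j , j∈ , far = record
        { centre = h ; rim = j
        ; radius = far ∘ seen
        ; S≤8L = ≤-trans (+-mono-≤ D≤ D≤) (≤-reflexive
            (solve 1 (λ L → let E = L :+ L in E :+ E :+ (E :+ E) := con (ℤ.+ 8) :* L) refl L))
        ; covering = covering }
        where
        D≤ : d h j ≤ L + L + (L + L)
        D≤ = ≤-trans (dist≤ (p h) (p j) (0≤len (h ∷ xs)) (near-len h xs j∈)) (+-mono-≤ short short)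

        S′ = d h j + d h j
        0≤S = +-nonNeg (0≤dist (p h) (p j)) (0≤dist (p h) (p j))

        covering : ∀ Q → 0# ≤ Q → ∃[ as ]
            (∀ {v} → v ∈ₛ vertices → ∃[ b ] b ∈ as × Close Q S′ b v) ×
            (∀ {b} → b ∈ as → b ∈ₛ vertices) ×
            fromℕ (length as) * S′ ≤ S′ + Q * (L + L)
        covering Q 0≤Q with anchors {Q} {S′} 0≤Q 0≤S h h xs 0# ≤-refl
                              (≤-trans (≤-reflexive (zeroʳ Q)) 0≤S) (near-refl ≤-refl , near-refl ≤-refl)
        ... | as , cover , as⊆ , few =
          h ∷ as , cover ∘ seen , (λ { (here refl) → within (here refl) ; (there b∈) → within (as⊆ b∈) }) ,
          ≤-trans (≤-reflexive (fromℕ-suc-* (length as) S′))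
            (+-monoʳ-≤ S′ (≤-trans few (*-monoˡ-≤ 0≤Q (≤-trans (≤-reflexive (+-identityˡ _)) short))))

-- A language of bounded loops and its compiler.

module LoopLanguage (R : RealNumbers) where
  open RealNumbers R
  open Plane R
  open Combinatorics using (iter; ⌊⌋-true; ⌊⌋-false; leᵇ; leᵇ-⌊⌋)

  infix 4 _∋_

  data Ty : Set where
    natᵗ realᵗ boolᵗ : Ty

  data _∋_ : List Ty → Ty → Set where
    here  : ∀ {Γ τ} → (τ ∷ Γ) ∋ τ
    there : ∀ {Γ σ τ} → Γ ∋ τ → (σ ∷ Γ) ∋ τ

  look : ∀ {P : Ty → Set} {Γ τ} → All P Γ → Γ ∋ τ → P τ
  look (p ∷ ps) here      = p
  look (p ∷ ps) (there x) = look ps x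

  -- All operations are strict, `ifᵒ` and `andᵒ` included: both branches are evaluated, so running
  -- time cannot depend on the data.
  data Op : List Ty → Ty → Set where
    litᵒ              : ℕ → Op [] natᵗ
    sizeᵒ goalᵒ       : Op [] natᵗ
    zeroᵒ             : Op [] realᵗ
    boolᵒ             : Bool → Op [] boolᵗ
    xᵒ yᵒ             : Op (natᵗ ∷ []) realᵗ
    plusᵒ minusᵒ      : Op (natᵗ ∷ natᵗ ∷ []) natᵗ
    plusʳ timesʳ      : Op (realᵗ ∷ realᵗ ∷ []) realᵗ
    negʳ sqrtʳ        : Op (realᵗ ∷ []) realᵗ
    leᵒ               : Op (natᵗ ∷ natᵗ ∷ []) boolᵗ
    leʳ               : Op (realᵗ ∷ realᵗ ∷ []) boolᵗ
    notᵒ              : Op (boolᵗ ∷ []) boolᵗ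
    andᵒ              : Op (boolᵗ ∷ boolᵗ ∷ []) boolᵗ
    ifᵒ               : ∀ {τ} → Op (boolᵗ ∷ τ ∷ τ ∷ []) τ

  -- `fold z b` iterates b once for every index below the number of points; in b, variable 0 is the
  -- accumulator and variable 1 the index.
  data Tm (Γ : List Ty) : Ty → Set
  data Tms (Γ : List Ty) : List Ty → Set

  data Tm Γ where
    var  : ∀ {τ} → Γ ∋ τ → Tm Γ τ
    op   : ∀ {Δ τ} → Op Δ τ → Tms Γ Δ → Tm Γ τ
    call : ∀ {Δ τ} → Tm Δ τ → Tms Γ Δ → Tm Γ τ
    fold : ∀ {τ} → Tm Γ τ → Tm (τ ∷ natᵗ ∷ Γ) τ → Tm Γ τ

  infixr 5 _∷_

  data Tms Γ where
    []  : Tms Γ []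
    _∷_ : ∀ {τ Δ} → Tm Γ τ → Tms Γ Δ → Tms Γ (τ ∷ Δ)

  Val : Ty → Set
  Val natᵗ  = ℕ
  Val realᵗ = ℝ
  Val boolᵗ = Bool

  Env : List Ty → Set
  Env = All Val

  module Semantics (n k : ℕ) (X Y : ℕ → ℝ) where

    ⟦_⟧ᵒ : ∀ {Δ τ} → Op Δ τ → Env Δ → Val τ
    ⟦ litᵒ m ⟧ᵒ []              = m
    ⟦ sizeᵒ ⟧ᵒ  []              = n
    ⟦ goalᵒ ⟧ᵒ  []              = k
    ⟦ zeroᵒ ⟧ᵒ  []              = 0#
    ⟦ boolᵒ b ⟧ᵒ []             = b
    ⟦ xᵒ ⟧ᵒ     (i ∷ [])        = X i
    ⟦ yᵒ ⟧ᵒ     (i ∷ [])        = Y i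
    ⟦ plusᵒ ⟧ᵒ  (i ∷ j ∷ [])    = i ℕ.+ j
    ⟦ minusᵒ ⟧ᵒ (i ∷ j ∷ [])    = i ℕ.∸ j
    ⟦ plusʳ ⟧ᵒ  (x ∷ y ∷ [])    = x + y
    ⟦ timesʳ ⟧ᵒ (x ∷ y ∷ [])    = x * y
    ⟦ negʳ ⟧ᵒ   (x ∷ [])        = - x
    ⟦ sqrtʳ ⟧ᵒ  (x ∷ [])        = √ x
    ⟦ leᵒ ⟧ᵒ    (i ∷ j ∷ [])    = leᵇ i j
    ⟦ leʳ ⟧ᵒ    (x ∷ y ∷ [])    = ⌊ x ≤? y ⌋
    ⟦ notᵒ ⟧ᵒ   (a ∷ [])        = not a
    ⟦ andᵒ ⟧ᵒ   (a ∷ b ∷ [])    = a ∧ b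
    ⟦ ifᵒ ⟧ᵒ    (a ∷ v ∷ w ∷ []) = if a then v else w

    ⟦_⟧  : ∀ {Γ τ} → Tm Γ τ → Env Γ → Val τ
    ⟦_⟧ˢ : ∀ {Γ Δ} → Tms Γ Δ → Env Γ → Env Δ
    ⟦ var x ⟧     ρ = look ρ x
    ⟦ op o ts ⟧   ρ = ⟦ o ⟧ᵒ (⟦ ts ⟧ˢ ρ)
    ⟦ call t ts ⟧ ρ = ⟦ t ⟧ (⟦ ts ⟧ˢ ρ)
    ⟦ fold z b ⟧  ρ = iter (λ i a → ⟦ b ⟧ (a ∷ i ∷ ρ)) (⟦ z ⟧ ρ) n
    ⟦ [] ⟧ˢ       ρ = []
    ⟦ t ∷ ts ⟧ˢ   ρ = ⟦ t ⟧ ρ ∷ ⟦ ts ⟧ˢ ρ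

  -- Values live on a stack: level ℓ is cell ℓ of natural array 5 or of real array 2.  A term compiled
  -- at level ℓ leaves its value there and leaves all lower levels intact.
  Slots : List Ty → Set
  Slots = All (λ _ → ℕ)

  consecutive : ℕ → (Δ : List Ty) → Slots Δ
  consecutive ℓ []      = []
  consecutive ℓ (_ ∷ Δ) = ℓ ∷ consecutive (suc ℓ) Δ

  slotᴺ : ℕ → NatExp
  slotᴺ j = 5 [ lit j ]ᴺ

  slotᴿ : ℕ → RealExp
  slotᴿ j = 2 [ lit j ]ᴿ

  setᴺ : ℕ → NatExp → Program
  setᴺ ℓ e = 5 [ lit ℓ ]ᴺ≔ e

  setᴿ : ℕ → RealExp → Program
  setᴿ ℓ e = 2 [ lit ℓ ]ᴿ≔ e

  copy : Ty → ℕ → ℕ → Program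
  copy natᵗ  ℓ j = setᴺ ℓ (slotᴺ j)
  copy realᵗ ℓ j = setᴿ ℓ (slotᴿ j)
  copy boolᵗ ℓ j = setᴺ ℓ (slotᴺ j)

  bit : Bool → ℕ
  bit true  = 1
  bit false = 0

  compileOp : ∀ {Δ τ} → Op Δ τ → ℕ → Program
  compileOp (litᵒ m)    ℓ = setᴺ ℓ (lit m)
  compileOp sizeᵒ       ℓ = setᴺ ℓ (0 [ lit 0 ]ᴺ)
  compileOp goalᵒ       ℓ = setᴺ ℓ (0 [ lit 1 ]ᴺ)
  compileOp zeroᵒ       ℓ = setᴿ ℓ 0ᴿ
  compileOp (boolᵒ b)   ℓ = setᴺ ℓ (lit (bit b))
  compileOp xᵒ          ℓ = setᴿ ℓ (0 [ slotᴺ ℓ ]ᴿ)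
  compileOp yᵒ          ℓ = setᴿ ℓ (1 [ slotᴺ ℓ ]ᴿ)
  compileOp plusᵒ       ℓ = setᴺ ℓ (slotᴺ ℓ ⊕ slotᴺ (suc ℓ))
  compileOp minusᵒ      ℓ = setᴺ ℓ (slotᴺ ℓ ⊖ slotᴺ (suc ℓ))
  compileOp plusʳ       ℓ = setᴿ ℓ (slotᴿ ℓ +ᴿ slotᴿ (suc ℓ))
  compileOp timesʳ      ℓ = setᴿ ℓ (slotᴿ ℓ *ᴿ slotᴿ (suc ℓ))
  compileOp negʳ        ℓ = setᴿ ℓ (-ᴿ slotᴿ ℓ)
  compileOp sqrtʳ       ℓ = setᴿ ℓ (√ᴿ (slotᴿ ℓ))
  compileOp leᵒ         ℓ = ifᴾ (slotᴺ ℓ ≤ᴺ slotᴺ (suc ℓ)) (setᴺ ℓ (lit 1)) (setᴺ ℓ (lit 0))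
  compileOp leʳ         ℓ = ifᴾ (slotᴿ ℓ ≤ᴿ slotᴿ (suc ℓ)) (setᴺ ℓ (lit 1)) (setᴺ ℓ (lit 0))
  compileOp notᵒ        ℓ = setᴺ ℓ (lit 1 ⊖ slotᴺ ℓ)
  compileOp andᵒ        ℓ = ifᴾ (lit 1 ≤ᴺ slotᴺ ℓ) (copy boolᵗ ℓ (suc ℓ)) (setᴺ ℓ (lit 0))
  compileOp (ifᵒ {τ})   ℓ = ifᴾ (lit 1 ≤ᴺ slotᴺ ℓ) (copy τ ℓ (suc ℓ)) (copy τ ℓ (suc (suc ℓ)))

  -- Cell 0 of natural array 0 holds the number of points; adding 1 in the test expresses a strict
  -- inequality.
  loop : ℕ → Program → Program
  loop j body = setᴺ j (lit 0) ⨾ while (slotᴺ j ⊕ lit 1 ≤ᴺ 0 [ lit 0 ]ᴺ) (body ⨾ setᴺ j (slotᴺ j ⊕ lit 1))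

  -- The body of a `call` sees its arguments only, which lie consecutively on the stack; it works
  -- above them and its result is copied down. In a `fold`, level `ℓ` holds the accumulator and the
  -- next level the counter.
  compile  : ∀ {Γ τ} → Tm Γ τ → ℕ → Slots Γ → Program
  compileˢ : ∀ {Γ Δ} → Tms Γ Δ → ℕ → Slots Γ → Program
  compile {τ = τ} (var x)    ℓ σ = copy τ ℓ (look σ x)
  compile (op o ts)          ℓ σ = compileˢ ts ℓ σ ⨾ compileOp o ℓ
  compile {τ = τ} (call {Δ} t ts) ℓ σ =
    compileˢ ts ℓ σ ⨾ compile t (length Δ ℕ.+ ℓ) (consecutive ℓ Δ) ⨾ copy τ ℓ (length Δ ℕ.+ ℓ)
  compile {τ = τ} (fold z b) ℓ σ =
    compile z ℓ σ ⨾
    loop (suc ℓ) (compile b (2 ℕ.+ ℓ) (ℓ ∷ suc ℓ ∷ σ) ⨾ copy τ ℓ (2 ℕ.+ ℓ))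
  compileˢ []       ℓ σ = skip
  compileˢ (t ∷ ts) ℓ σ = compile t ℓ σ ⨾ compileˢ ts (suc ℓ) σ

  opTime : ∀ {Δ τ} → Op Δ τ → ℕ
  opTime leᵒ  = 2
  opTime leʳ  = 2
  opTime andᵒ = 2
  opTime ifᵒ  = 2
  opTime _    = 1

  -- One step initialises the counter, each round takes a test, the body and an increment, and the
  -- last step is the failing test.
  loopTime : ℕ → ℕ → ℕ
  loopTime b m = 1 ℕ.+ (m ℕ.* suc (b ℕ.+ 1) ℕ.+ 1)

  time  : ∀ {Γ τ} → Tm Γ τ → ℕ → ℕ
  timeˢ : ∀ {Γ Δ} → Tms Γ Δ → ℕ → ℕ
  time (var x)     n = 1
  time (op o ts)   n = timeˢ ts n ℕ.+ opTime o
  time (call t ts) n = timeˢ ts n ℕ.+ (time t n ℕ.+ 1)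
  time (fold z b)  n = time z n ℕ.+ loopTime (time b n ℕ.+ 1) n
  timeˢ []         n = 1
  timeˢ (t ∷ ts)   n = time t n ℕ.+ timeˢ ts n

  -- For `n ≥ 1` powers of `n` grow with the exponent, so that two bounds can be brought to a common
  -- degree in `poly-+`.
  PolyBounded : (ℕ → ℕ) → Set
  PolyBounded f = ∃[ c ] ∃[ d ] (∀ n → 1 ℕ.≤ n → f n ℕ.≤ c ℕ.* n ℕ.^ d)

  poly-const : ∀ m → PolyBounded (λ _ → m)
  poly-const m = m , 0 , λ n _ → ℕ.≤-reflexive (sym (ℕ.*-identityʳ m))

  poly-+ : ∀ {f g} → PolyBounded f → PolyBounded g → PolyBounded (λ n → f n ℕ.+ g n)
  poly-+ {f} {g} (c , d , F) (c′ , d′ , G) = c ℕ.+ c′ , d ℕ.+ d′ , H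
    where
    H : ∀ n → 1 ℕ.≤ n → f n ℕ.+ g n ℕ.≤ (c ℕ.+ c′) ℕ.* n ℕ.^ (d ℕ.+ d′)
    H n@(suc _) 1≤n = begin
      f n ℕ.+ g n
        ≤⟨ ℕ.+-mono-≤ (F n 1≤n) (G n 1≤n) ⟩
      c ℕ.* n ℕ.^ d ℕ.+ c′ ℕ.* n ℕ.^ d′
        ≤⟨ ℕ.+-mono-≤ (ℕ.*-monoʳ-≤ c (ℕ.^-monoʳ-≤ n (ℕ.m≤m+n d d′)))
                      (ℕ.*-monoʳ-≤ c′ (ℕ.^-monoʳ-≤ n (ℕ.m≤n+m d′ d))) ⟩
      c ℕ.* n ℕ.^ (d ℕ.+ d′) ℕ.+ c′ ℕ.* n ℕ.^ (d ℕ.+ d′)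
        ≡⟨ ℕ.*-distribʳ-+ (n ℕ.^ (d ℕ.+ d′)) c c′ ⟨
      (c ℕ.+ c′) ℕ.* n ℕ.^ (d ℕ.+ d′) ∎
      where open ℕ.≤-Reasoning

  poly-n* : ∀ {f} → PolyBounded f → PolyBounded (λ n → n ℕ.* f n)
  poly-n* {f} (c , d , F) = c , suc d , λ n 1≤n →
    ℕ.≤-trans (ℕ.*-monoʳ-≤ n (F n 1≤n)) (ℕ.≤-reflexive (swap n c (n ℕ.^ d)))
    where
    swap : ∀ n c x → n ℕ.* (c ℕ.* x) ≡ c ℕ.* (n ℕ.* x)
    swap = solve-∀

  poly-loop : ∀ {f} → PolyBounded f → PolyBounded (λ n → loopTime (f n) n)
  poly-loop F = poly-+ (poly-const 1) (poly-+ (poly-n* (poly-+ (poly-const 1) (poly-+ F (poly-const 1)))) (poly-const 1))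

  poly-time  : ∀ {Γ τ} (t : Tm Γ τ) → PolyBounded (time t)
  poly-timeˢ : ∀ {Γ Δ} (ts : Tms Γ Δ) → PolyBounded (timeˢ ts)
  poly-time (var x)     = poly-const 1
  poly-time (op o ts)   = poly-+ (poly-timeˢ ts) (poly-const (opTime o))
  poly-time (call t ts) = poly-+ (poly-timeˢ ts) (poly-+ (poly-time t) (poly-const 1))
  poly-time (fold z b)  = poly-+ (poly-time z) (poly-loop (poly-+ (poly-time b) (poly-const 1)))
  poly-timeˢ []         = poly-const 1
  poly-timeˢ (t ∷ ts)   = poly-+ (poly-time t) (poly-timeˢ ts)

  At : State → (τ : Ty) → ℕ → Val τ → Set
  At s natᵗ  j v = nat s 5 j ≡ v
  At s realᵗ j v = real s 2 j ≡ v
  At s boolᵗ j v = nat s 5 j ≡ bit v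

  record Frame (ℓ : ℕ) (s s′ : State) : Set where
    field
      natᶠ  : ∀ a j → a ≢ 5 ⊎ j ℕ.< ℓ → nat s′ a j ≡ nat s a j
      realᶠ : ∀ a j → a ≢ 2 ⊎ j ℕ.< ℓ → real s′ a j ≡ real s a j
  open Frame

  weaken-bound : ∀ {A : Set} {j ℓ ℓ′} → ℓ ℕ.≤ ℓ′ → A ⊎ j ℕ.< ℓ → A ⊎ j ℕ.< ℓ′
  weaken-bound ℓ≤ℓ′ (inj₁ a)   = inj₁ a
  weaken-bound ℓ≤ℓ′ (inj₂ j<ℓ) = inj₂ (ℕ.≤-trans j<ℓ ℓ≤ℓ′)

  frame-refl : ∀ {ℓ s} → Frame ℓ s s
  frame-refl = record { natᶠ = λ _ _ _ → refl ; realᶠ = λ _ _ _ → refl }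

  frame-trans : ∀ {ℓ ℓ′ s s′ s″} → ℓ ℕ.≤ ℓ′ → Frame ℓ s s′ → Frame ℓ′ s′ s″ → Frame ℓ s s″
  frame-trans ℓ≤ F G = record
    { natᶠ  = λ a j h → trans (natᶠ G a j (weaken-bound ℓ≤ h)) (natᶠ F a j h)
    ; realᶠ = λ a j h → trans (realᶠ G a j (weaken-bound ℓ≤ h)) (realᶠ F a j h) }

  frame-at : ∀ {ℓ s s′ j} τ {v : Val τ} → Frame ℓ s s′ → j ℕ.< ℓ → At s τ j v → At s′ τ j v
  frame-at natᵗ  F j<ℓ h = trans (natᶠ F _ _ (inj₂ j<ℓ)) h
  frame-at realᵗ F j<ℓ h = trans (realᶠ F _ _ (inj₂ j<ℓ)) h
  frame-at boolᵗ F j<ℓ h = trans (natᶠ F _ _ (inj₂ j<ℓ)) h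

  write-same : ∀ {A : Set} (m : ℕ → ℕ → A) a i x → write m a i x a i ≡ x
  write-same m a i x = cong₂ (λ b c → if b ∧ c then x else m a i)
    (⌊⌋-true (a ℕ.≟ a) refl) (⌊⌋-true (i ℕ.≟ i) refl)

  write-array : ∀ {A : Set} (m : ℕ → ℕ → A) {a b} i x j → a ≢ b → write m a i x b j ≡ m b j
  write-array m {a} {b} i x j a≢b =
    cong (λ c → if c ∧ ⌊ i ℕ.≟ j ⌋ then x else m b j) (⌊⌋-false (a ℕ.≟ b) a≢b)

  write-cell : ∀ {A : Set} (m : ℕ → ℕ → A) a {i} x b {j} → i ≢ j → write m a i x b j ≡ m b j
  write-cell m a {i} x b {j} i≢j with ⌊ a ℕ.≟ b ⌋
  ... | false = refl
  ... | true  = cong (λ c → if c then x else m b j) (⌊⌋-false (i ℕ.≟ j) i≢j)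

  write-frame : ∀ {A : Set} (m : ℕ → ℕ → A) {c ℓ x} a j → a ≢ c ⊎ j ℕ.< ℓ → write m c ℓ x a j ≡ m a j
  write-frame m {ℓ = ℓ} {x} a j (inj₁ a≢c) = write-array m ℓ x j (λ c≡a → a≢c (sym c≡a))
  write-frame m {c} {ℓ} {x} a j (inj₂ j<ℓ) = write-cell m c x a (λ ℓ≡j → ℕ.<⇒≢ j<ℓ (sym ℓ≡j))

  Computes : Program → State → ℕ → (τ : Ty) → ℕ → Val τ → Set
  Computes P s t τ ℓ v = Σ[ s′ ∈ State ] (P , s ⇓[ t ] s′) × At s′ τ ℓ v × Frame ℓ s s′

  setᴺ-computes : ∀ {s ℓ e v} → ⟦ e ⟧ᴺ s ≡ v → Computes (setᴺ ℓ e) s 1 natᵗ ℓ v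
  setᴺ-computes {s} {ℓ} eq = _ , assignᴺ , trans (write-same (nat s) 5 ℓ _) eq ,
    record { natᶠ = write-frame (nat s) ; realᶠ = λ _ _ _ → refl }

  setᴮ-computes : ∀ {s ℓ e v} → ⟦ e ⟧ᴺ s ≡ bit v → Computes (setᴺ ℓ e) s 1 boolᵗ ℓ v
  setᴮ-computes {s} {ℓ} eq = _ , assignᴺ , trans (write-same (nat s) 5 ℓ _) eq ,
    record { natᶠ = write-frame (nat s) ; realᶠ = λ _ _ _ → refl }

  setᴿ-computes : ∀ {s ℓ e v} → ⟦ e ⟧ᴿ s ≡ v → Computes (setᴿ ℓ e) s 1 realᵗ ℓ v
  setᴿ-computes {s} {ℓ} eq = _ , assignᴿ , trans (write-same (real s) 2 ℓ _) eq ,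
    record { natᶠ = λ _ _ _ → refl ; realᶠ = write-frame (real s) }

  copy-computes : ∀ {s ℓ j} τ {v : Val τ} → At s τ j v → Computes (copy τ ℓ j) s 1 τ ℓ v
  copy-computes natᵗ  h = setᴺ-computes h
  copy-computes realᵗ h = setᴿ-computes h
  copy-computes boolᵗ {v} h = setᴮ-computes {v = v} h

  if-computes : ∀ {b P Q s t τ ℓ} {v : Val τ} c → ⟦ b ⟧ᵀ s ≡ c →
                (c ≡ true → Computes P s t τ ℓ v) → (c ≡ false → Computes Q s t τ ℓ v) →
                Computes (ifᴾ b P Q) s (suc t) τ ℓ v
  if-computes true  eq p q with p refl
  ... | s′ , run , h , F = s′ , if-true eq run , h , F
  if-computes false eq p q with q refl
  ... | s′ , run , h , F = s′ , if-false eq run , h , F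

  1≤bit : ∀ b → ⌊ 1 ℕ.≤? bit b ⌋ ≡ b
  1≤bit true  = refl
  1≤bit false = refl

  1∸bit : ∀ b → 1 ℕ.∸ bit b ≡ bit (not b)
  1∸bit true  = refl
  1∸bit false = refl

  Holds : ∀ {Γ} → State → Slots Γ → Env Γ → Set
  Holds {Γ} s σ ρ = ∀ {τ} (x : Γ ∋ τ) → At s τ (look σ x) (look ρ x)

  Below : ∀ {Γ} → Slots Γ → ℕ → Set
  Below {Γ} σ ℓ = ∀ {τ} (x : Γ ∋ τ) → look σ x ℕ.< ℓ

  frame-holds : ∀ {Γ ℓ s s′} (σ : Slots Γ) ρ → Frame ℓ s s′ → Below σ ℓ → Holds s σ ρ → Holds s′ σ ρ
  frame-holds σ ρ F b h {τ} x = frame-at τ F (b x) (h x)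

  consecutive-below : ∀ ℓ Δ → Below (consecutive ℓ Δ) (length Δ ℕ.+ ℓ)
  consecutive-below ℓ (_ ∷ Δ) here      = s≤s (ℕ.m≤n+m ℓ (length Δ))
  consecutive-below ℓ (_ ∷ Δ) (there x) =
    subst (look (consecutive (suc ℓ) Δ) x ℕ.<_) (ℕ.+-suc (length Δ) ℓ) (consecutive-below (suc ℓ) Δ x)

  emit : ℕ → Tm (natᵗ ∷ []) natᵗ → Program
  emit a e = loop 0 (compile e 1 (0 ∷ []) ⨾ a [ slotᴺ 0 ]ᴺ≔ slotᴺ 1)

  emitTime : Tm (natᵗ ∷ []) natᵗ → ℕ → ℕ
  emitTime e m = loopTime (time e m ℕ.+ 1) m

  writeTree : (flag end₁ end₂ : Tm (natᵗ ∷ []) natᵗ) → Program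
  writeTree flag end₁ end₂ =
    -- All arrays are filled for `n` indices, but the edge count `k - 1` makes only the first
    -- `k - 1` entries of arrays 3 and 4 meaningful.
    emit 1 flag ⨾ emit 3 end₁ ⨾ emit 4 end₂ ⨾ 2 [ lit 0 ]ᴺ≔ 0 [ lit 1 ]ᴺ ⊖ lit 1

  writeTreeTime : (flag end₁ end₂ : Tm (natᵗ ∷ []) natᵗ) → ℕ → ℕ
  writeTreeTime flag end₁ end₂ m =
    emitTime flag m ℕ.+ (emitTime end₁ m ℕ.+ (emitTime end₂ m ℕ.+ 1))

  poly-writeTree : ∀ flag end₁ end₂ → PolyBounded (writeTreeTime flag end₁ end₂)
  poly-writeTree flag end₁ end₂ = poly-+ (poly-emit flag) (poly-+ (poly-emit end₁) (poly-+ (poly-emit end₂) (poly-const 1)))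
    where
    poly-emit : ∀ e → PolyBounded (emitTime e)
    poly-emit e = poly-loop (poly-+ (poly-time e) (poly-const 1))

  module Correctness (n k : ℕ) (X Y : ℕ → ℝ) where
    open Semantics n k X Y

    record InputOK (s : State) : Set where
      field
        n-ok : nat s 0 0 ≡ n
        k-ok : nat s 0 1 ≡ k
        X-ok : ∀ j → real s 0 j ≡ X j
        Y-ok : ∀ j → real s 1 j ≡ Y j
    open InputOK

    frame-input : ∀ {ℓ s s′} → Frame ℓ s s′ → InputOK s → InputOK s′
    frame-input F I = record
      { n-ok = trans (natᶠ F 0 0 (inj₁ λ ())) (n-ok I)
      ; k-ok = trans (natᶠ F 0 1 (inj₁ λ ())) (k-ok I)
      ; X-ok = λ j → trans (realᶠ F 0 j (inj₁ λ ())) (X-ok I j)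
      ; Y-ok = λ j → trans (realᶠ F 1 j (inj₁ λ ())) (Y-ok I j) }

    op-computes : ∀ {Δ τ} (o : Op Δ τ) {s ℓ} (ρ : Env Δ) → InputOK s →
                  Holds s (consecutive ℓ Δ) ρ → Computes (compileOp o ℓ) s (opTime o) τ ℓ (⟦ o ⟧ᵒ ρ)
    op-computes (litᵒ m) [] I h = setᴺ-computes refl
    op-computes sizeᵒ    [] I h = setᴺ-computes (n-ok I)
    op-computes goalᵒ    [] I h = setᴺ-computes (k-ok I)
    op-computes zeroᵒ    [] I h = setᴿ-computes refl
    op-computes (boolᵒ b) [] I h = setᴮ-computes {v = b} refl
    op-computes xᵒ {s} (i ∷ []) I h = setᴿ-computes (trans (cong (real s 0) (h here)) (X-ok I i))
    op-computes yᵒ {s} (i ∷ []) I h = setᴿ-computes (trans (cong (real s 1) (h here)) (Y-ok I i))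
    op-computes plusᵒ  (i ∷ j ∷ []) I h = setᴺ-computes (cong₂ ℕ._+_ (h here) (h (there here)))
    op-computes minusᵒ (i ∷ j ∷ []) I h = setᴺ-computes (cong₂ ℕ._∸_ (h here) (h (there here)))
    op-computes plusʳ  (x ∷ y ∷ []) I h = setᴿ-computes (cong₂ _+_ (h here) (h (there here)))
    op-computes timesʳ (x ∷ y ∷ []) I h = setᴿ-computes (cong₂ _*_ (h here) (h (there here)))
    op-computes negʳ   (x ∷ []) I h = setᴿ-computes (cong -_ (h here))
    op-computes sqrtʳ  (x ∷ []) I h = setᴿ-computes (cong √ (h here))
    op-computes leᵒ    (i ∷ j ∷ []) I h = if-computes {τ = boolᵗ} {v = leᵇ i j} _
      (trans (cong₂ (λ a b → ⌊ a ℕ.≤? b ⌋) (h here) (h (there here))) (leᵇ-⌊⌋ i j))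
      (λ c → setᴮ-computes (cong bit (sym c))) (λ c → setᴮ-computes (cong bit (sym c)))
    op-computes leʳ    (x ∷ y ∷ []) I h = if-computes {τ = boolᵗ} {v = ⌊ x ≤? y ⌋} _
      (cong₂ (λ a b → ⌊ a ≤? b ⌋) (h here) (h (there here)))
      (λ c → setᴮ-computes (cong bit (sym c))) (λ c → setᴮ-computes (cong bit (sym c)))
    op-computes notᵒ   (a ∷ []) I h = setᴮ-computes (trans (cong (1 ℕ.∸_) (h here)) (1∸bit a))
    op-computes andᵒ   (a ∷ b ∷ []) I h = if-computes {τ = boolᵗ} {v = a ∧ b} a
      (trans (cong (λ z → ⌊ 1 ℕ.≤? z ⌋) (h here)) (1≤bit a))
      (λ { refl → setᴮ-computes (h (there here)) }) (λ { refl → setᴮ-computes refl })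
    op-computes (ifᵒ {τ}) (a ∷ v ∷ w ∷ []) I h =
      if-computes a (trans (cong (λ z → ⌊ 1 ℕ.≤? z ⌋) (h here)) (1≤bit a))
        (λ { refl → copy-computes τ (h (there here)) }) (λ { refl → copy-computes τ (h (there (there here))) })

    -- The induction is on the number `m` of rounds still to run. `Inv` has to expose the counter
    -- and `n`, the two cells that the test reads.
    while-computes : ∀ {j body t} (Inv : ℕ → State → Set) →
      (∀ {i s} → Inv i s → nat s 5 j ≡ i × nat s 0 0 ≡ n) →
      (∀ {i s} → i ℕ.< n → Inv i s → Σ[ s′ ∈ State ] (body , s ⇓[ t ] s′) × Inv (suc i) s′) →
      ∀ m {i s} → m ℕ.+ i ≡ n → Inv i s →
      Σ[ s′ ∈ State ] (while (slotᴺ j ⊕ lit 1 ≤ᴺ 0 [ lit 0 ]ᴺ) body , s ⇓[ m ℕ.* suc t ℕ.+ 1 ] s′) × Inv n s′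
    while-computes Inv cells step zero {i} {s} refl inv =
      s , while-false (trans (cong₂ (λ a b → ⌊ a ℕ.+ 1 ℕ.≤? b ⌋) (proj₁ (cells inv)) (proj₂ (cells inv)))
                             (⌊⌋-false (i ℕ.+ 1 ℕ.≤? i) (ℕ.m+1+n≰m i))) , inv
    while-computes {j} {body} {t} Inv cells step (suc m) {i} {s} eq inv
      with step (subst (suc i ℕ.≤_) eq (s≤s (ℕ.m≤n+m i m))) inv
    ... | s₁ , run₁ , inv₁ with while-computes Inv cells step m (trans (ℕ.+-suc m i) eq) inv₁
    ... | s₂ , run₂ , inv₂ = s₂ ,
      subst (while (slotᴺ j ⊕ lit 1 ≤ᴺ 0 [ lit 0 ]ᴺ) body , s ⇓[_] s₂) (sym (cong suc (ℕ.+-assoc t _ 1)))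
      (while-true (trans (cong₂ (λ a b → ⌊ a ℕ.+ 1 ℕ.≤? b ⌋) (proj₁ (cells inv)) (proj₂ (cells inv)))
         (⌊⌋-true (i ℕ.+ 1 ℕ.≤? n) (subst₂ ℕ._≤_ (ℕ.+-comm 1 i) eq (s≤s (ℕ.m≤n+m i m))))) run₁ run₂) , inv₂

    compile-computes : ∀ {Γ τ} (t : Tm Γ τ) {s ℓ σ ρ} → InputOK s → Below σ ℓ → Holds s σ ρ →
                       Computes (compile t ℓ σ) s (time t n) τ ℓ (⟦ t ⟧ ρ)
    compileˢ-computes : ∀ {Γ Δ} (ts : Tms Γ Δ) {s ℓ σ ρ} → InputOK s → Below σ ℓ → Holds s σ ρ →
                        Σ[ s′ ∈ State ] (compileˢ ts ℓ σ , s ⇓[ timeˢ ts n ] s′) ×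
                        Holds s′ (consecutive ℓ Δ) (⟦ ts ⟧ˢ ρ) × Frame ℓ s s′
    compile-computes {τ = τ} (var x) I b h = copy-computes τ (h x)
    compile-computes (op o ts) I b h with compileˢ-computes ts I b h
    ... | s₁ , run₁ , h₁ , F₁ with op-computes o _ (frame-input F₁ I) h₁
    ... | s₂ , run₂ , h₂ , F₂ = s₂ , seq run₁ run₂ , h₂ , frame-trans ℕ.≤-refl F₁ F₂
    compile-computes {τ = τ} (call {Δ} t ts) {ℓ = ℓ} I b h with compileˢ-computes ts I b h
    ... | s₁ , run₁ , h₁ , F₁
      with compile-computes t (frame-input F₁ I) (consecutive-below ℓ Δ) h₁
    ... | s₂ , run₂ , h₂ , F₂ with copy-computes {ℓ = ℓ} τ h₂
    ... | s₃ , run₃ , h₃ , F₃ =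
      s₃ , seq run₁ (seq run₂ run₃) , h₃ ,
      frame-trans ℕ.≤-refl (frame-trans (ℕ.m≤n+m ℓ (length Δ)) F₁ F₂) F₃
    compile-computes {Γ} {τ} (fold z b) {s} {ℓ} {σ} {ρ} I below h with compile-computes z I below h
    ... | s₁ , run₁ , h₁ , F₁ with setᴺ-computes {s₁} {suc ℓ} {lit 0} refl
    ... | s₂ , run₂ , h₂ , F₂ = finish
      where
      value : ℕ → Val τ
      value = iter (λ i a → ⟦ b ⟧ (a ∷ i ∷ ρ)) (⟦ z ⟧ ρ)

      -- The frame refers to the state before the fold, so environment and input are available again
      -- in every round.
      Inv : ℕ → State → Set
      Inv i s′ = At s′ τ ℓ (value i) × nat s′ 5 (suc ℓ) ≡ i × Frame ℓ s s′

      step : ∀ {i s′} → i ℕ.< n → Inv i s′ →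
             Σ[ s″ ∈ State ]
               ((compile b (2 ℕ.+ ℓ) (ℓ ∷ suc ℓ ∷ σ) ⨾ copy τ ℓ (2 ℕ.+ ℓ)) ⨾ setᴺ (suc ℓ) (slotᴺ (suc ℓ) ⊕ lit 1) , s′
                ⇓[ (time b n ℕ.+ 1) ℕ.+ 1 ] s″) × Inv (suc i) s″
      step {i} {s′} _ (acc , counter , F)
        with compile-computes b {s′} {2 ℕ.+ ℓ} {ℓ ∷ suc ℓ ∷ σ} {value i ∷ i ∷ ρ} (frame-input F I)
               (λ { here → s≤s (ℕ.n≤1+n ℓ) ; (there here) → ℕ.≤-refl
                  ; (there (there x)) → ℕ.≤-trans (below x) (ℕ.m≤n+m ℓ 2) })
               (λ { here → acc ; (there here) → counter
                  ; (there (there x)) → frame-holds σ ρ F below h x })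
      ... | t₁ , r₁ , a₁ , G₁ with copy-computes {t₁} {ℓ} τ a₁
      ... | t₂ , r₂ , a₂ , G₂ with setᴺ-computes {t₂} {suc ℓ} {slotᴺ (suc ℓ) ⊕ lit 1} refl
      ... | t₃ , r₃ , a₃ , G₃ =
        t₃ , seq (seq r₁ r₂) r₃ , frame-at τ G₃ ℕ.≤-refl a₂ ,
        trans a₃ (trans (ℕ.+-comm _ 1) (cong suc (trans (copy-counter τ r₂)
          (trans (natᶠ G₁ 5 (suc ℓ) (inj₂ ℕ.≤-refl)) counter)))) ,
        frame-trans (ℕ.n≤1+n ℓ) (frame-trans ℕ.≤-refl (frame-trans (ℕ.m≤n+m ℓ 2) F G₁) G₂) G₃
        where
        -- The frame of a copy to level `ℓ` protects lower levels only; that the counter one level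
        -- higher survives is read off from the assignment itself.
        copy-counter : ∀ τ {t₁ t₂} → copy τ ℓ (2 ℕ.+ ℓ) , t₁ ⇓[ 1 ] t₂ → nat t₂ 5 (suc ℓ) ≡ nat t₁ 5 (suc ℓ)
        copy-counter natᵗ  {t₁} assignᴺ = write-cell (nat t₁) 5 _ 5 (ℕ.<⇒≢ ℕ.≤-refl)
        copy-counter realᵗ assignᴿ = refl
        copy-counter boolᵗ {t₁} assignᴺ = write-cell (nat t₁) 5 _ 5 (ℕ.<⇒≢ ℕ.≤-refl)

      finish : Computes _ s _ τ ℓ (value n)
      finish with while-computes Inv
                    (λ { (_ , c , F) → c , n-ok (frame-input F I) }) step n {0} {s₂} (ℕ.+-identityʳ n)
                    (frame-at τ F₂ ℕ.≤-refl h₁ , h₂ , frame-trans (ℕ.n≤1+n ℓ) F₁ F₂)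
      ... | s₃ , run₃ , h₃ , _ , F₃ = s₃ , seq run₁ (seq run₂ run₃) , h₃ , F₃
    compileˢ-computes [] I b h = _ , skip , (λ ()) , frame-refl
    compileˢ-computes {Δ = τ ∷ Δ} (t ∷ ts) {ℓ = ℓ} {σ} {ρ} I b h with compile-computes t I b h
    ... | s₁ , run₁ , h₁ , F₁
      with compileˢ-computes ts (frame-input F₁ I) (λ x → ℕ.m<n⇒m<1+n (b x)) (frame-holds σ ρ F₁ b h)
    ... | s₂ , run₂ , h₂ , F₂ =
      s₂ , seq run₁ run₂ , (λ { here → frame-at τ F₂ ℕ.≤-refl h₁ ; (there x) → h₂ x }) ,
      frame-trans (ℕ.n≤1+n ℓ) F₁ F₂

    -- The stack in array 5 is scratch space; agreement everywhere else keeps the arrays written by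
    -- earlier uses of `emit`.
    SameOutside : ℕ → State → State → Set
    SameOutside a s s′ = ∀ b j → b ≢ a → b ≢ 5 → nat s′ b j ≡ nat s b j

    emit-computes : ∀ a e {s} → a ≢ 0 → a ≢ 5 → InputOK s →
      Σ[ s′ ∈ State ] (emit a e , s ⇓[ emitTime e n ] s′) × InputOK s′ ×
        (∀ v → v ℕ.< n → nat s′ a v ≡ ⟦ e ⟧ (v ∷ [])) × SameOutside a s s′
    emit-computes a e {s} a≢0 a≢5 I with setᴺ-computes {s} {0} {lit 0} refl
    ... | s₁ , run₁ , h₁ , F₁ = finish
      where
      Inv : ℕ → State → Set
      Inv i s′ = nat s′ 5 0 ≡ i × InputOK s′ ×
                 (∀ v → v ℕ.< i → nat s′ a v ≡ ⟦ e ⟧ (v ∷ [])) × SameOutside a s s′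

      step : ∀ {i s′} → i ℕ.< n → Inv i s′ →
             Σ[ s″ ∈ State ]
               ((compile e 1 (0 ∷ []) ⨾ a [ slotᴺ 0 ]ᴺ≔ slotᴺ 1) ⨾ setᴺ 0 (slotᴺ 0 ⊕ lit 1) , s′
                ⇓[ (time e n ℕ.+ 1) ℕ.+ 1 ] s″) × Inv (suc i) s″
      step {i} {s′} _ (counter , I′ , written , same)
        with compile-computes e {s′} {1} {0 ∷ []} {i ∷ []} I′ (λ { here → s≤s z≤n }) (λ { here → counter })
      ... | t₁ , r₁ , a₁ , G₁ with setᴺ-computes
              {⟨ write (nat t₁) a (nat t₁ 5 0) (nat t₁ 5 1) , real t₁ ⟩} {0} {slotᴺ 0 ⊕ lit 1} refl
      ... | t₂ , r₂ , a₂ , G₂ =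
        t₂ , seq (seq r₁ assignᴺ) r₂ ,
        trans a₂ (trans (ℕ.+-comm _ 1) (cong suc (trans (write-array (nat t₁) _ _ 0 a≢5) counter₁))) ,
        frame-input G₂ (record
          { n-ok = trans (write-array (nat t₁) _ _ 0 a≢0) (n-ok I₁)
          ; k-ok = trans (write-array (nat t₁) _ _ 1 a≢0) (k-ok I₁)
          ; X-ok = X-ok I₁ ; Y-ok = Y-ok I₁ }) ,
        written′ , same′
        where
        I₁ = frame-input G₁ I′
        counter₁ : nat t₁ 5 0 ≡ i
        counter₁ = trans (natᶠ G₁ 5 0 (inj₂ (s≤s z≤n))) counter

        written′ : ∀ v → v ℕ.< suc i → nat t₂ a v ≡ ⟦ e ⟧ (v ∷ [])
        written′ v v<1+i = trans (natᶠ G₂ a v (inj₁ a≢5)) (go (v ℕ.≟ i))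
          where
          go : Dec (v ≡ i) → write (nat t₁) a (nat t₁ 5 0) (nat t₁ 5 1) a v ≡ ⟦ e ⟧ (v ∷ [])
          go (yes refl) rewrite counter₁ = trans (write-same (nat t₁) a v _) a₁
          go (no v≢i)   = trans (write-cell (nat t₁) a _ a (λ eq → v≢i (trans (sym eq) counter₁)))
            (trans (natᶠ G₁ a v (inj₁ a≢5)) (written v (ℕ.≤∧≢⇒< (ℕ.≤-pred v<1+i) v≢i)))

        same′ : SameOutside a s t₂
        same′ b j b≢a b≢5 = trans (natᶠ G₂ b j (inj₁ b≢5))
          (trans (write-array (nat t₁) _ _ j (λ a≡b → b≢a (sym a≡b)))
          (trans (natᶠ G₁ b j (inj₁ b≢5)) (same b j b≢a b≢5)))

      finish : Σ[ s′ ∈ State ] (emit a e , s ⇓[ emitTime e n ] s′) × InputOK s′ ×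
               (∀ v → v ℕ.< n → nat s′ a v ≡ ⟦ e ⟧ (v ∷ [])) × SameOutside a s s′
      finish with while-computes Inv (λ { (c , J , _) → c , n-ok J }) step n {0} {s₁} (ℕ.+-identityʳ n)
                    (h₁ , frame-input F₁ I , (λ _ ()) , λ b j _ b≢5 → natᶠ F₁ b j (inj₁ b≢5))
      ... | s₂ , run₂ , _ , J , written , same = s₂ , seq run₁ run₂ , J , written , same

    writeTree-computes : ∀ flag end₁ end₂ {s} → InputOK s →
      Σ[ s′ ∈ State ] (writeTree flag end₁ end₂ , s ⇓[ writeTreeTime flag end₁ end₂ n ] s′) ×
        (∀ v → v ℕ.< n → nat s′ 1 v ≡ ⟦ flag ⟧ (v ∷ [])) × nat s′ 2 0 ≡ k ℕ.∸ 1 ×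
        (∀ v → v ℕ.< n → nat s′ 3 v ≡ ⟦ end₁ ⟧ (v ∷ [])) ×
        (∀ v → v ℕ.< n → nat s′ 4 v ≡ ⟦ end₂ ⟧ (v ∷ []))
    writeTree-computes flag end₁ end₂ I with emit-computes 1 flag (λ ()) (λ ()) I
    ... | s₁ , run₁ , I₁ , w₁ , _ with emit-computes 3 end₁ (λ ()) (λ ()) I₁
    ... | s₂ , run₂ , I₂ , w₂ , f₂ with emit-computes 4 end₂ (λ ()) (λ ()) I₂
    ... | s₃ , run₃ , I₃ , w₃ , f₃ =
      _ , seq run₁ (seq run₂ (seq run₃ assignᴺ)) ,
      (λ v v<n → trans (f₃ 1 v (λ ()) (λ ())) (trans (f₂ 1 v (λ ()) (λ ())) (w₁ v v<n))) ,
      cong (ℕ._∸ 1) (k-ok I₃) ,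
      (λ v v<n → trans (f₃ 3 v (λ ()) (λ ())) (w₂ v v<n)) , w₃

-- The algorithm as functions on numbers.

module GridAlgorithm (R : RealNumbers) where
  open RealNumbers R
  open Plane R
  open LoopLanguage R
  open Combinatorics

  -- Index 0 is the initial candidate, whether or not it is `ok`; hence the assumption `ok 0` in
  -- `argmin-ok`.
  argmin : (ℕ → Bool) → (ℕ → ℝ) → ℕ → ℕ
  argmin ok c = iter (λ i a → if ok i ∧ ⌊ c i ≤? c a ⌋ then i else a) 0

  -- The chosen half is stretched back to length `S` instead of being measured at half the scale, so
  -- no division occurs. `digit` appends the binary digit telling which half it was.
  bisect : ℝ → ℝ → ℝ
  bisect S y = if ⌊ S ≤? y + y ⌋ then y + y - S else y + y

  digit : ℝ → ℝ → ℕ → ℕ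
  digit S y g = if ⌊ S ≤? y + y ⌋ then suc (g ℕ.+ g) else g ℕ.+ g

  module Algorithm (n k : ℕ) (X Y : ℕ → ℝ) where

    δ : ℕ → ℕ → ℝ
    δ v w = dist (X v , Y v) (X w , Y w)

    side : ℕ → ℕ → ℝ
    side i j = δ i j + δ i j

    -- Coordinates relative to the lower left corner of the square, hence between 0 and `side i j`
    -- for points inside.
    offset : (ℕ → ℝ) → ℕ → ℕ → ℕ → ℝ
    offset Z i j v = Z v - Z i + δ i j

    within : ℝ → ℝ → Bool
    within S z = ⌊ 0# ≤? z ⌋ ∧ ⌊ z ≤? S ⌋

    opaque
      in-square : ℕ → ℕ → ℕ → Bool
      in-square i j v = within (side i j) (offset X i j v) ∧ within (side i j) (offset Y i j v)

    -- A loop of the language always runs n times; the guards stop these after m bisections.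
    position : ℝ → ℝ → ℕ → ℝ
    position S z m = iter (λ a y → if leᵇ (suc a) m then bisect S y else y) z n

    index : ℝ → ℝ → ℕ → ℕ
    index S z m = iter (λ a g → if leᵇ (suc a) m then digit S (position S z a) g else g) 0 n

    opaque
      column row : ℕ → ℕ → ℕ → ℕ → ℕ
      column i j m v = index (side i j) (offset X i j v) m
      row    i j m v = index (side i j) (offset Y i j v) m

    module Order (i j m : ℕ) = Density n (in-square i j) (column i j m) (row i j m)

    opaque
      nearest : ℕ → ℕ → ℕ → ℕ → ℕ
      nearest i j m r = argmin (λ s → leᵇ (suc s) r) (λ s → δ (Order.σ i j m r) (Order.σ i j m s)) n

    -- The root `r = 0` has no parent, and the summing loop runs beyond `k`; the guard assigns cost
    -- 0 to both.
    step-cost : ℕ → ℕ → ℕ → ℕ → ℝ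
    step-cost i j m r = if leᵇ 1 r ∧ leᵇ (suc r) k
                        then δ (Order.σ i j m r) (Order.σ i j m (nearest i j m r)) else 0#

    opaque
      cost : ℕ → ℕ → ℕ → ℝ
      cost i j m = iter (λ r c → c + step-cost i j m r) 0# n

    opaque
      -- Three nested minimisations over single numbers replace a search over triples, since an
      -- accumulator holds only one value.
      best-m : ℕ → ℕ → ℕ
      best-m i j = argmin (λ _ → true) (cost i j) n

    opaque
      best-j : ℕ → ℕ
      best-j i = argmin (λ _ → true) (λ j → cost i j (best-m i j)) n

    opaque
      best-i : ℕ
      best-i = argmin (λ _ → true) (λ i → cost i (best-j i) (best-m i (best-j i))) n

  -- The algorithm as terms of the loop language.

  pattern N¹ = natᵗ ∷ []
  pattern N² = natᵗ ∷ natᵗ ∷ []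
  pattern N³ = natᵗ ∷ natᵗ ∷ natᵗ ∷ []
  pattern N⁴ = natᵗ ∷ natᵗ ∷ natᵗ ∷ natᵗ ∷ []
  pattern N⁵ = natᵗ ∷ natᵗ ∷ natᵗ ∷ natᵗ ∷ natᵗ ∷ []

  v₀ : ∀ {Γ τ} → Tm (τ ∷ Γ) τ
  v₀ = var here
  v₁ : ∀ {Γ a τ} → Tm (a ∷ τ ∷ Γ) τ
  v₁ = var (there here)
  v₂ : ∀ {Γ a b τ} → Tm (a ∷ b ∷ τ ∷ Γ) τ
  v₂ = var (there (there here))
  v₃ : ∀ {Γ a b c τ} → Tm (a ∷ b ∷ c ∷ τ ∷ Γ) τ
  v₃ = var (there (there (there here)))
  v₄ : ∀ {Γ a b c d τ} → Tm (a ∷ b ∷ c ∷ d ∷ τ ∷ Γ) τ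
  v₄ = var (there (there (there (there here))))
  v₅ : ∀ {Γ a b c d e τ} → Tm (a ∷ b ∷ c ∷ d ∷ e ∷ τ ∷ Γ) τ
  v₅ = var (there (there (there (there (there here)))))
  v₆ : ∀ {Γ a b c d e f τ} → Tm (a ∷ b ∷ c ∷ d ∷ e ∷ f ∷ τ ∷ Γ) τ
  v₆ = var (there (there (there (there (there (there here))))))
  v₇ : ∀ {Γ a b c d e f g τ} → Tm (a ∷ b ∷ c ∷ d ∷ e ∷ f ∷ g ∷ τ ∷ Γ) τ
  v₇ = var (there (there (there (there (there (there (there here)))))))

  infixl 6 _+ᵗ_
  infix 4 _≤ᵗ_ _≤ʳᵗ_ _≡ᵗ_
  infixr 3 _∧ᵗ_

  litᵗ : ∀ {Γ} → ℕ → Tm Γ natᵗ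
  litᵗ m = op (litᵒ m) []

  _≤ᵗ_ : ∀ {Γ} → Tm Γ natᵗ → Tm Γ natᵗ → Tm Γ boolᵗ
  a ≤ᵗ b = op leᵒ (a ∷ b ∷ [])

  _≤ʳᵗ_ : ∀ {Γ} → Tm Γ realᵗ → Tm Γ realᵗ → Tm Γ boolᵗ
  x ≤ʳᵗ y = op leʳ (x ∷ y ∷ [])

  _∧ᵗ_ : ∀ {Γ} → Tm Γ boolᵗ → Tm Γ boolᵗ → Tm Γ boolᵗ
  a ∧ᵗ b = op andᵒ (a ∷ b ∷ [])

  _≡ᵗ_ : ∀ {Γ} → Tm Γ natᵗ → Tm Γ natᵗ → Tm Γ boolᵗ
  a ≡ᵗ b = (a ≤ᵗ b) ∧ᵗ (b ≤ᵗ a)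

  _+ᵗ_ : ∀ {Γ} → Tm Γ realᵗ → Tm Γ realᵗ → Tm Γ realᵗ
  x +ᵗ y = op plusʳ (x ∷ y ∷ [])

  -ᵗ_ : ∀ {Γ} → Tm Γ realᵗ → Tm Γ realᵗ
  -ᵗ x = op negʳ (x ∷ [])

  sucᵗ : ∀ {Γ} → Tm Γ natᵗ → Tm Γ natᵗ
  sucᵗ a = op plusᵒ (litᵗ 1 ∷ a ∷ [])

  doubleᵗ : ∀ {Γ} → Tm Γ natᵗ → Tm Γ natᵗ
  doubleᵗ a = op plusᵒ (a ∷ a ∷ [])

  ifᵗ : ∀ {Γ τ} → Tm Γ boolᵗ → Tm Γ τ → Tm Γ τ → Tm Γ τ
  ifᵗ a t u = op ifᵒ (a ∷ t ∷ u ∷ [])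

  xᵗ yᵗ : ∀ {Γ} → Tm Γ natᵗ → Tm Γ realᵗ
  xᵗ v = op xᵒ (v ∷ [])
  yᵗ v = op yᵒ (v ∷ [])

  δᵗ : Tm N² realᵗ
  δᵗ = op sqrtʳ ((sq (xᵗ v₀ +ᵗ (-ᵗ xᵗ v₁)) +ᵗ sq (yᵗ v₀ +ᵗ (-ᵗ yᵗ v₁))) ∷ [])
    where
    sq : ∀ {Γ} → Tm Γ realᵗ → Tm Γ realᵗ
    sq x = op timesʳ (x ∷ x ∷ [])

  sideᵗ : Tm N² realᵗ
  sideᵗ = d +ᵗ d
    where d = call δᵗ (v₀ ∷ v₁ ∷ [])

  offsetᵗ : (∀ {Γ} → Tm Γ natᵗ → Tm Γ realᵗ) → Tm N³ realᵗ
  offsetᵗ zᵗ = zᵗ v₂ +ᵗ (-ᵗ zᵗ v₀) +ᵗ call δᵗ (v₀ ∷ v₁ ∷ [])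

  opaque
    in-squareᵗ : Tm N³ boolᵗ
    in-squareᵗ = within xᵗ ∧ᵗ within yᵗ
      where
      within : (∀ {Γ} → Tm Γ natᵗ → Tm Γ realᵗ) → Tm N³ boolᵗ
      within zᵗ = (op zeroᵒ [] ≤ʳᵗ call (offsetᵗ zᵗ) (v₀ ∷ v₁ ∷ v₂ ∷ [])) ∧ᵗ
                  (call (offsetᵗ zᵗ) (v₀ ∷ v₁ ∷ v₂ ∷ []) ≤ʳᵗ call sideᵗ (v₀ ∷ v₁ ∷ []))

  positionᵗ : Tm (realᵗ ∷ realᵗ ∷ natᵗ ∷ []) realᵗ
  positionᵗ = fold v₁ (ifᵗ (sucᵗ v₁ ≤ᵗ v₄)
    (ifᵗ (v₂ ≤ʳᵗ v₀ +ᵗ v₀) (v₀ +ᵗ v₀ +ᵗ (-ᵗ v₂)) (v₀ +ᵗ v₀)) v₀)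

  -- A loop carries one accumulator, so the position is recomputed from the start in each round
  -- rather than carried along with the index.
  indexᵗ : Tm (realᵗ ∷ realᵗ ∷ natᵗ ∷ []) natᵗ
  indexᵗ = fold (litᵗ 0) (ifᵗ (sucᵗ v₁ ≤ᵗ v₄)
    (ifᵗ (v₂ ≤ʳᵗ y +ᵗ y) (sucᵗ (doubleᵗ v₀)) (doubleᵗ v₀)) v₀)
    where
    y : Tm (natᵗ ∷ natᵗ ∷ realᵗ ∷ realᵗ ∷ natᵗ ∷ []) realᵗ
    y = call positionᵗ (v₂ ∷ v₃ ∷ v₁ ∷ [])

  opaque
    coordinateᵗ : (∀ {Γ} → Tm Γ natᵗ → Tm Γ realᵗ) → Tm N⁴ natᵗ
    coordinateᵗ zᵗ = call indexᵗ (call sideᵗ (v₀ ∷ v₁ ∷ []) ∷ call (offsetᵗ zᵗ) (v₀ ∷ v₁ ∷ v₃ ∷ []) ∷ v₂ ∷ [])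

  opaque
    sameᵗ : Tm N⁵ boolᵗ
    sameᵗ = call in-squareᵗ (v₀ ∷ v₁ ∷ v₃ ∷ []) ∧ᵗ call in-squareᵗ (v₀ ∷ v₁ ∷ v₄ ∷ []) ∧ᵗ
            (at v₃ xᵗ ≡ᵗ at v₄ xᵗ) ∧ᵗ (at v₃ yᵗ ≡ᵗ at v₄ yᵗ)
      where
      at : Tm N⁵ natᵗ → (∀ {Γ} → Tm Γ natᵗ → Tm Γ realᵗ) → Tm N⁵ natᵗ
      at v zᵗ = call (coordinateᵗ zᵗ) (v₀ ∷ v₁ ∷ v₂ ∷ v ∷ [])

  opaque
    densityᵗ : Tm N⁴ natᵗ
    densityᵗ = fold (litᵗ 0) (ifᵗ (call sameᵗ (v₂ ∷ v₃ ∷ v₄ ∷ v₅ ∷ v₁ ∷ [])) (sucᵗ v₀) v₀)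

  opaque
    -- There are no list values, so the two keys of four components arrive as eight arguments.
    lexᵗ : Tm (natᵗ ∷ natᵗ ∷ natᵗ ∷ natᵗ ∷ natᵗ ∷ natᵗ ∷ natᵗ ∷ natᵗ ∷ []) boolᵗ
    lexᵗ = lex v₀ v₄ (lex v₁ v₅ (lex v₂ v₆ (lex v₃ v₇ (op (boolᵒ false) []))))
      where
      lex : ∀ {Γ} → Tm Γ natᵗ → Tm Γ natᵗ → Tm Γ boolᵗ → Tm Γ boolᵗ
      lex a b rest = ifᵗ (b ≤ᵗ a) ((a ≤ᵗ b) ∧ᵗ rest) (op (boolᵒ true) [])

  opaque
    beforeᵗ : Tm N⁵ boolᵗ
    beforeᵗ = call lexᵗ (sparsity v₃ ∷ at v₃ xᵗ ∷ at v₃ yᵗ ∷ v₃ ∷ sparsity v₄ ∷ at v₄ xᵗ ∷ at v₄ yᵗ ∷ v₄ ∷ [])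
      where
      at : Tm N⁵ natᵗ → (∀ {Γ} → Tm Γ natᵗ → Tm Γ realᵗ) → Tm N⁵ natᵗ
      at v zᵗ = call (coordinateᵗ zᵗ) (v₀ ∷ v₁ ∷ v₂ ∷ v ∷ [])
      sparsity : Tm N⁵ natᵗ → Tm N⁵ natᵗ
      sparsity v = op minusᵒ (op sizeᵒ [] ∷ call densityᵗ (v₀ ∷ v₁ ∷ v₂ ∷ v ∷ []) ∷ [])

  opaque
    rankᵗ : Tm N⁴ natᵗ
    rankᵗ = fold (litᵗ 0) (ifᵗ (call beforeᵗ (v₂ ∷ v₃ ∷ v₄ ∷ v₁ ∷ v₅ ∷ [])) (sucᵗ v₀) v₀)

  opaque
    σᵗ : Tm N⁴ natᵗ
    σᵗ = fold (litᵗ 0) (ifᵗ (call rankᵗ (v₂ ∷ v₃ ∷ v₄ ∷ v₁ ∷ []) ≡ᵗ v₅) v₁ v₀)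

  opaque
    nearestᵗ : Tm N⁴ natᵗ
    nearestᵗ = fold (litᵗ 0) (ifᵗ ((sucᵗ v₁ ≤ᵗ v₅) ∧ᵗ (gap v₁ ≤ʳᵗ gap v₀)) v₁ v₀)
      where
      gap : Tm (natᵗ ∷ natᵗ ∷ N⁴) natᵗ → Tm (natᵗ ∷ natᵗ ∷ N⁴) realᵗ
      gap s = call δᵗ (call σᵗ (v₂ ∷ v₃ ∷ v₄ ∷ v₅ ∷ []) ∷ call σᵗ (v₂ ∷ v₃ ∷ v₄ ∷ s ∷ []) ∷ [])

  opaque
    costᵗ : Tm N³ realᵗ
    costᵗ = fold (op zeroᵒ []) (v₀ +ᵗ ifᵗ ((litᵗ 1 ≤ᵗ v₁) ∧ᵗ (sucᵗ v₁ ≤ᵗ op goalᵒ []))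
      (call δᵗ (call σᵗ (v₂ ∷ v₃ ∷ v₄ ∷ v₁ ∷ []) ∷
                call σᵗ (v₂ ∷ v₃ ∷ v₄ ∷ call nearestᵗ (v₂ ∷ v₃ ∷ v₄ ∷ v₁ ∷ []) ∷ []) ∷ []))
      (op zeroᵒ []))

  opaque
    best-mᵗ : Tm N² natᵗ
    best-mᵗ = fold (litᵗ 0) (ifᵗ (call costᵗ (v₂ ∷ v₃ ∷ v₁ ∷ []) ≤ʳᵗ call costᵗ (v₂ ∷ v₃ ∷ v₀ ∷ [])) v₁ v₀)

  opaque
    best-jᵗ : Tm N¹ natᵗ
    best-jᵗ = fold (litᵗ 0) (ifᵗ (at v₁ ≤ʳᵗ at v₀) v₁ v₀)
      where
      at : Tm N³ natᵗ → Tm N³ realᵗ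
      at j = call costᵗ (v₂ ∷ j ∷ call best-mᵗ (v₂ ∷ j ∷ []) ∷ [])

  opaque
    best-iᵗ : Tm [] natᵗ
    best-iᵗ = fold (litᵗ 0) (ifᵗ (at v₁ ≤ʳᵗ at v₀) v₁ v₀)
      where
      at : Tm N² natᵗ → Tm N² realᵗ
      at i = call costᵗ (i ∷ call best-jᵗ (i ∷ []) ∷ call best-mᵗ (i ∷ call best-jᵗ (i ∷ []) ∷ []) ∷ [])

  -- The best parameters are recomputed for every output cell; this only raises the degree of the
  -- polynomial.
  at-best : Tm N⁴ natᵗ → Tm N¹ natᵗ
  at-best t = call t (i ∷ j ∷ m ∷ v₀ ∷ [])
    where
    i = call best-iᵗ []
    j = call best-jᵗ (i ∷ [])
    m = call best-mᵗ (i ∷ j ∷ [])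

  flagᵗ : Tm N⁴ natᵗ
  flagᵗ = ifᵗ (sucᵗ (call rankᵗ (v₀ ∷ v₁ ∷ v₂ ∷ v₃ ∷ [])) ≤ᵗ op goalᵒ []) (litᵗ 1) (litᵗ 0)

  childᵗ : Tm N⁴ natᵗ
  childᵗ = call σᵗ (v₀ ∷ v₁ ∷ v₂ ∷ sucᵗ v₃ ∷ [])

  parentᵗ : Tm N⁴ natᵗ
  parentᵗ = call σᵗ (v₀ ∷ v₁ ∷ v₂ ∷ call nearestᵗ (v₀ ∷ v₁ ∷ v₂ ∷ sucᵗ v₃ ∷ []) ∷ [])

  program : Program
  program = writeTree (at-best flagᵗ) (at-best childᵗ) (at-best parentᵗ)

  iter-cong : ∀ {A : Set} {f g : ℕ → A → A} {z} → (∀ i a → f i a ≡ g i a) → ∀ m → iter f z m ≡ iter g z m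
  iter-cong f≡g zero    = refl
  iter-cong {g = g} f≡g (suc m) = trans (f≡g m _) (cong (g m) (iter-cong f≡g m))

  argmin-cong : ∀ {ok} {c c′ : ℕ → ℝ} → (∀ s → c s ≡ c′ s) → ∀ m → argmin ok c m ≡ argmin ok c′ m
  argmin-cong {ok} c≡c′ = iter-cong (λ i a → cong₂ (λ x y → if ok i ∧ ⌊ x ≤? y ⌋ then i else a) (c≡c′ i) (c≡c′ a))

  -- Agreement of the terms with the functions.

  module Denotations (n k : ℕ) (X Y : ℕ → ℝ) where
    open Algorithm n k X Y
    open Semantics n k X Y

    opaque
      unfolding column coordinateᵗ

      ⟦column⟧ : ∀ i j m v → ⟦ coordinateᵗ xᵗ ⟧ (i ∷ j ∷ m ∷ v ∷ []) ≡ column i j m v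
      ⟦column⟧ i j m v = refl

      ⟦row⟧ : ∀ i j m v → ⟦ coordinateᵗ yᵗ ⟧ (i ∷ j ∷ m ∷ v ∷ []) ≡ row i j m v
      ⟦row⟧ i j m v = refl

    opaque
      unfolding in-square in-squareᵗ

      ⟦in-square⟧ : ∀ i j v → ⟦ in-squareᵗ ⟧ (i ∷ j ∷ v ∷ []) ≡ in-square i j v
      ⟦in-square⟧ i j v = refl

    opaque
      unfolding sameᵗ

      ⟦same⟧ : ∀ i j m v w → ⟦ sameᵗ ⟧ (i ∷ j ∷ m ∷ v ∷ w ∷ []) ≡ Order.same i j m v w
      ⟦same⟧ i j m v w = cong₂ _∧_ (⟦in-square⟧ i j v) (cong₂ _∧_ (⟦in-square⟧ i j w)
        (cong₂ _∧_ (cong₂ eqᵇ (⟦column⟧ i j m v) (⟦column⟧ i j m w)) (cong₂ eqᵇ (⟦row⟧ i j m v) (⟦row⟧ i j m w))))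

    opaque
      unfolding densityᵗ Density.density

      ⟦density⟧ : ∀ i j m v → ⟦ densityᵗ ⟧ (i ∷ j ∷ m ∷ v ∷ []) ≡ Order.density i j m v
      ⟦density⟧ i j m v = iter-cong (λ w a → cong (λ b → if b then suc a else a) (⟦same⟧ i j m v w)) n

    opaque
      unfolding lexᵗ

      ⟦lex⟧ : ∀ a b c d a′ b′ c′ d′ → ⟦ lexᵗ ⟧ (a ∷ b ∷ c ∷ d ∷ a′ ∷ b′ ∷ c′ ∷ d′ ∷ []) ≡
              lexᵇ (a ∷ b ∷ c ∷ d ∷ []) (a′ ∷ b′ ∷ c′ ∷ d′ ∷ [])
      ⟦lex⟧ a b c d a′ b′ c′ d′ = refl

    opaque
      unfolding beforeᵗ Rank.before

      ⟦before⟧ : ∀ i j m w v → ⟦ beforeᵗ ⟧ (i ∷ j ∷ m ∷ w ∷ v ∷ []) ≡ Order.before i j m w v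
      ⟦before⟧ i j m w v = trans (⟦lex⟧ _ _ _ _ _ _ _ _) (cong₂ lexᵇ (key-eq w) (key-eq v))
        where
        key-eq : ∀ v → n ℕ.∸ ⟦ densityᵗ ⟧ (i ∷ j ∷ m ∷ v ∷ []) ∷ ⟦ coordinateᵗ xᵗ ⟧ (i ∷ j ∷ m ∷ v ∷ []) ∷
                       ⟦ coordinateᵗ yᵗ ⟧ (i ∷ j ∷ m ∷ v ∷ []) ∷ v ∷ [] ≡ Order.key i j m v
        key-eq v = cong₂ _∷_ (cong (n ℕ.∸_) (⟦density⟧ i j m v))
          (cong₂ (λ a b → a ∷ b ∷ v ∷ []) (⟦column⟧ i j m v) (⟦row⟧ i j m v))

    opaque
      unfolding rankᵗ Rank.rank

      ⟦rank⟧ : ∀ i j m v → ⟦ rankᵗ ⟧ (i ∷ j ∷ m ∷ v ∷ []) ≡ Order.rank i j m v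
      ⟦rank⟧ i j m v = iter-cong (λ w a → cong (λ b → if b then suc a else a) (⟦before⟧ i j m w v)) n

    opaque
      unfolding σᵗ Rank.σ

      ⟦σ⟧ : ∀ i j m r → ⟦ σᵗ ⟧ (i ∷ j ∷ m ∷ r ∷ []) ≡ Order.σ i j m r
      ⟦σ⟧ i j m r = iter-cong (λ v a → cong (λ x → if eqᵇ x r then v else a) (⟦rank⟧ i j m v)) n

    opaque
      unfolding nearestᵗ nearest

      ⟦nearest⟧ : ∀ i j m r → ⟦ nearestᵗ ⟧ (i ∷ j ∷ m ∷ r ∷ []) ≡ nearest i j m r
      ⟦nearest⟧ i j m r = argmin-cong (λ s → cong₂ δ (⟦σ⟧ i j m r) (⟦σ⟧ i j m s)) n

    opaque
      unfolding costᵗ cost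

      ⟦cost⟧ : ∀ i j m → ⟦ costᵗ ⟧ (i ∷ j ∷ m ∷ []) ≡ cost i j m
      ⟦cost⟧ i j m = iter-cong (λ r c → cong (λ x → c + (if leᵇ 1 r ∧ leᵇ (suc r) k then x else 0#))
        (cong₂ δ (⟦σ⟧ i j m r) (trans (⟦σ⟧ i j m _) (cong (Order.σ i j m) (⟦nearest⟧ i j m r))))) n

    opaque
      unfolding best-mᵗ best-m

      ⟦best-m⟧ : ∀ i j → ⟦ best-mᵗ ⟧ (i ∷ j ∷ []) ≡ best-m i j
      ⟦best-m⟧ i j = argmin-cong {λ _ → true} (⟦cost⟧ i j) n

    opaque
      unfolding best-jᵗ best-j

      ⟦best-j⟧ : ∀ i → ⟦ best-jᵗ ⟧ (i ∷ []) ≡ best-j i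
      ⟦best-j⟧ i = argmin-cong {λ _ → true} (λ j → trans (⟦cost⟧ i j _) (cong (cost i j) (⟦best-m⟧ i j))) n

    opaque
      unfolding best-iᵗ best-i

      ⟦best-i⟧ : ⟦ best-iᵗ ⟧ [] ≡ best-i
      ⟦best-i⟧ = argmin-cong {λ _ → true} (λ i → trans (⟦cost⟧ i _ _)
        (trans (cong (cost i _) (⟦best-m⟧ i _)) (cong (λ j → cost i j (best-m i j)) (⟦best-j⟧ i)))) n

    ⟦at-best⟧ : ∀ (t : Tm N⁴ natᵗ) (f : ℕ → ℕ → ℕ → ℕ → ℕ) → (∀ i j m v → ⟦ t ⟧ (i ∷ j ∷ m ∷ v ∷ []) ≡ f i j m v) →
                ∀ v → ⟦ at-best t ⟧ (v ∷ []) ≡ f best-i (best-j best-i) (best-m best-i (best-j best-i)) v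
    -- The equation for `m` still mentions the term values of `i` and `j`, and that for `j` the one
    -- of `i`; hence the replacement goes from `m` to `i`.
    ⟦at-best⟧ t f eq v = trans (eq _ _ _ v) (trans (cong (λ m → f i j m v) (⟦best-m⟧ i j))
      (trans (cong (λ j → f i j (best-m i j) v) (⟦best-j⟧ i)) (cong (λ i → f i (best-j i) (best-m i (best-j i)) v) ⟦best-i⟧)))
      where
      i = ⟦ best-iᵗ ⟧ []
      j = ⟦ best-jᵗ ⟧ (i ∷ [])

    ⟦flag⟧ : ∀ i j m v → ⟦ flagᵗ ⟧ (i ∷ j ∷ m ∷ v ∷ []) ≡ (if leᵇ (suc (Order.rank i j m v)) k then 1 else 0)
    ⟦flag⟧ i j m v = cong (λ x → if leᵇ (suc x) k then 1 else 0) (⟦rank⟧ i j m v)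

    ⟦child⟧ : ∀ i j m e → ⟦ childᵗ ⟧ (i ∷ j ∷ m ∷ e ∷ []) ≡ Order.σ i j m (suc e)
    ⟦child⟧ i j m e = ⟦σ⟧ i j m (suc e)

    ⟦parent⟧ : ∀ i j m e → ⟦ parentᵗ ⟧ (i ∷ j ∷ m ∷ e ∷ []) ≡ Order.σ i j m (nearest i j m (suc e))
    ⟦parent⟧ i j m e = trans (⟦σ⟧ i j m _) (cong (Order.σ i j m) (⟦nearest⟧ i j m (suc e)))

-- Geometry of the cells and cost of the tree built from one grid.

module GridAnalysis (R : RealNumbers) where
  open RealNumbers R
  open Plane R
  open RealArithmetic R
  open Combinatorics
  open GridAlgorithm R

  pow : ℕ → ℝ
  pow a = fromℕ (2 ℕ.^ a)

  pow-suc : ∀ a x → pow (suc a) * x ≡ pow a * x + pow a * x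
  pow-suc a x = trans (cong (_* x) (fromℕ-* 2 (2 ℕ.^ a)))
    (solve 2 (λ p x → con (ℤ.+ 2) :* p :* x := p :* x :+ p :* x) refl (pow a) x)

  pow-nonNeg : ∀ a → 0# ≤ pow a
  pow-nonNeg a = 0≤fromℕ (2 ℕ.^ a)

  pow-≢0 : ∀ a → pow a ≢ 0#
  pow-≢0 a = 1≤⇒≢0 (1≤fromℕ (ℕ.m^n>0 2 a))

  fromℕ-cancel-≤ : ∀ {m n} → fromℕ m ≤ fromℕ n → m ℕ.≤ n
  fromℕ-cancel-≤ {m} {n} h with m ℕ.≤? n
  ... | yes m≤n = m≤n
  ... | no m≰n  = ⊥-elim (1≤⇒≢0 {1#} ≤-refl (≤-antisym 1≤0 0≤1))
    where
    1≤0 : 1# ≤ 0#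
    1≤0 = subst₂ _≤_ (solve 2 (λ o x → o :+ x :+ :- x := o) refl 1# (fromℕ n)) (-‿inverseʳ (fromℕ n))
      (subst₂ _≤_ (+-comm _ _) (+-comm _ _) (+-monoʳ-≤ (- fromℕ n) (≤-trans (fromℕ-mono (ℕ.≰⇒> m≰n)) h)))

  near-shift : ∀ {e x y} c → Near e (x + c) (y + c) → Near e x y
  near-shift {e} {x} {y} c (p , q) =
    ≤-by (0≤-diff p) (solve 4 (λ e x y c → y :+ e := x :+ (y :+ c :+ e :- (x :+ c))) refl e x y c) ,
    ≤-by (0≤-diff q) (solve 4 (λ e x y c → x :+ e := y :+ (x :+ c :+ e :- (y :+ c))) refl e x y c)

  near-shift⁺ : ∀ {e x y} c → Near e x y → Near e (x + c) (y + c)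
  near-shift⁺ {e} {x} {y} c (p , q) =
    ≤-by (0≤-diff p) (solve 4 (λ e x y c → y :+ c :+ e := x :+ c :+ (y :+ e :- x)) refl e x y c) ,
    ≤-by (0≤-diff q) (solve 4 (λ e x y c → x :+ c :+ e := y :+ c :+ (x :+ e :- y)) refl e x y c)

  near-unscale : ∀ {c e x y} → 0# ≤ c → c ≢ 0# → Near (c * e) (c * x) (c * y) → Near e x y
  near-unscale {c} {e} {x} {y} 0≤c c≢0 (p , q) =
    *-cancelˡ-≤ 0≤c c≢0 (≤-trans p (≤-reflexive (sym (distribˡ c y e)))) ,
    *-cancelˡ-≤ 0≤c c≢0 (≤-trans q (≤-reflexive (sym (distribˡ c x e))))

  near-scale : ∀ {c e x y} → 0# ≤ c → Near e x y → Near (c * e) (c * x) (c * y)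
  near-scale {c} {e} {x} {y} 0≤c (p , q) =
    ≤-trans (*-monoˡ-≤ 0≤c p) (≤-reflexive (distribˡ c y e)) ,
    ≤-trans (*-monoˡ-≤ 0≤c q) (≤-reflexive (distribˡ c x e))

  ≰⇒≥ : ∀ {x y} → ¬ x ≤ y → y ≤ x
  ≰⇒≥ {x} {y} x≰y with ≤-total x y
  ... | inj₁ x≤y = ⊥-elim (x≰y x≤y)
  ... | inj₂ y≤x = y≤x

  module Bisection (S : ℝ) where

    residue : ℝ → ℕ → ℝ
    residue z = iter (λ _ y → bisect S y) z

    code : ℝ → ℕ → ℕ
    code z = iter (λ a g → digit S (residue z a) g) 0

    -- Closed at both ends: `bisect` fixes the upper end `S`, so that the far edge of the square
    -- belongs to the last cells and needs no cells of its own.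
    Inside : ℝ → Set
    Inside z = 0# ≤ z × z ≤ S

    bisect-inside : ∀ {y} → Inside y → Inside (bisect S y)
    bisect-inside {y} (0≤y , y≤S) with S ≤? y + y
    ... | yes S≤2y = 0≤-diff S≤2y , ≤-by (+-nonNeg (0≤-diff y≤S) (0≤-diff y≤S))
            (solve 2 (λ S y → S := y :+ y :- S :+ (S :- y :+ (S :- y))) refl S y)
    ... | no S≰2y = +-nonNeg 0≤y 0≤y , ≰⇒≥ S≰2y

    residue-inside : ∀ {z} → Inside z → ∀ a → Inside (residue z a)
    residue-inside h zero    = h
    residue-inside h (suc a) = bisect-inside (residue-inside h a)

    bisect-digit : ∀ y g → bisect S y + fromℕ (digit S y g) * S ≡ (fromℕ g * S + y) + (fromℕ g * S + y)
    bisect-digit y g with S ≤? y + y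
    ... | yes _ = trans (cong (y + y - S +_) (trans (fromℕ-suc-* (g ℕ.+ g) S) (cong (λ x → S + x * S) (fromℕ-+ g g))))
      (solve 3 (λ y S g → y :+ y :- S :+ (S :+ (g :+ g) :* S) := g :* S :+ y :+ (g :* S :+ y)) refl y S (fromℕ g))
    ... | no _  = trans (cong (λ x → y + y + x * S) (fromℕ-+ g g))
      (solve 3 (λ y S g → y :+ y :+ (g :+ g) :* S := g :* S :+ y :+ (g :* S :+ y)) refl y S (fromℕ g))

    -- By `bisect-digit` each bisection doubles code times `S` plus residue. Thus the code is the
    -- integer part of `z` in units of the cell side, up to the choice at cell boundaries.
    expansion : ∀ z a → pow a * z ≡ fromℕ (code z a) * S + residue z a
    expansion z zero    = trans (cong (_* z) (+-identityʳ 1#)) (trans (*-identityˡ z)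
      (solve 2 (λ S z → z := con (ℤ.+ 0) :* S :+ z) refl S z))
    expansion z (suc a) = trans (pow-suc a z) (trans (cong₂ _+_ (expansion z a) (expansion z a))
      (trans (sym (bisect-digit (residue z a) (code z a))) (+-comm _ _)))

    same-code⇒near : ∀ {z z′} a → Inside z → Inside z′ → code z a ≡ code z′ a → Near S (pow a * z) (pow a * z′)
    same-code⇒near {z} {z′} a h h′ eq =
      half (residue-inside h a) (residue-inside h′ a) (expansion z a)
        (trans (expansion z′ a) (cong (λ g → fromℕ g * S + residue z′ a) (sym eq))) ,
      half (residue-inside h′ a) (residue-inside h a) (trans (expansion z′ a) (cong (λ g → fromℕ g * S + residue z′ a) (sym eq)))
        (expansion z a)
      where
      half : ∀ {y y′ x x′ c} → Inside y → Inside y′ → x ≡ c + y → x′ ≡ c + y′ → x ≤ x′ + S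
      half {y} {y′} {c = c} (_ , y≤S) (0≤y′ , _) refl refl = ≤-by (+-nonNeg (0≤-diff y≤S) 0≤y′)
        (solve 4 (λ c y y′ S → c :+ y′ :+ S := c :+ y :+ (S :- y :+ y′)) refl c y y′ S)

    -- One unit of the 2 is for the residue of `z′`, the other for the distance, which is at most
    -- one cell side.
    near⇒code≤ : ∀ {z z′ e} a → S ≢ 0# → 0# ≤ S → Inside z → Inside z′ → pow a * e ≤ S → Near e z z′ →
                 code z a ℕ.≤ 2 ℕ.+ code z′ a
    near⇒code≤ {z} {z′} {e} a S≢0 0≤S h h′ pe≤S near = fromℕ-cancel-≤
      (*-cancelˡ-≤ 0≤S S≢0 (subst₂ _≤_ (*-comm _ _) (*-comm _ _)
        (≤-trans (≤-by (proj₁ (residue-inside h a)) (expansion z a))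
        (≤-trans (proj₁ (near-scale (pow-nonNeg a) near))
        (≤-trans (+-mono-≤ (≤-trans (≤-reflexive (expansion z′ a)) (+-monoʳ-≤ _ (proj₂ (residue-inside h′ a)))) pe≤S)
        (≤-reflexive (trans (solve 2 (λ g S → g :* S :+ S :+ S := (con (ℤ.+ 2) :+ g) :* S) refl (fromℕ (code z′ a)) S)
          (cong (_* S) (sym (fromℕ-+ 2 (code z′ a)))))))))))

    code-parent : ∀ z a → code z a ≡ ⌊ code z (suc a) /2⌋
    code-parent z a with S ≤? residue z a + residue z a
    ... | yes _ = ℕ.n≡⌈n+n/2⌉ (code z a)
    ... | no _  = ℕ.n≡⌊n+n/2⌋ (code z a)

    code-child : ∀ z a → let g = code z a in code z (suc a) ≡ g ℕ.+ g ⊎ code z (suc a) ≡ suc (g ℕ.+ g)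
    code-child z a with S ≤? residue z a + residue z a
    ... | yes _ = inj₂ refl
    ... | no _  = inj₁ refl

  quarters : Cell → List Cell
  quarters (g , h) = (g ℕ.+ g , h ℕ.+ h) ∷ (g ℕ.+ g , suc (h ℕ.+ h)) ∷
                     (suc (g ℕ.+ g) , h ℕ.+ h) ∷ (suc (g ℕ.+ g) , suc (h ℕ.+ h)) ∷ []

  ∈-quarters : ∀ g h {g′ h′} → g′ ≡ g ℕ.+ g ⊎ g′ ≡ suc (g ℕ.+ g) → h′ ≡ h ℕ.+ h ⊎ h′ ≡ suc (h ℕ.+ h) →
               (g′ , h′) ∈ quarters (g , h)
  ∈-quarters g h (inj₁ refl) (inj₁ refl) = here refl
  ∈-quarters g h (inj₁ refl) (inj₂ refl) = there (here refl)
  ∈-quarters g h (inj₂ refl) (inj₁ refl) = there (there (here refl))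
  ∈-quarters g h (inj₂ refl) (inj₂ refl) = there (there (there (here refl)))

  iter-cong-< : ∀ {A : Set} {f g : ℕ → A → A} {z} m → (∀ {i} → i ℕ.< m → ∀ a → f i a ≡ g i a) → iter f z m ≡ iter g z m
  iter-cong-< zero    f≡g = refl
  iter-cong-< {g = g} (suc m) f≡g =
    trans (f≡g ℕ.≤-refl _) (cong (g m) (iter-cong-< m (λ i<m → f≡g (ℕ.m<n⇒m<1+n i<m))))

  then-branch : ∀ {A : Set} {b} {x y : A} → b ≡ true → (if b then x else y) ≡ x
  then-branch refl = refl

  else-branch : ∀ {A : Set} {b} {x y : A} → b ≡ false → (if b then x else y) ≡ y
  else-branch refl = refl

  iter-guarded : ∀ {A : Set} (f : ℕ → A → A) z {m n} → m ℕ.≤ n →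
                 iter (λ i a → if leᵇ (suc i) m then f i a else a) z n ≡ iter f z m
  iter-guarded f z {m} {zero}  z≤n = refl
  iter-guarded f z {m} {suc n} m≤1+n with m ℕ.≟ suc n
  ... | yes refl = trans (then-branch (leᵇ-true (ℕ.≤-refl {suc n})))
    (cong (f n) (iter-cong-< n (λ i<n a → then-branch (leᵇ-true (ℕ.m<n⇒m<1+n i<n)))))
  ... | no m≢1+n = trans (else-branch (leᵇ-false (ℕ.≤⇒≯ m≤n))) (iter-guarded f z m≤n)
    where m≤n = ℕ.≤-pred (ℕ.≤∧≢⇒< m≤1+n m≢1+n)

  argmin-ok : ∀ (ok : ℕ → Bool) (c : ℕ → ℝ) m → ok 0 ≡ true → ok (argmin ok c m) ≡ true
  argmin-ok ok c zero    ok0 = ok0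
  argmin-ok ok c (suc m) ok0 with ok m in okm | c m ≤? c (argmin ok c m)
  ... | true  | yes _ = okm
  ... | true  | no _  = argmin-ok ok c m ok0
  ... | false | _     = argmin-ok ok c m ok0

  argmin-minimal : ∀ (ok : ℕ → Bool) (c : ℕ → ℝ) m {v} → v ℕ.< m → ok v ≡ true → c (argmin ok c m) ≤ c v
  argmin-minimal ok c (suc m) {v} v<1+m okv with ok m in okm | c m ≤? c (argmin ok c m) | v ℕ.≟ m
  ... | true  | yes p | yes refl = ≤-refl
  ... | true  | yes p | no v≢m   = ≤-trans p (argmin-minimal ok c m (ℕ.≤∧≢⇒< (ℕ.≤-pred v<1+m) v≢m) okv)
  ... | true  | no ¬p | no v≢m   = argmin-minimal ok c m (ℕ.≤∧≢⇒< (ℕ.≤-pred v<1+m) v≢m) okv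
  ... | false | _     | no v≢m   = argmin-minimal ok c m (ℕ.≤∧≢⇒< (ℕ.≤-pred v<1+m) v≢m) okv
  ... | true  | no ¬p | yes refl = ≰⇒≥ ¬p
  ... | false | _     | yes refl = ⊥-elim (false≢true (trans (sym okm) okv))
    where
    false≢true : false ≢ true
    false≢true ()

  module Chosen (n k : ℕ) (X Y : ℕ → ℝ) (i j m : ℕ) where
    open Algorithm n k X Y
    open Order i j m using (σ)

    S : ℝ
    S = side i j

    open Bisection S

    0≤S : 0# ≤ S
    0≤S = +-nonNeg (0≤dist _ _) (0≤dist _ _)

    cellAt : ℕ → ℕ → Cell
    cellAt a v = code (offset X i j v) a , code (offset Y i j v) a

    opaque
      unfolding column

      cell≡cellAt : ∀ v → m ℕ.≤ n → Order.cell i j m v ≡ cellAt m v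
      cell≡cellAt v m≤n = cong₂ _,_ (index≡code (offset X i j v)) (index≡code (offset Y i j v))
        where
        position≡residue : ∀ z {a} → a ℕ.≤ n → position S z a ≡ residue z a
        position≡residue z a≤n = iter-guarded (λ _ y → bisect S y) z a≤n

        index≡code : ∀ z → index S z m ≡ code z m
        index≡code z = trans (iter-guarded (λ a g → digit S (position S z a) g) 0 m≤n)
          (iter-cong-< m (λ a<m g → cong (λ y → digit S y g)
            (position≡residue z (ℕ.≤-trans (ℕ.<⇒≤ a<m) m≤n))))

    Inside₂ : ℕ → Set
    Inside₂ v = Inside (offset X i j v) × Inside (offset Y i j v)

    opaque
      unfolding in-square

      in-square⇒Inside : ∀ v → in-square i j v ≡ true → Inside₂ v
      in-square⇒Inside v eq with ∧-true (within S (offset X i j v)) _ eq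
      ... | ex , ey with ∧-true ⌊ 0# ≤? offset X i j v ⌋ _ ex | ∧-true ⌊ 0# ≤? offset Y i j v ⌋ _ ey
      ... | a , b | c , d = (⌊⌋-witness (_ ≤? _) a , ⌊⌋-witness (_ ≤? _) b) ,
                            (⌊⌋-witness (_ ≤? _) c , ⌊⌋-witness (_ ≤? _) d)

      near⇒in-square : ∀ v → δ i v ≤ δ i j → in-square i j v ≡ true
      near⇒in-square v δ≤D = both (inside (proj₁ (near-dist _ _))) (inside (proj₂ (near-dist _ _)))
        where
        both : ∀ {a b} → a ≡ true → b ≡ true → (a ∧ b) ≡ true
        both refl refl = refl

        inside : ∀ {Z : ℕ → ℝ} → Near (δ i v) (Z i) (Z v) → within S (offset Z i j v) ≡ true
        inside {Z} (p , q) = both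
          (⌊⌋-true (_ ≤? _) (≤-by (+-nonNeg (0≤-diff p) (0≤-diff δ≤D))
            (solve 4 (λ d D x y → y :- x :+ D := con (ℤ.+ 0) :+ (y :+ d :- x :+ (D :- d))) refl (δ i v) (δ i j) (Z i) (Z v))))
          (⌊⌋-true (_ ≤? _) (≤-by (+-nonNeg (0≤-diff q) (0≤-diff δ≤D))
            (solve 4 (λ d D x y → D :+ D := y :- x :+ D :+ (x :+ d :- y :+ (D :- d))) refl (δ i v) (δ i j) (Z i) (Z v))))

    near-offset : ∀ Z {e v w} → Near e (offset Z i j v) (offset Z i j w) → Near e (Z v) (Z w)
    near-offset Z near = near-shift (- Z i) (near-shift (δ i j) near)

    -- The side of a cell at level `a` is `S / 2^a`, the `e` below; `dist≤` doubles it.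
    δ-bound : ∀ a {v w} → Inside₂ v → Inside₂ w → cellAt a v ≡ cellAt a w → pow a * δ v w ≤ S + S
    δ-bound a {v} {w} (vx , vy) (wx , wy) eq =
      ≤-trans (*-monoˡ-≤ (pow-nonNeg a) (dist≤ _ _ 0≤e (near X vx wx (cong proj₁ eq) , near Y vy wy (cong proj₂ eq))))
        (≤-reflexive (trans (distribˡ (pow a) e e) (cong₂ _+_ pe≡S pe≡S)))
      where
      e = pow a ⁻¹ * S
      pe≡S : pow a * e ≡ S
      pe≡S = trans (sym (*-assoc _ _ _)) (trans (cong (_* S) (⁻¹-inverseʳ (pow a) (pow-≢0 a))) (*-identityˡ S))
      0≤e : 0# ≤ e
      0≤e = *-cancelˡ-≤ (pow-nonNeg a) (pow-≢0 a) (subst₂ _≤_ (sym (zeroʳ (pow a))) (sym pe≡S) 0≤S)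
      near : ∀ Z → Inside (offset Z i j v) → Inside (offset Z i j w) →
             code (offset Z i j v) a ≡ code (offset Z i j w) a → Near e (Z v) (Z w)
      near Z hv hw eq = near-offset Z (near-unscale (pow-nonNeg a) (pow-≢0 a)
        (subst (λ z → Near z (pow a * offset Z i j v) (pow a * offset Z i j w)) (sym pe≡S) (same-code⇒near a hv hw eq)))

    -- The order `σ` is fixed by the grid of level `m`, but cells are counted at every level, also
    -- at levels finer than `m`.
    open Levels _≟ᶜ_ (λ a r → cellAt a (σ r)) public
    open Refining (λ c → ⌊ proj₁ c /2⌋ , ⌊ proj₂ c /2⌋) quarters (0 , 0) (λ _ → refl)
      (λ a r → cong₂ _,_ (code-parent (offset X i j (σ r)) a) (code-parent (offset Y i j (σ r)) a))
      (λ a r → ∈-quarters (code (offset X i j (σ r)) a) (code (offset Y i j (σ r)) a)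
                          (code-child (offset X i j (σ r)) a) (code-child (offset Y i j (σ r)) a))
      (λ _ → refl) public

    gap : ℕ → ℝ
    gap r = δ (σ r) (σ (nearest i j m r))

    opaque
      unfolding nearest

      nearest-< : ∀ {r} → 1 ℕ.≤ r → nearest i j m r ℕ.< r
      nearest-< {r} 1≤r = leᵇ⇒≤ (argmin-ok (λ s → leᵇ (suc s) r) (λ s → δ (σ r) (σ s)) n (leᵇ-true 1≤r))

      gap-minimal : ∀ {r s} → r ℕ.< n → s ℕ.< r → gap r ≤ δ (σ r) (σ s)
      gap-minimal {r} {s} r<n s<r = argmin-minimal (λ s → leᵇ (suc s) r) (λ s → δ (σ r) (σ s)) n
        (ℕ.<-trans s<r r<n) (leᵇ-true s<r)

    partial : ℕ → ℝ
    partial = iter (λ r c → c + step-cost i j m r) 0#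

    step-cost-zero : step-cost i j m 0 ≡ 0#
    step-cost-zero = else-branch (cong (_∧ leᵇ 1 k) (leᵇ-false {1} {0} λ ()))

    step-cost-gap : ∀ r → suc r ℕ.< k → step-cost i j m (suc r) ≡ gap (suc r)
    step-cost-gap r r<k = then-branch (cong₂ _∧_ (leᵇ-true {1} {suc r} (s≤s z≤n)) (leᵇ-true r<k))

    partial-beyond : ∀ d → partial (d ℕ.+ k) ≡ partial k
    partial-beyond zero    = refl
    partial-beyond (suc d) = trans (cong (partial (d ℕ.+ k) +_) (else-branch (beyond (leᵇ 1 (d ℕ.+ k)))))
      (trans (+-identityʳ _) (partial-beyond d))
      where
      beyond : ∀ b → b ∧ leᵇ (suc (d ℕ.+ k)) k ≡ false
      beyond true  = leᵇ-false (ℕ.<⇒≱ (s≤s (ℕ.m≤n+m k d)))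
      beyond false = refl

    opaque
      unfolding cost

      cost≡partial : k ℕ.≤ n → cost i j m ≡ partial k
      cost≡partial k≤n = trans (cong partial (sym (ℕ.m∸n+n≡m k≤n))) (partial-beyond (n ∸ k))

    module _ (k≤n : k ℕ.≤ n) (all-inside : ∀ {r} → r ℕ.< k → Inside₂ (σ r)) where

      2S = S + S

      0≤2S : 0# ≤ 2S
      0≤2S = +-nonNeg 0≤S 0≤S

      close-gap : ∀ a {r s} → r ℕ.< k → s ℕ.< r → cellAt a (σ r) ≡ cellAt a (σ s) → pow a * gap r ≤ 2S
      close-gap a r<k s<r eq = ≤-trans
        (*-monoˡ-≤ (pow-nonNeg a) (gap-minimal (ℕ.<-≤-trans r<k k≤n) s<r))
        (δ-bound a (all-inside r<k) (all-inside (ℕ.<-trans s<r r<k)) eq)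

      2S≤ : ∀ x → 2S ≤ fromℕ (1 ℕ.+ x) * 2S
      2S≤ x = ≤-by (*-nonNeg (0≤fromℕ x) 0≤2S) (fromℕ-suc-* x 2S)

      gap-bound : ∀ B {r} → 1 ℕ.≤ r → r ℕ.< k → pow B * gap r ≤ fromℕ (1 ℕ.+ E B r) * 2S
      gap-bound zero    1≤r r<k = ≤-trans (close-gap 0 r<k (nearest-< 1≤r) refl) (2S≤ 0)
      gap-bound (suc B) {r} 1≤r r<k with DecMembership._∈?_ _≟ᶜ_ (cellAt (suc B) (σ r)) (occupied (suc B) r)
      ... | yes old with ∈-occupied⁻ (suc B) r old
      ... | s , s<r , eq = ≤-trans (close-gap (suc B) r<k s<r eq) (2S≤ (2 ℕ.* E B r ℕ.+ 0))
      -- A fresh cell gives no new neighbour, so the coarser bound is doubled: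
      -- `2 (1 + E) = 1 + (2 E + 1)`, and the last 1 is the freshness indicator.
      gap-bound (suc B) {r} 1≤r r<k | no fresh =
        ≤-trans (≤-reflexive (pow-suc B (gap r)))
        (≤-trans (+-mono-≤ (gap-bound B 1≤r r<k) (gap-bound B 1≤r r<k))
        (≤-reflexive (trans (sym (distribʳ 2S _ _)) (cong (_* 2S)
          (trans (sym (fromℕ-+ (1 ℕ.+ E B r) (1 ℕ.+ E B r))) (cong fromℕ (twice (E B r))))))))
        where
        twice : ∀ x → (1 ℕ.+ x) ℕ.+ (1 ℕ.+ x) ≡ 1 ℕ.+ (2 ℕ.* x ℕ.+ 1)
        twice = solve-∀

      step-cost-bound : ∀ B r → r ℕ.< k → pow B * step-cost i j m r ≤ fromℕ (1 ℕ.+ E B r) * 2S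
      step-cost-bound B zero r<k = ≤-trans (≤-reflexive (trans (cong (pow B *_) step-cost-zero) (zeroʳ _)))
        (*-nonNeg (0≤fromℕ (1 ℕ.+ E B 0)) 0≤2S)
      step-cost-bound B (suc r) r<k = ≤-trans (≤-reflexive (cong (pow B *_) (step-cost-gap r r<k)))
        (gap-bound B (s≤s z≤n) r<k)

      partial-bound : ∀ B t → t ℕ.≤ k → pow B * partial t ≤ fromℕ (t ℕ.+ Tot B t) * 2S
      partial-bound B zero    _   = ≤-reflexive (trans (zeroʳ _) (sym (zeroˡ _)))
      partial-bound B (suc t) t<k = ≤-trans (≤-reflexive (distribˡ _ _ _))
        (≤-trans (+-mono-≤ (partial-bound B t (ℕ.<⇒≤ t<k)) (step-cost-bound B t t<k))
        (≤-reflexive (trans (sym (distribʳ 2S _ _)) (cong (_* 2S)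
          (trans (sym (fromℕ-+ (t ℕ.+ Tot B t) _)) (cong fromℕ (shuffle t (Tot B t) (E B t))))))))
        where
        shuffle : ∀ t x e → t ℕ.+ x ℕ.+ (1 ℕ.+ e) ≡ suc t ℕ.+ (x ℕ.+ e)
        shuffle = solve-∀

      cost-bound : ∀ B → pow B * cost i j m ≤ fromℕ (k ℕ.+ Tot B k) * 2S
      cost-bound B = subst (λ x → pow B * x ≤ fromℕ (k ℕ.+ Tot B k) * 2S) (sym (cost≡partial k≤n))
        (partial-bound B k ℕ.≤-refl)

-- Choice of the scale, the ratio and the output tree.

module Approximation (R : RealNumbers) where
  open RealNumbers R
  open Plane R
  open RealArithmetic R
  open TreeTours R
  open LoopLanguage R
  open GridAlgorithm R
  open GridAnalysis R
  open Combinatorics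
  open RootedTrees
  open import Data.Fin using (Fin; zero; suc; toℕ; fromℕ<)

  power-bracket : ∀ m k → 1 ℕ.≤ k → k ℕ.< 16 ℕ.^ m → ∃[ b ] 16 ℕ.^ b ℕ.≤ k × k ℕ.≤ 16 ℕ.* 16 ℕ.^ b
  power-bracket zero    k 1≤k k<1 = ⊥-elim (ℕ.<⇒≱ k<1 1≤k)
  power-bracket (suc m) k 1≤k k<  with 16 ℕ.^ m ℕ.≤? k
  ... | yes p = m , p , ℕ.<⇒≤ k<
  ... | no ¬p = power-bracket m k 1≤k (ℕ.≰⇒> ¬p)

  -- The double `n + n` serves two purposes: level `2b` is in the searched range below `n`, and
  -- `k < 16^k` starts the search for `b`.
  n<16^n : ∀ n → n ℕ.+ n ℕ.< 16 ℕ.^ n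
  n<16^n zero    = s≤s z≤n
  n<16^n (suc n) = begin-strict
    suc n ℕ.+ suc n                           ≡⟨ cong suc (ℕ.+-suc n n) ⟩
    2 ℕ.+ (n ℕ.+ n)                           <⟨ ℕ.+-monoʳ-< 2 (n<16^n n) ⟩
    2 ℕ.+ 16 ℕ.^ n                            ≤⟨ ℕ.+-monoˡ-≤ (16 ℕ.^ n) (ℕ.*-monoʳ-≤ 2 (ℕ.m^n>0 16 n)) ⟩
    2 ℕ.* 16 ℕ.^ n ℕ.+ 16 ℕ.^ n               ≤⟨ ℕ.m≤m+n _ (13 ℕ.* 16 ℕ.^ n) ⟩
    2 ℕ.* 16 ℕ.^ n ℕ.+ 16 ℕ.^ n ℕ.+ 13 ℕ.* 16 ℕ.^ n ≡⟨ shuffle (16 ℕ.^ n) ⟩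
    16 ℕ.* 16 ℕ.^ n                           ∎
    where
    open ℕ.≤-Reasoning
    shuffle : ∀ x → 2 ℕ.* x ℕ.+ x ℕ.+ 13 ℕ.* x ≡ 16 ℕ.* x
    shuffle = solve-∀

  16^≡2^⁴ : ∀ b → 16 ℕ.^ b ≡ 2 ℕ.^ b ℕ.* 2 ℕ.^ b ℕ.* (2 ℕ.^ b ℕ.* 2 ℕ.^ b)
  16^≡2^⁴ zero    = refl
  16^≡2^⁴ (suc b) = trans (cong (16 ℕ.*_) (16^≡2^⁴ b)) (shuffle (2 ℕ.^ b))
    where
    shuffle : ∀ x → 16 ℕ.* (x ℕ.* x ℕ.* (x ℕ.* x)) ≡ 2 ℕ.* x ℕ.* (2 ℕ.* x) ℕ.* (2 ℕ.* x ℕ.* (2 ℕ.* x))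
    shuffle = solve-∀

  -- Contains every g′ with |g − g′| ≤ 2; truncated subtraction only adds repetitions of 0.
  around : ℕ → List ℕ
  around g = map (λ e → g ℕ.+ e ∸ 2) (upTo 5)

  ∈-around : ∀ {g g′} → g ℕ.≤ 2 ℕ.+ g′ → g′ ℕ.≤ 2 ℕ.+ g → g′ ∈ around g
  ∈-around {g} {g′} g≤ g′≤ = subst (_∈ around g) (cong (_∸ 2) (ℕ.m+[n∸m]≡n g≤))
    (∈-map⁺ (λ e → g ℕ.+ e ∸ 2) (∈-upTo⁺ (s≤s (ℕ.m≤n+o⇒m∸n≤o (2 ℕ.+ g′) g
      (subst (2 ℕ.+ g′ ℕ.≤_) (ℕ.+-comm 4 g) (s≤s (s≤s g′≤)))))))

  block : Cell → List Cell
  block (g , h) = concatMap (λ a → map (a ,_) (around h)) (around g)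

  length-block : ∀ c → length (block c) ℕ.≤ 25
  length-block c = ℕ.≤-refl

  ∈-block : ∀ g h {g′ h′} → g′ ∈ around g → h′ ∈ around h → (g′ , h′) ∈ block (g , h)
  ∈-block g h {g′} g′∈ h′∈ = ∈-concatMap (λ a → map (a ,_) (around h)) g′∈ (∈-map⁺ (g′ ,_) h′∈)

  -- Here `x` stands for `q³` times the cost. The lone `S` in the bound on `t * S` is absorbed into
  -- `Q * S` by `1 ≤ Q`, and then `S ≤ E * L` turns everything into multiples of `q⁴ L`.
  combine : ∀ {A B F E q t S L x} → let Q = q * q in
    0# ≤ A → 0# ≤ B → 0# ≤ F → 1# ≤ Q → 0# ≤ S →
    x ≤ (A * (Q * Q) + B * (Q * t)) * (S + S) → t * S ≤ F * (S + Q * (L + L)) → S ≤ E * L →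
    x ≤ q * Q * (((A + A + (B + B) * F) * E + (B + B) * (F + F)) * q * L)
  combine {A} {B} {F} {E} {q} {t} {S} {L} {x} 0≤A 0≤B 0≤F 1≤Q 0≤S x≤ tS≤ S≤EL =
    ≤-trans x≤ (≤-trans (≤-reflexive
      (solve 5 (λ A B Q t S → (A :* (Q :* Q) :+ B :* (Q :* t)) :* (S :+ S) :=
                              (A :+ A) :* (Q :* Q) :* S :+ (B :+ B) :* Q :* (t :* S)) refl A B Q t S))
    (≤-trans (+-monoʳ-≤ _ (*-monoˡ-≤ (*-nonNeg 0≤2B 0≤Q) (≤-trans tS≤
      (*-monoˡ-≤ 0≤F (+-mono-≤ S≤QS ≤-refl)))))
    (≤-trans (≤-reflexive
      (solve 6 (λ A B F Q S L → (A :+ A) :* (Q :* Q) :* S :+ (B :+ B) :* Q :* (F :* (Q :* S :+ Q :* (L :+ L))) :=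
                (A :+ A :+ (B :+ B) :* F) :* (Q :* Q) :* S :+ (B :+ B) :* F :* (Q :* Q) :* (L :+ L)) refl A B F Q S L))
    (≤-trans (+-mono-≤ (*-monoˡ-≤ (*-nonNeg (+-nonNeg (+-nonNeg 0≤A 0≤A) (*-nonNeg 0≤2B 0≤F)) (*-nonNeg 0≤Q 0≤Q)) S≤EL) ≤-refl)
    (≤-reflexive
      (solve 6 (λ A B F E q L → (A :+ A :+ (B :+ B) :* F) :* (q :* q :* (q :* q)) :* (E :* L) :+
                                (B :+ B) :* F :* (q :* q :* (q :* q)) :* (L :+ L) :=
                q :* (q :* q) :* (((A :+ A :+ (B :+ B) :* F) :* E :+ (B :+ B) :* (F :+ F)) :* q :* L)) refl A B F E q L))))))
    where
    Q = q * q
    0≤Q = 0≤x² q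
    0≤2B = +-nonNeg 0≤B 0≤B
    S≤QS : S ≤ Q * S
    S≤QS = ≤-trans (≤-reflexive (sym (*-identityˡ S))) (*-monoʳ-≤ 0≤S 1≤Q)

  -- = 1788
  ratio : ℝ
  ratio = (A + A + (B + B) * F) * fromℕ 8 + (B + B) * (F + F)
    where
    A = fromℕ 18
    B = fromℕ 3
    F = fromℕ 25

  0≤ratio : 0# ≤ ratio
  0≤ratio = +-nonNeg (*-nonNeg (+-nonNeg (+-nonNeg (0≤fromℕ 18) (0≤fromℕ 18)) (*-nonNeg 0≤2B (0≤fromℕ 25))) (0≤fromℕ 8))
    (*-nonNeg 0≤2B (+-nonNeg (0≤fromℕ 25) (0≤fromℕ 25)))
    where 0≤2B = +-nonNeg (0≤fromℕ 3) (0≤fromℕ 3)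

  array-toℕ : ∀ {A : Set} {z : A} {n} (v : Vector A n) i → array z v (toℕ i) ≡ v i
  array-toℕ v zero    = refl
  array-toℕ v (suc i) = array-toℕ (v ∘ suc) i

  runningTime : ℕ → ℕ
  runningTime = writeTreeTime (at-best flagᵗ) (at-best childᵗ) (at-best parentᵗ)

  runningTime-polynomial : PolyBounded runningTime
  runningTime-polynomial = poly-writeTree (at-best flagᵗ) (at-best childᵗ) (at-best parentᵗ)

  module Instance {n : ℕ} (p : Vector Point n) (k′ : ℕ) (k≤n : suc k′ ℕ.≤ n) where
    k = suc k′
    X = array 0# (proj₁ ∘ p)
    Y = array 0# (proj₂ ∘ p)
    open Algorithm n k X Y

    -- The points as the program reads them from memory. They agree with `p` only pointwise, so
    -- geometry is done with `p₀` and lengths are carried over by `length-p₀`.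
    p₀ : Vector Point n
    p₀ v = X (toℕ v) , Y (toℕ v)

    p₀≡p : ∀ v → p₀ v ≡ p v
    p₀≡p v = cong₂ _,_ (array-toℕ (proj₁ ∘ p) v) (array-toℕ (proj₂ ∘ p) v)

    length-p₀ : ∀ G → totalLength p G ≡ totalLength p₀ G
    length-p₀ G = sum-cong (λ e → sym (cong₂ dist (p₀≡p (proj₁ (Graph.edge G e))) (p₀≡p (proj₂ (Graph.edge G e)))))

    module _ (T* : Graph n) (spanning : IsTreeSpanning k T*) where
      open IsTreeSpanning spanning
      open Graph T*
      open Tours p₀ using (Skeleton; skeleton; Close; 0≤L)
      open Skeleton (skeleton T* isTree) hiding (S)

      i = toℕ centre
      j = toℕ rim
      L = totalLength p₀ T*

      O : List ℕ
      O = map toℕ (elements vertices)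

      O-unique : Unique O
      O-unique = Unique.map⁺ Fin.toℕ-injective (elements-unique vertices)

      k≤O : k ℕ.≤ length O
      k≤O = ℕ.≤-reflexive (sym (trans (length-map toℕ (elements vertices)) (trans (length-elements vertices) size)))

      vertex-inside : ∀ {v} → v ∈ₛ vertices → in-square i j (toℕ v) ≡ true
      -- The square does not depend on the grid level, so level 0 stands for any.
      vertex-inside {v} v∈ = Chosen.near⇒in-square n k X Y i j 0 (toℕ v) (radius v∈)

      O-inside : ∀ {v} → v ∈ O → v ℕ.< n × in-square i j v ≡ true
      O-inside v∈ with ∈-map⁻ toℕ v∈
      ... | w , w∈ , refl = Fin.toℕ<n w , vertex-inside (∈-elements⁻ vertices w∈)

      module AtLevel (m : ℕ) (m≤n : m ℕ.≤ n) where
        open Chosen n k X Y i j m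
        open Bisection S using (near⇒code≤)
        open Order i j m using (σ; cell; σ-inside; densest-cells-≤)

        inside : ∀ {r} → r ℕ.< k → Inside₂ (σ r)
        inside {r} r<k = in-square⇒Inside (σ r) (σ-inside O-unique O-inside k≤O k≤n r<k)

        cells-≤ : ∀ {CO} → Unique CO → (∀ {v} → v ∈ O → cellAt m v ∈ CO) → N m k ℕ.≤ length CO
        cells-≤ {CO} CO-unique O⊆CO = densest-cells-≤ {k′} {O} {CO} {occupied m k}
          k≤n O-unique O-inside k≤O CO-unique
          (λ {v} v∈ → subst (_∈ CO) (sym (cell≡cellAt v m≤n)) (O⊆CO v∈))
          (occupied-unique m k) (λ c∈ → index-of (∈-occupied⁻ m k c∈))
          (λ {r} r≤k′ → subst (_∈ occupied m k) (sym (cell≡cellAt (σ r) m≤n)) (∈-occupied⁺ m (s≤s r≤k′)))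
          where
          index-of : ∀ {c} → ∃[ r ] r ℕ.< k × c ≡ cellAt m (σ r) → ∃[ r ] r ℕ.≤ k′ × c ≡ cell (σ r)
          index-of (r , s≤s r≤k′ , eq) = r , r≤k′ , trans eq (sym (cell≡cellAt (σ r) m≤n))

        adjacent : S ≢ 0# → ∀ {a v} → a ∈ₛ vertices → v ∈ₛ vertices → Close (pow m) S a v →
                   cellAt m (toℕ v) ∈ block (cellAt m (toℕ a))
        adjacent S≢0 {a} {v} a∈ v∈ (e , pe≤S , nearX , nearY) =
          ∈-block (code (offset X i j (toℕ a)) m) (code (offset Y i j (toℕ a)) m)
            (coordinate X (proj₁ a-in) (proj₁ v-in) nearX)
            (coordinate Y (proj₂ a-in) (proj₂ v-in) nearY)
          where
          a-in = in-square⇒Inside (toℕ a) (vertex-inside a∈)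
          v-in = in-square⇒Inside (toℕ v) (vertex-inside v∈)
          open Bisection S using (Inside; code)
          coordinate : ∀ Z → Inside (offset Z i j (toℕ a)) → Inside (offset Z i j (toℕ v)) →
                       Near e (Z (toℕ a)) (Z (toℕ v)) →
                       code (offset Z i j (toℕ v)) m ∈ around (code (offset Z i j (toℕ a)) m)
          coordinate Z ha hv near = ∈-around
            (near⇒code≤ m S≢0 0≤S ha hv pe≤S shifted) (near⇒code≤ m S≢0 0≤S hv ha pe≤S (near-sym shifted))
            where shifted = near-shift⁺ (δ i j) (near-shift⁺ (- Z i) near)

        Covering : List (Fin n) → Set
        Covering as = (∀ {v} → v ∈ₛ vertices → ∃[ a ] a ∈ as × Close (pow m) S a v) ×
                      (∀ {a} → a ∈ as → a ∈ₛ vertices) ×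
                      fromℕ (length as) * S ≤ S + pow m * (L + L)

        -- The cells in the blocks around the anchors contain all vertices of the optimal tree.
        -- Duplicates are removed because the comparison with the densest points counts distinct
        -- cells.
        cells-near-anchors : S ≢ 0# → ∀ {as} → Covering as → N m k ℕ.≤ 25 ℕ.* length as
        cells-near-anchors S≢0 {as} (close , as⊆ , _) =
          ℕ.≤-trans (cells-≤ (deduplicate-! _≟ᶜ_ nearby) O⊆nearby) length-nearby
          where
          anchor-cells = map (λ a → cellAt m (toℕ a)) as
          nearby = concatMap block anchor-cells

          length-nearby : length (deduplicate _≟ᶜ_ nearby) ℕ.≤ 25 ℕ.* length as
          length-nearby = ℕ.≤-trans (length-deduplicate _≟ᶜ_ nearby)
            (subst (λ l → length nearby ℕ.≤ 25 ℕ.* l) (length-map (λ a → cellAt m (toℕ a)) as)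
              (length-concatMap-≤ block 25 length-block anchor-cells))

          near-anchor : ∀ {v} → v ∈ₛ vertices → ∃[ a ] a ∈ as × Close (pow m) S a v → cellAt m (toℕ v) ∈ nearby
          near-anchor v∈ (a , a∈ , v-close) = ∈-concatMap block (∈-map⁺ (λ a → cellAt m (toℕ a)) a∈)
            (adjacent S≢0 (as⊆ a∈) v∈ v-close)

          from-vertex : ∀ {v} → ∃[ w ] w ∈ elements vertices × v ≡ toℕ w → cellAt m v ∈ nearby
          from-vertex (w , w∈ , refl) = near-anchor w∈V (close w∈V)
            where w∈V = ∈-elements⁻ vertices w∈

          O⊆nearby : ∀ {v} → v ∈ O → cellAt m v ∈ deduplicate _≟ᶜ_ nearby
          O⊆nearby v∈ = ∈-deduplicate⁺ _≟ᶜ_ (from-vertex (∈-map⁻ toℕ v∈))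

        few-cells : fromℕ (N m k) * S ≤ fromℕ 25 * (S + pow m * (L + L))
        few-cells = bound (IsDecTotalOrder._≟_ isDecTotalOrder S 0#) (covering (pow m) (pow-nonNeg m))
          where
          0≤L* = 0≤L T* isTree
          bound : Dec (S ≡ 0#) → ∃[ as ] Covering as → fromℕ (N m k) * S ≤ fromℕ 25 * (S + pow m * (L + L))
          -- All vertices of the optimal tree coincide; the cells are then degenerate, but the left
          -- side is 0.
          bound (yes S≡0) _ = ≤-trans (≤-reflexive (trans (cong (fromℕ (N m k) *_) S≡0) (zeroʳ _)))
            (*-nonNeg (0≤fromℕ 25) (+-nonNeg 0≤S (*-nonNeg (pow-nonNeg m) (+-nonNeg 0≤L* 0≤L*))))
          bound (no S≢0) (as , cover) =
            ≤-trans (*-monoʳ-≤ 0≤S (fromℕ-mono (cells-near-anchors S≢0 cover)))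
            (≤-trans (≤-reflexive (trans (cong (_* S) (fromℕ-* 25 (length as))) (*-assoc (fromℕ 25) (fromℕ (length as)) S)))
            (*-monoˡ-≤ (0≤fromℕ 25) (proj₂ (proj₂ cover))))

      module AtScale (b : ℕ) (16^b≤k : 16 ℕ.^ b ℕ.≤ k) (k≤16^1+b : k ℕ.≤ 16 ℕ.* 16 ℕ.^ b) where
        m = b ℕ.+ b
        -- At this level `2^B = q³`, so the summand `k ≤ 16 q⁴` costs only `16 q` after division.
        B = b ℕ.+ (b ℕ.+ b)
        m<n : m ℕ.< n
        m<n = ℕ.<-≤-trans (n<16^n b) (ℕ.≤-trans 16^b≤k k≤n)
        open Chosen n k X Y i j m
        open AtLevel m (ℕ.<⇒≤ m<n)
        2^b = 2 ℕ.^ b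
        q = pow b
        Q = q * q
        t = N m k

        powm : pow m ≡ Q
        powm = trans (cong fromℕ (ℕ.^-distribˡ-+-* 2 b b)) (fromℕ-* 2^b 2^b)

        powB : pow B ≡ q * Q
        powB = trans (cong fromℕ (ℕ.^-distribˡ-+-* 2 b m)) (trans (fromℕ-* 2^b (2 ℕ.^ m)) (cong (q *_) powm))

        Q⁴ : fromℕ (2^b ℕ.* 2^b ℕ.* (2^b ℕ.* 2^b)) ≡ Q * Q
        Q⁴ = trans (fromℕ-* (2^b ℕ.* 2^b) _) (cong₂ _*_ (fromℕ-* 2^b 2^b) (fromℕ-* 2^b 2^b))

        -- The 18 is 16 from `k ≤ 16 q⁴` plus 2 from `Tot-three-scales`, which also gives the 3.
        weight : k ℕ.+ Tot B k ℕ.≤ 18 ℕ.* (2^b ℕ.* 2^b ℕ.* (2^b ℕ.* 2^b)) ℕ.+ 3 ℕ.* (2^b ℕ.* 2^b ℕ.* t)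
        weight = ℕ.≤-trans (ℕ.+-mono-≤ (ℕ.≤-trans k≤16^1+b (ℕ.≤-reflexive (cong (16 ℕ.*_) (16^≡2^⁴ b))))
                                       (Tot-three-scales b k))
          (ℕ.≤-reflexive (shuffle (2^b ℕ.* 2^b ℕ.* (2^b ℕ.* 2^b)) (2^b ℕ.* 2^b ℕ.* t)))
          where
          shuffle : ∀ x y → 16 ℕ.* x ℕ.+ (2 ℕ.* x ℕ.+ 3 ℕ.* y) ≡ 18 ℕ.* x ℕ.+ 3 ℕ.* y
          shuffle = solve-∀

        weightᴿ : fromℕ (k ℕ.+ Tot B k) ≤ fromℕ 18 * (Q * Q) + fromℕ 3 * (Q * fromℕ t)
        weightᴿ = ≤-trans (fromℕ-mono weight) (≤-reflexive (trans (fromℕ-+ (18 ℕ.* (2^b ℕ.* 2^b ℕ.* (2^b ℕ.* 2^b))) _)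
          (cong₂ _+_ (trans (fromℕ-* 18 (2^b ℕ.* 2^b ℕ.* (2^b ℕ.* 2^b))) (cong (fromℕ 18 *_) Q⁴))
                     (trans (fromℕ-* 3 (2^b ℕ.* 2^b ℕ.* t)) (cong (fromℕ 3 *_)
                       (trans (fromℕ-* (2^b ℕ.* 2^b) t) (cong (_* fromℕ t) (fromℕ-* 2^b 2^b))))))))

        bound : pow B * cost i j m ≤ q * Q * (ratio * q * L)
        bound = combine {fromℕ 18} {fromℕ 3} {fromℕ 25} {fromℕ 8} {q} {fromℕ t} {S} {L}
          (0≤fromℕ 18) (0≤fromℕ 3) (0≤fromℕ 25)
          (subst (1# ≤_) powm (1≤fromℕ (ℕ.m^n>0 2 m))) 0≤S
          (≤-trans (cost-bound k≤n inside B) (*-monoʳ-≤ (+-nonNeg 0≤S 0≤S) weightᴿ))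
          (subst (λ z → fromℕ t * S ≤ fromℕ 25 * (S + z * (L + L))) powm few-cells) S≤8L

        q≤ : q ≤ √ (√ (fromℕ k))
        q≤ = ≤-√ (√-nonNeg _) (≤-√ (0≤fromℕ k) (≤-trans (≤-reflexive (sym Q⁴))
          (fromℕ-mono (subst (ℕ._≤ k) (16^≡2^⁴ b) 16^b≤k))))

        cost≤ : cost i j m ≤ ratio * √ (√ (fromℕ k)) * L
        cost≤ = ≤-trans
          (*-cancelˡ-≤ (pow-nonNeg B) (pow-≢0 B)
            (subst (λ z → pow B * cost i j m ≤ z * (ratio * q * L)) (sym powB) bound))
          (*-monoʳ-≤ (0≤L T* isTree) (*-monoˡ-≤ 0≤ratio q≤))

      good-candidate : ∃[ m ] m ℕ.< n × cost i j m ≤ ratio * √ (√ (fromℕ k)) * L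
      good-candidate = at-scale (power-bracket k k (s≤s z≤n) (ℕ.≤-<-trans (ℕ.m≤m+n k k) (n<16^n k)))
        where
        at-scale : ∃[ b ] 16 ℕ.^ b ℕ.≤ k × k ℕ.≤ 16 ℕ.* 16 ℕ.^ b →
                   ∃[ m ] m ℕ.< n × cost i j m ≤ ratio * √ (√ (fromℕ k)) * L
        at-scale (b , lower , upper) = b ℕ.+ b , AtScale.m<n b lower upper , AtScale.cost≤ b lower upper

      i<n : i ℕ.< n
      i<n = Fin.toℕ<n centre

      j<n : j ℕ.< n
      j<n = Fin.toℕ<n rim

    best : ℝ
    best = cost best-i (best-j best-i) (best-m best-i (best-j best-i))

    opaque
      unfolding best-i best-j best-m

      best-minimal : ∀ {i j m} → i ℕ.< n → j ℕ.< n → m ℕ.< n → best ≤ cost i j m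
      best-minimal {i} {j} {m} i<n j<n m<n =
        ≤-trans (argmin-minimal (λ _ → true) (λ i → cost i (best-j i) (best-m i (best-j i))) n i<n refl)
        (≤-trans (argmin-minimal (λ _ → true) (λ j → cost i j (best-m i j)) n j<n refl)
        (argmin-minimal (λ _ → true) (cost i j) n m<n refl))

    best-ratio : ∀ T* → IsTreeSpanning k T* → best ≤ ratio * √ (√ (fromℕ k)) * totalLength p T*
    best-ratio T* spanning = subst (λ z → best ≤ ratio * √ (√ (fromℕ k)) * z) (sym (length-p₀ T*))
      (≤-trans (best-minimal (i<n T* spanning) (j<n T* spanning) (proj₁ (proj₂ candidate))) (proj₂ (proj₂ candidate)))
      where candidate = good-candidate T* spanning

    -- The tree described by the ranks.

    module Built (i j m : ℕ) where
      open Chosen n k X Y i j m using (nearest-<; gap; step-cost-zero; step-cost-gap; cost≡partial; partial)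
      open Order i j m using (σ; rank; σ<n; σ-injective; rank-σ; σ-rank)

      r<n : (r : Fin k) → toℕ r ℕ.< n
      r<n r = ℕ.<-≤-trans (Fin.toℕ<n r) k≤n

      node : Fin k → Fin n
      node r = fromℕ< (σ<n (r<n r))

      toℕ-node : ∀ r → toℕ (node r) ≡ σ (toℕ r)
      toℕ-node r = Fin.toℕ-fromℕ< (σ<n (r<n r))

      node-injective : ∀ {r s} → node r ≡ node s → r ≡ s
      node-injective {r} {s} eq = Fin.toℕ-injective (σ-injective (r<n r) (r<n s)
        (trans (sym (toℕ-node r)) (trans (cong toℕ eq) (toℕ-node s))))

      parent-bound : ∀ (e : Fin k′) → nearest i j m (suc (toℕ e)) ℕ.< k
      parent-bound e = ℕ.<-trans (nearest-< (s≤s z≤n)) (s≤s (Fin.toℕ<n e))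

      parent : Fin k′ → Fin k
      parent e = fromℕ< (parent-bound e)

      toℕ-parent : ∀ e → toℕ (parent e) ≡ nearest i j m (suc (toℕ e))
      toℕ-parent e = Fin.toℕ-fromℕ< (parent-bound e)

      parent≤ : ∀ e → toℕ (parent e) ℕ.≤ toℕ e
      parent≤ e = subst (ℕ._≤ toℕ e) (sym (toℕ-parent e)) (ℕ.≤-pred (nearest-< (s≤s z≤n)))

      chosen : ℕ → Bool
      chosen v = leᵇ (suc (rank v)) k

      vertices : Subset n
      vertices = tabulate (chosen ∘ toℕ)

      ∈⇒chosen : ∀ {v} → v ∈ₛ vertices → chosen (toℕ v) ≡ true
      ∈⇒chosen {v} v∈ = trans (sym (lookup∘tabulate (chosen ∘ toℕ) v)) ([]=⇒lookup v∈)

      chosen⇒∈ : ∀ {v} → chosen (toℕ v) ≡ true → v ∈ₛ vertices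
      chosen⇒∈ {v} eq = lookup⇒[]= v vertices (trans (lookup∘tabulate (chosen ∘ toℕ) v) eq)

      node∈ : ∀ r → node r ∈ₛ vertices
      node∈ r = chosen⇒∈ (leᵇ-true (subst (ℕ._< k)
        (sym (trans (cong rank (toℕ-node r)) (rank-σ (r<n r)))) (Fin.toℕ<n r)))

      ∈⇒node : ∀ {v} → v ∈ₛ vertices → ∃[ r ] v ≡ node r
      ∈⇒node {v} v∈ = fromℕ< rank<k , Fin.toℕ-injective (sym (trans (toℕ-node (fromℕ< rank<k))
        (trans (cong σ (Fin.toℕ-fromℕ< rank<k)) (σ-rank (Fin.toℕ<n v)))))
        where
        rank<k : rank (toℕ v) ℕ.< k
        rank<k = leᵇ⇒≤ (∈⇒chosen v∈)

      open Rooted node node-injective parent parent≤ vertices node∈ ∈⇒node public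
        using (graph; isTree; size)

      -- `iter` adds its terms at the end and `sum` at the front; moving the first term forward
      -- reconciles them.
      iter-front : ∀ (f : ℕ → ℝ) t → iter (λ r c → c + f r) 0# (suc t) ≡ f 0 + iter (λ r c → c + f (suc r)) 0# t
      iter-front f zero    = +-comm 0# (f 0)
      iter-front f (suc t) = trans (cong (_+ f (suc t)) (iter-front f t)) (+-assoc _ _ _)

      iter≡sum : ∀ (f : ℕ → ℝ) t → iter (λ r c → c + f r) 0# t ≡ sum {t} (λ e → f (toℕ e))
      iter≡sum f zero    = refl
      iter≡sum f (suc t) = trans (iter-front f t) (cong (f 0 +_) (iter≡sum (f ∘ suc) t))

      edge-length : ∀ e → dist (p₀ (node (suc e))) (p₀ (node (parent e))) ≡ step-cost i j m (suc (toℕ e))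
      edge-length e = trans (cong₂ δ (toℕ-node (suc e)) (trans (toℕ-node (parent e)) (cong σ (toℕ-parent e))))
        (sym (step-cost-gap (toℕ e) (s≤s (Fin.toℕ<n e))))

      length≡cost : totalLength p graph ≡ cost i j m
      length≡cost = begin
        totalLength p graph                                        ≡⟨ length-p₀ graph ⟩
        totalLength p₀ graph                                       ≡⟨ sum-cong edge-length ⟩
        -- The zero cost of the root is inserted to pass from the `k′` edges to all `k` ranks.
        sum {k′} (λ e → step-cost i j m (suc (toℕ e)))             ≡⟨ +-identityˡ _ ⟨
        0# + sum {k′} (λ e → step-cost i j m (suc (toℕ e)))        ≡⟨ cong (_+ sum {k′} (λ e → step-cost i j m (suc (toℕ e)))) step-cost-zero ⟨
        sum {k} (λ e → step-cost i j m (toℕ e))                    ≡⟨ iter≡sum (step-cost i j m) k ⟨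
        partial k                                                  ≡⟨ cost≡partial k≤n ⟨
        cost i j m                                                 ∎
        where open ≡-Reasoning

    open Built best-i (best-j best-i) (best-m best-i (best-j best-i))
      public
    open Correctness n k X Y
    open Semantics n k X Y
    open Denotations n k X Y

    e<n : (e : Fin k′) → toℕ e ℕ.< n
    e<n e = ℕ.<-trans (Fin.toℕ<n e) k≤n

    bit⇒true : ∀ {b} → (if b then 1 else 0) ≡ 1 → b ≡ true
    bit⇒true {true} _ = refl

    input-ok : InputOK (input p k)
    input-ok = record { n-ok = refl ; k-ok = refl ; X-ok = λ _ → refl ; Y-ok = λ _ → refl }

    Written : State → Set
    Written s = (∀ v → v ℕ.< n → nat s 1 v ≡ ⟦ at-best flagᵗ ⟧ (v ∷ [])) × nat s 2 0 ≡ k′ ×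
                (∀ v → v ℕ.< n → nat s 3 v ≡ ⟦ at-best childᵗ ⟧ (v ∷ [])) ×
                (∀ v → v ℕ.< n → nat s 4 v ≡ ⟦ at-best parentᵗ ⟧ (v ∷ []))

    outputs : ∀ {s} → Written s → Outputs s graph
    outputs {s} (flags , edges , ends₁ , ends₂) = record
      { flags = λ v → mk⇔
          (λ v∈ → trans (flag-value v) (then-branch (∈⇒chosen v∈)))
          (λ eq → chosen⇒∈ (bit⇒true (trans (sym (flag-value v)) eq)))
      ; edge-count = edges
      ; ends₁ = λ e → trans (ends₁ (toℕ e) (e<n e)) (trans
          (⟦at-best⟧ childᵗ (λ i j m e → Order.σ i j m (suc e)) ⟦child⟧ (toℕ e))
          (sym (toℕ-node (suc e))))
      ; ends₂ = λ e → trans (ends₂ (toℕ e) (e<n e)) (trans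
          (⟦at-best⟧ parentᵗ (λ i j m e → Order.σ i j m (nearest i j m (suc e))) ⟦parent⟧ (toℕ e))
          (sym (trans (toℕ-node (parent e)) (cong (Order.σ _ _ _) (toℕ-parent e))))) }
      where
      flag-value : ∀ v → nat s 1 (toℕ v) ≡ (if chosen (toℕ v) then 1 else 0)
      flag-value v = trans (flags (toℕ v) (Fin.toℕ<n v))
        (⟦at-best⟧ flagᵗ (λ i j m v → if leᵇ (suc (Order.rank i j m v)) k then 1 else 0) ⟦flag⟧ (toℕ v))

    run : Σ[ s ∈ State ] (program , input p k ⇓[ runningTime n ] s) × Outputs s graph
    run = with-outputs (writeTree-computes (at-best flagᵗ) (at-best childᵗ) (at-best parentᵗ) input-ok)
      where
      with-outputs : Σ[ s ∈ State ] (program , input p k ⇓[ runningTime n ] s) × Written s →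
                     Σ[ s ∈ State ] (program , input p k ⇓[ runningTime n ] s) × Outputs s graph
      with-outputs (s , execution , written) = s , execution , outputs written

    total≤ : ∀ T* → IsMinimumTreeSpanning p k T* →
             totalLength p graph ≤ ratio * √ (√ (fromℕ k)) * totalLength p T*
    total≤ T* minimal = ≤-trans (≤-reflexive length≡cost)
      (best-ratio T* (IsMinimumTreeSpanning.isTreeSpanning minimal))

theorem1p3 : (R : RealNumbers) → let open RealNumbers R in let open Plane R in
    Σ[ P ∈ Program ] Σ[ c ∈ ℕ ] Σ[ d ∈ ℕ ] Σ[ C ∈ ℝ ]
    ((n : ℕ) (p : Vector Point n) (k : ℕ) → 1 ℕ.≤ k → k ℕ.≤ n →
    Σ[ t ∈ ℕ ] Σ[ s ∈ State ] Σ[ T ∈ Graph n ]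
    (P , input p k ⇓[ t ] s)
    × t ℕ.≤ c ℕ.* n ℕ.^ d
    × Outputs s T
    × IsTree T
    × k ℕ.≤ ∣ Graph.vertices T ∣
    × ((T* : Graph n) → IsMinimumTreeSpanning p k T* →
    totalLength p T ≤ C * √ (√ (fromℕ k)) * totalLength p T*))
theorem1p3 R = program , proj₁ runningTime-polynomial , proj₁ (proj₂ runningTime-polynomial) , ratio , solution
  where
  open RealNumbers R
  open Plane R
  open GridAlgorithm R
  open Approximation R

  solution : (n : ℕ) (p : Vector Point n) (k : ℕ) → 1 ℕ.≤ k → k ℕ.≤ n →
    Σ[ t ∈ ℕ ] Σ[ s ∈ State ] Σ[ T ∈ Graph n ]
    (program , input p k ⇓[ t ] s)
    × t ℕ.≤ proj₁ runningTime-polynomial ℕ.* n ℕ.^ proj₁ (proj₂ runningTime-polynomial)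
    × Outputs s T
    × IsTree T
    × k ℕ.≤ ∣ Graph.vertices T ∣
    × ((T* : Graph n) → IsMinimumTreeSpanning p k T* →
    totalLength p T ≤ ratio * √ (√ (fromℕ k)) * totalLength p T*)
  solution n p (suc k′) 1≤k k≤n =
    runningTime n , proj₁ run , graph , proj₁ (proj₂ run) ,
    -- The polynomial bound asks for `n ≥ 1`, which follows from `1 ≤ k ≤ n`.
    proj₂ (proj₂ runningTime-polynomial) n (ℕ.≤-trans 1≤k k≤n) ,
    proj₂ (proj₂ run) , isTree , size , total≤
    where open Instance p k′ k≤n
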